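{- For any recursively inseparable pair $\langle A,B\rangle$, there is an r.e. theory $U_{\langle A,B\rangle}$ such that $\mathsf{G1}$ holds for $U_{\langle A,B\rangle}$ and $U_{\langle A,B\rangle}\lhd\mathbf R$ (namely the theory $U_{\langle A,B\rangle}$ described below).
   Context: A recursively inseparable pair is a pair $\langle A,B\rangle$ of disjoint r.e. subsets of $\mathbb N$ with no recursive $X\subseteq\mathbb N$ such that $A\subseteq X$ and $X\cap B=\emptyset$. $U_{\langle A,B\rangle}$ is the theory in language $\{\mathbf 0,\mathbf S,\mathbf P\}$ ($\mathbf P$ unary relation, $\overline n=\mathbf S^n\mathbf 0$) with axioms $\overline m\neq\overline n$ ($m\neq n$), $\mathbf P(\overline n)$ ($n\in A$), $\neg\mathbf P(\overline n)$ ($n\in B$). $\mathbf R$ is Robinson's theory in language $\{\mathbf 0,\mathbf S,+,\cdot,\le\}$ ($\le$ primitive) with schemes $\overline m+\overline n=\overline{m+n}$; $\overline m\cdot\overline n=\overline{m\cdot n}$; $\overline m\neq\overline n$ for $m\neq n$; $\forall x(x\le\overline n\to x=\overline 0\vee\dots\vee x=\overline n)$; $\forall x(x\le\overline n\vee\overline n\le x)$. "$\mathsf{G1}$ holds for $T$": for every recursively axiomatizable consistent theory $S$, if $T$ is interpretable in $S$ then $S$ is incomplete. $S\lhd T$: $S$ is interpretable in $T$ but $T$ is not interpretable in $S$ (relative interpretations). -}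

module Defs where

open import Data.Fin using (Fin; zero; suc; toℕ; _↑ˡ_; _↑ʳ_)
open import Data.List using (List; []; _∷_; map)
open import Data.List.Membership.Propositional using (_∈_)
open import Data.Nat using (ℕ; zero; suc; _+_; _*_; _<_)
open import Data.Product using (Σ; Σ-syntax; ∃; ∃-syntax; _×_; _,_)
open import Data.Sum using (_⊎_)
open import Data.Vec as Vec using (Vec; []; _∷_)
open import Function using (_∘_)
open import Function.Bundles using (_⇔_)
open import Relation.Binary.PropositionalEquality using (_≡_; _≢_; refl)
open import Relation.Nullary using (¬_)

private variable
  k l m n : ℕ

data Rec : ℕ → Set where
  zeroᵣ : Rec n
  sucᵣ  : Rec 1
  proj  : Fin n → Rec n
  comp  : Rec k → Vec (Rec n) k → Rec n
  prim  : Rec n → Rec (2 + n) → Rec (1 + n)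
  mu    : Rec (1 + n) → Rec n

infix 4 _·_⇓_ _·_⇓*_

mutual
  data _·_⇓_ : Rec n → Vec ℕ n → ℕ → Set where
    ⇓zero  : {xs : Vec ℕ n} → zeroᵣ · xs ⇓ 0
    ⇓suc   : ∀ {x} → sucᵣ · (x ∷ []) ⇓ suc x
    ⇓proj  : {xs : Vec ℕ n} (i : Fin n) → proj i · xs ⇓ Vec.lookup xs i
    ⇓comp  : {f : Rec k} {gs : Vec (Rec n) k} {xs : Vec ℕ n} {ys : Vec ℕ k} {z : ℕ} →
             gs · xs ⇓* ys → f · ys ⇓ z → comp f gs · xs ⇓ z
    ⇓prim0 : {f : Rec n} {g : Rec (2 + n)} {xs : Vec ℕ n} {z : ℕ} →
             f · xs ⇓ z → prim f g · (0 ∷ xs) ⇓ z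
    ⇓primS : {f : Rec n} {g : Rec (2 + n)} {xs : Vec ℕ n} {x y z : ℕ} →
             prim f g · (x ∷ xs) ⇓ y → g · (x ∷ y ∷ xs) ⇓ z →
             prim f g · (suc x ∷ xs) ⇓ z
    ⇓mu    : {f : Rec (1 + n)} {xs : Vec ℕ n} {y : ℕ} →
             (∀ i → i < y → ∃[ z ] f · (i ∷ xs) ⇓ suc z) →
             f · (y ∷ xs) ⇓ 0 → mu f · xs ⇓ y

  data _·_⇓*_ : Vec (Rec n) k → Vec ℕ n → Vec ℕ k → Set where
    []  : {xs : Vec ℕ n} → [] · xs ⇓* []
    _∷_ : {g : Rec n} {gs : Vec (Rec n) k} {xs : Vec ℕ n} {y : ℕ} {ys : Vec ℕ k} →
          g · xs ⇓ y → gs · xs ⇓* ys → (g ∷ gs) · xs ⇓* (y ∷ ys)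

RecursiveRel : (Vec ℕ k → Set) → Set
RecursiveRel {k} X =
  Σ[ c ∈ Rec k ] ∀ xs → (X xs × c · xs ⇓ 1) ⊎ (¬ X xs × c · xs ⇓ 0)

Recursive : (ℕ → Set) → Set
Recursive X = RecursiveRel {1} (X ∘ Vec.head)

RE : (ℕ → Set) → Set
RE X = Σ[ c ∈ Rec 1 ] ∀ x → X x ⇔ (∃[ y ] c · (x ∷ []) ⇓ y)

record RecursivelyInseparable (A B : ℕ → Set) : Set₁ where
  field
    re-A        : RE A
    re-B        : RE B
    disjoint    : ∀ n → ¬ (A n × B n)
    inseparable : ¬ (Σ[ X ∈ (ℕ → Set) ]
                      Recursive X × (∀ n → A n → X n) × (∀ n → ¬ (X n × B n)))

-- Countable languages, with symbols (sorted by arity) numbered injectively.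
record Language : Set₁ where
  field
    Fun     : ℕ → Set
    Rel     : ℕ → Set
    codeF   : Fun k → ℕ
    codeR   : Rel k → ℕ
    codeF-injective : {f g : Fun k} → codeF f ≡ codeF g → f ≡ g
    codeR-injective : {r s : Rel k} → codeR r ≡ codeR s → r ≡ s

open Language

RecursiveLanguage : Language → Set
RecursiveLanguage L =
    RecursiveRel {2} (λ { (k ∷ c ∷ []) → Σ[ f ∈ Fun L k ] codeF L f ≡ c })
  × RecursiveRel {2} (λ { (k ∷ c ∷ []) → Σ[ r ∈ Rel L k ] codeR L r ≡ c })

-- Terms and formulas with de Bruijn variables in scope n.
data Term (L : Language) (n : ℕ) : Set where
  var : Fin n → Term L n
  fn  : Fun L k → Vec (Term L n) k → Term L n

infix  8 _≐_
infixr 5 _⇒_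

data Formula (L : Language) (n : ℕ) : Set where
  ⊥'  : Formula L n
  _≐_ : Term L n → Term L n → Formula L n
  rel : Rel L k → Vec (Term L n) k → Formula L n
  _⇒_ : Formula L n → Formula L n → Formula L n
  ∀'  : Formula L (suc n) → Formula L n

Sentence : Language → Set
Sentence L = Formula L 0

private variable
  L L′ : Language

infix  9 ¬'_
infixr 7 _∧'_
infixr 6 _∨'_

¬'_ : Formula L n → Formula L n
¬' φ = φ ⇒ ⊥'

_∧'_ _∨'_ : Formula L n → Formula L n → Formula L n
φ ∧' ψ = ¬' (φ ⇒ ¬' ψ)
φ ∨' ψ = ¬' φ ⇒ ψ

⊤' : Formula L n
⊤' = ¬' ⊥'

∃' : Formula L (suc n) → Formula L n
∃' φ = ¬' ∀' (¬' φ)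

⋀ : (Fin k → Formula L n) → Formula L n
⋀ {zero}  φ = ⊤'
⋀ {suc k} φ = φ zero ∧' ⋀ (φ ∘ suc)

infixr 5 _▸_

_▸_ : {X : Set} → X → (Fin k → X) → Fin (suc k) → X
(x ▸ xs) zero    = x
(x ▸ xs) (suc i) = xs i

ε : {X : Set} → Fin 0 → X
ε ()

mutual
  renT : (Fin m → Fin n) → Term L m → Term L n
  renT ρ (var x)   = var (ρ x)
  renT ρ (fn f ts) = fn f (renTs ρ ts)

  renTs : (Fin m → Fin n) → Vec (Term L m) k → Vec (Term L n) k
  renTs ρ []       = []
  renTs ρ (t ∷ ts) = renT ρ t ∷ renTs ρ ts

mutual
  subT : (Fin m → Term L n) → Term L m → Term L n
  subT σ (var x)   = σ x
  subT σ (fn f ts) = fn f (subTs σ ts)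

  subTs : (Fin m → Term L n) → Vec (Term L m) k → Vec (Term L n) k
  subTs σ []       = []
  subTs σ (t ∷ ts) = subT σ t ∷ subTs σ ts

sub : (Fin m → Term L n) → Formula L m → Formula L n
sub σ ⊥'         = ⊥'
sub σ (t ≐ u)    = subT σ t ≐ subT σ u
sub σ (rel r ts) = rel r (subTs σ ts)
sub σ (φ ⇒ ψ)    = sub σ φ ⇒ sub σ ψ
sub σ (∀' φ)     = ∀' (sub (var zero ▸ (renT suc ∘ σ)) φ)

inst : Formula L (suc n) → Term L n → Formula L n
inst φ t = sub (t ▸ var) φ

shift : Formula L n → Formula L (suc n)
shift = sub (var ∘ suc)

-- A theory is given by its set of axioms.
Theory : Language → Set₁
Theory L = Sentence L → Set

-- Classical natural deduction. The rule `nonempty` is needed because in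
-- scope 0 a language without constants has no term to instantiate with.
infix 3 _∣_⊢_

data _∣_⊢_ (T : Theory L) {n : ℕ} (Γ : List (Formula L n)) : Formula L n → Set where
  axiom    : ∀ {φ} → T φ → T ∣ Γ ⊢ sub ε φ
  hyp      : ∀ {φ} → φ ∈ Γ → T ∣ Γ ⊢ φ
  ⇒I       : ∀ {φ ψ} → T ∣ φ ∷ Γ ⊢ ψ → T ∣ Γ ⊢ φ ⇒ ψ
  ⇒E       : ∀ {φ ψ} → T ∣ Γ ⊢ φ ⇒ ψ → T ∣ Γ ⊢ φ → T ∣ Γ ⊢ ψ
  raa      : ∀ {φ} → T ∣ ¬' φ ∷ Γ ⊢ ⊥' → T ∣ Γ ⊢ φ
  ∀I       : ∀ {φ} → T ∣ map shift Γ ⊢ φ → T ∣ Γ ⊢ ∀' φ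
  ∀E       : ∀ {φ} (t : Term L n) → T ∣ Γ ⊢ ∀' φ → T ∣ Γ ⊢ inst φ t
  ≐refl    : (t : Term L n) → T ∣ Γ ⊢ t ≐ t
  ≐subst   : ∀ {t u} (φ : Formula L (suc n)) →
             T ∣ Γ ⊢ t ≐ u → T ∣ Γ ⊢ inst φ t → T ∣ Γ ⊢ inst φ u
  nonempty : T ∣ Γ ⊢ ∃' (var zero ≐ var zero)

infix 3 _⊢_

_⊢_ : Theory L → Sentence L → Set
T ⊢ φ = T ∣ [] ⊢ φ

Consistent : Theory L → Set
Consistent T = ¬ (T ⊢ ⊥')

Complete : Theory L → Set
Complete {L} T = (φ : Sentence L) → (T ⊢ φ) ⊎ (T ⊢ ¬' φ)

-- Read as the negation of completeness; classically this is the existence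
-- of an independent sentence.
Incomplete : Theory L → Set
Incomplete T = ¬ Complete T

triangle : ℕ → ℕ
triangle zero    = 0
triangle (suc n) = suc n + triangle n

-- Cantor's pairing bijection.
pair : ℕ → ℕ → ℕ
pair x y = triangle (x + y) + y

mutual
  codeT : Term L n → ℕ
  codeT         (var x)       = pair 0 (toℕ x)
  codeT {L = L} (fn {k} f ts) = pair 1 (pair k (pair (codeF L f) (codeTs ts)))

  codeTs : Vec (Term L n) k → ℕ
  codeTs []       = 0
  codeTs (t ∷ ts) = suc (pair (codeT t) (codeTs ts))

⌜_⌝ : Formula L n → ℕ
⌜ ⊥' ⌝                   = pair 0 0
⌜ t ≐ u ⌝                = pair 1 (pair (codeT t) (codeT u))
⌜_⌝ {L = L} (rel {k} r ts) = pair 2 (pair k (pair (codeR L r) (codeTs ts)))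
⌜ φ ⇒ ψ ⌝                = pair 3 (pair ⌜ φ ⌝ ⌜ ψ ⌝)
⌜ ∀' φ ⌝                 = pair 4 ⌜ φ ⌝

Codes : Theory L → ℕ → Set
Codes {L} T c = Σ[ φ ∈ Sentence L ] T φ × ⌜ φ ⌝ ≡ c

RETheory : Theory L → Set
RETheory {L} T = RecursiveLanguage L × RE (Codes T)

RecursivelyAxiomatizable : Theory L → Set₁
RecursivelyAxiomatizable {L} T =
    RecursiveLanguage L
  × (Σ[ T′ ∈ Theory L ] Recursive (Codes T′) × (∀ φ → (T ⊢ φ) ⇔ (T′ ⊢ φ)))

-- Relative interpretations: one-dimensional and parameter-free, with a
-- domain formula and equality not necessarily absolute.

record Translation (L L′ : Language) : Set where
  field
    dom  : Formula L′ 1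
    eq   : Formula L′ 2
    relᵗ : Rel L k → Formula L′ k
    -- The graph of f: variable 0 is the value, variable suc i is argument i.
    funᵗ : Fun L k → Formula L′ (suc k)

  Dom : Fin m → Formula L′ m
  Dom x = sub (var ∘ (x ▸ ε)) dom

  Eq : Fin m → Fin m → Formula L′ m
  Eq x y = sub (var ∘ (x ▸ y ▸ ε)) eq

  Relᵗ : Rel L k → (Fin k → Fin m) → Formula L′ m
  Relᵗ r xs = sub (var ∘ xs) (relᵗ r)

  Graph : Fun L k → (Fin k → Fin m) → Fin m → Formula L′ m
  Graph f xs y = sub (var ∘ (y ▸ xs)) (funᵗ f)

  -- Blocks of k quantifiers restricted to the domain, binding the variables
  -- i ↑ˡ m for i : Fin k; an outer variable x becomes k ↑ʳ x.
  ∀ᴰ ∃ᴰ : ∀ k → Formula L′ (k + m) → Formula L′ m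
  ∀ᴰ zero    φ = φ
  ∀ᴰ (suc k) φ = ∀ᴰ k (∀' (Dom zero ⇒ φ))
  ∃ᴰ zero    φ = φ
  ∃ᴰ (suc k) φ = ∃ᴰ k (∃' (Dom zero ∧' φ))

  -- `value ρ t y` says that y is a value of t, with the variables of t
  -- renamed by ρ; nested terms are unravelled with fresh quantified variables.
  mutual
    value : (Fin n → Fin m) → Term L n → Fin m → Formula L′ m
    value         ρ (var x)       y = Eq (ρ x) y
    value {m = m} ρ (fn {k} f ts) y =
      ∃ᴰ k (values ((k ↑ʳ_) ∘ ρ) ts (_↑ˡ m) ∧' Graph f (_↑ˡ m) (k ↑ʳ y))

    values : (Fin n → Fin m) → Vec (Term L n) k → (Fin k → Fin m) → Formula L′ m
    values ρ []       ys = ⊤'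
    values ρ (t ∷ ts) ys = value ρ t (ys zero) ∧' values ρ ts (ys ∘ suc)

  infix 10 _ᵗ

  _ᵗ : Formula L n → Formula L′ n
  ⊥' ᵗ      = ⊥'
  (t ≐ u) ᵗ =
    ∃ᴰ 2 (value (2 ↑ʳ_) t (suc zero) ∧' value (2 ↑ʳ_) u zero ∧' Eq (suc zero) zero)
  _ᵗ {n = n} (rel {k} r ts) =
    ∃ᴰ k (values (k ↑ʳ_) ts (_↑ˡ n) ∧' Relᵗ r (_↑ˡ n))
  (φ ⇒ ψ) ᵗ = φ ᵗ ⇒ ψ ᵗ
  (∀' φ) ᵗ  = ∀' (Dom zero ⇒ φ ᵗ)

module _ {L L′ : Language} (T : Theory L) (S : Theory L′) where

  record IsInterpretation (τ : Translation L L′) : Set where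
    open Translation τ
    field
      domain-nonempty : S ⊢ ∃' (Dom zero)
      eq-refl  : S ⊢ ∀ᴰ 1 (Eq zero zero)
      eq-sym   : S ⊢ ∀ᴰ 2 (Eq (suc zero) zero ⇒ Eq zero (suc zero))
      eq-trans : S ⊢ ∀ᴰ 3 (Eq (suc (suc zero)) (suc zero) ⇒ Eq (suc zero) zero ⇒
                           Eq (suc (suc zero)) zero)
      rel-cong : (r : Rel L k) →
        let xs = λ (i : Fin k) → k ↑ʳ (i ↑ˡ 0)
            ys = λ (i : Fin k) → i ↑ˡ (k + 0)
        in S ⊢ ∀ᴰ k (∀ᴰ k (⋀ (λ i → Eq (xs i) (ys i)) ⇒ Relᵗ r xs ⇒ Relᵗ r ys))
      fun-cong : (f : Fun L k) →
        let xs = λ (i : Fin k) → 2 ↑ʳ (k ↑ʳ (i ↑ˡ 0))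
            ys = λ (i : Fin k) → 2 ↑ʳ (i ↑ˡ (k + 0))
            u  = suc zero
            v  = zero
        in S ⊢ ∀ᴰ k (∀ᴰ k (∀ᴰ 2 (⋀ (λ i → Eq (xs i) (ys i)) ⇒ Eq u v ⇒
                                 Graph f xs u ⇒ Graph f ys v)))
      fun-total : (f : Fun L k) →
        let xs = λ (i : Fin k) → 1 ↑ʳ (i ↑ˡ 0)
        in S ⊢ ∀ᴰ k (∃ᴰ 1 (Graph f xs zero))
      fun-functional : (f : Fun L k) →
        let xs = λ (i : Fin k) → 2 ↑ʳ (i ↑ˡ 0)
            u  = suc zero
            v  = zero
        in S ⊢ ∀ᴰ k (∀ᴰ 2 (Graph f xs u ⇒ Graph f xs v ⇒ Eq u v))
      axioms : (φ : Sentence L) → T φ → S ⊢ φ ᵗ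

  InterpretableIn : Set
  InterpretableIn = Σ[ τ ∈ Translation L L′ ] IsInterpretation τ

infix 4 _⊴_ _⊲_

_⊴_ : Theory L → Theory L′ → Set
T ⊴ S = InterpretableIn T S

_⊲_ : Theory L → Theory L′ → Set
S ⊲ T = S ⊴ T × ¬ (T ⊴ S)

G1 : Theory L → Set₁
G1 T = {L′ : Language} (S : Theory L′) →
       RecursivelyAxiomatizable S → Consistent S → T ⊴ S → Incomplete S

data FunU : ℕ → Set where
  𝟎 : FunU 0
  𝐒 : FunU 1

data RelU : ℕ → Set where
  𝐏 : RelU 1

LU : Language
LU = record
  { Fun = FunU ; Rel = RelU
  ; codeF = λ { 𝟎 → 0 ; 𝐒 → 1 }
  ; codeR = λ { 𝐏 → 0 }
  ; codeF-injective = λ { {f = 𝟎} {𝟎} _ → refl ; {f = 𝐒} {𝐒} _ → refl }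
  ; codeR-injective = λ { {r = 𝐏} {𝐏} _ → refl }
  }

numU : ℕ → Term LU n
numU zero    = fn 𝟎 []
numU (suc m) = fn 𝐒 (numU m ∷ [])

data U (A B : ℕ → Set) : Theory LU where
  distinct : ∀ {m n} → m ≢ n → U A B (¬' (numU m ≐ numU n))
  positive : ∀ {n} → A n → U A B (rel 𝐏 (numU n ∷ []))
  negative : ∀ {n} → B n → U A B (¬' rel 𝐏 (numU n ∷ []))

data FunR : ℕ → Set where
  𝟎 : FunR 0
  𝐒 : FunR 1
  ⊕ : FunR 2
  ⊗ : FunR 2

data RelR : ℕ → Set where
  leq : RelR 2

LR : Language
LR = record
  { Fun = FunR ; Rel = RelR
  ; codeF = λ { 𝟎 → 0 ; 𝐒 → 1 ; ⊕ → 2 ; ⊗ → 3 }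
  ; codeR = λ { leq → 0 }
  ; codeF-injective = λ { {f = 𝟎} {𝟎} _ → refl ; {f = 𝐒} {𝐒} _ → refl
                        ; {f = ⊕} {⊕} _ → refl ; {f = ⊗} {⊗} _ → refl
                        ; {f = ⊕} {⊗} () ; {f = ⊗} {⊕} () }
  ; codeR-injective = λ { {r = leq} {leq} _ → refl }
  }

numR : ℕ → Term LR n
numR zero    = fn 𝟎 []
numR (suc m) = fn 𝐒 (numR m ∷ [])

infix 8 _≤'_

_≤'_ : Term LR n → Term LR n → Formula LR n
t ≤' u = rel leq (t ∷ u ∷ [])

oneOf : ℕ → Term LR m → Formula LR m
oneOf zero    t = t ≐ numR 0
oneOf (suc n) t = oneOf n t ∨' t ≐ numR (suc n)

data 𝐑 : Theory LR where
  add      : ∀ m n → 𝐑 (fn ⊕ (numR m ∷ numR n ∷ []) ≐ numR (m + n))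
  mul      : ∀ m n → 𝐑 (fn ⊗ (numR m ∷ numR n ∷ []) ≐ numR (m * n))
  distinct : ∀ {m n} → m ≢ n → 𝐑 (¬' (numR m ≐ numR n))
  bounded  : ∀ n → 𝐑 (∀' (var zero ≤' numR n ⇒ oneOf n (var zero)))
  compare  : ∀ n → 𝐑 (∀' (var zero ≤' numR n ∨' numR n ≤' var zero))

{-# OPTIONS --safe #-}
module Submission where

-- U is r.e. since its axioms are generated from those of A and B.
--
-- G1: if a complete consistent recursively axiomatized S interprets U, then a
-- search through all derivations decides S ⊢ P(n)ᵗ, and the set of such n
-- separates A from B.
--
-- U ⊴ R: halting of partial recursive functions is expressed by bounded
-- formulas a(w,x), b(w,x) for A and B, which R decides, and P(x) becomes
-- Rosser's ∃w (a(w,x) ∧ ∀v≤w ¬b(v,x)).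
--
-- R ⋬ U: U has the model of infinitely many equally coloured copies of (ℤ, S).
-- A formula of rank r about two points that are far from each other and from 0
-- only sees the colours up to distance r, so it is invariant under swapping
-- two points of the same local type. By the pigeonhole principle this happens
-- to two of the interpreted numerals, but R orders its numerals strictly by ≤.

open import Data.Empty using (⊥)
open import Data.Fin using (Fin; zero; suc; toℕ; fromℕ<; combine; funToFin; finToFun; #_; _↑ˡ_; _↑ʳ_)
open import Data.Fin.Properties using (toℕ-injective; toℕ-fromℕ<; fromℕ<-injective; any?; pigeonhole; combine-injective; finToFun-funToFin)
open import Data.List as List using (List; []; _∷_)
open import Data.List.Membership.Propositional using (_∈_)
open import Data.List.Membership.Propositional.Properties using (∈-map⁺; ∈-map⁻)
open import Data.List.Relation.Unary.All as All using (All; []; _∷_)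
open import Data.List.Relation.Unary.Any using (here; there)
open import Data.Maybe using (Maybe; just; nothing)
open import Data.Nat hiding (compare; equal)
open import Data.Nat.DivMod using ([m+kn]%n≡m%n; m<n⇒m%n≡m; m%n<n; m≡m%n+[m/n]*n)
open import Data.Nat.Properties
open import Data.Nat.Tactic.RingSolver using (solve-∀)
open import Data.Product using (Σ; Σ-syntax; ∃; ∃-syntax; _×_; _,_; proj₁; proj₂; swap)
open import Data.Product.Properties using (≡-dec)
open import Data.Sum as Sum using (_⊎_; inj₁; inj₂)
open import Data.Unit using (⊤; tt)
open import Data.Vec as Vec using (Vec; []; _∷_; lookup)
open import Data.Vec.Properties using (map-∘; map-cong; lookup-map; tabulate-∘; tabulate-cong; tabulate∘lookup)
open import Data.Vec.Relation.Unary.All as VAll using ([]; _∷_)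
open import Data.Vec.Relation.Unary.All.Properties using (lookup⁺)
open import Function using (_∘_; _$_; id; const)
open import Function.Bundles using (_⇔_; mk⇔; Equivalence)
open import Relation.Binary.Definitions using (tri<; tri≈; tri>)
open import Relation.Binary.PropositionalEquality using (_≡_; _≢_; _≗_; refl; sym; trans; cong; cong₂; subst; subst₂; module ≡-Reasoning)
open import Relation.Nullary using (¬_; Dec; yes; no; contradiction)
open import Relation.Nullary.Decidable using (map′; _×-dec_; _⊎-dec_; ¬?; decidable-stable; ¬¬-excluded-middle)
open import Defs

private variable
  k l m n n′ : ℕ
  L : Language

-- Computable functions

mutual
  ⇓-deterministic : {c : Rec n} {xs : Vec ℕ n} {y z : ℕ} → c · xs ⇓ y → c · xs ⇓ z → y ≡ z
  ⇓-deterministic ⇓zero ⇓zero = refl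
  ⇓-deterministic ⇓suc ⇓suc = refl
  ⇓-deterministic (⇓proj i) (⇓proj .i) = refl
  ⇓-deterministic (⇓comp gs f) (⇓comp gs′ f′) with ⇓*-deterministic gs gs′
  ... | refl = ⇓-deterministic f f′
  ⇓-deterministic (⇓prim0 f) (⇓prim0 f′) = ⇓-deterministic f f′
  ⇓-deterministic (⇓primS p g) (⇓primS p′ g′) with ⇓-deterministic p p′
  ... | refl = ⇓-deterministic g g′
  ⇓-deterministic (⇓mu {y = y} below at) (⇓mu {y = z} below′ at′) with <-cmp y z
  ... | tri≈ _ y≡z _ = y≡z
  ... | tri< y<z _ _ = contradiction (⇓-deterministic at (proj₂ (below′ y y<z))) λ ()
  ... | tri> _ _ z<y = contradiction (⇓-deterministic (proj₂ (below z z<y)) at′) λ ()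

  ⇓*-deterministic : {cs : Vec (Rec n) k} {xs : Vec ℕ n} {ys zs : Vec ℕ k} →
                     cs · xs ⇓* ys → cs · xs ⇓* zs → ys ≡ zs
  ⇓*-deterministic [] [] = refl
  ⇓*-deterministic (c ∷ cs) (c′ ∷ cs′) = cong₂ _∷_ (⇓-deterministic c c′) (⇓*-deterministic cs cs′)

record Fn (n : ℕ) : Set where
  constructor mkFn
  field
    code     : Rec n
    fun      : Vec ℕ n → ℕ
    computes : ∀ xs → code · xs ⇓ fun xs

open Fn public


respec : (f : Fn n) (g : Vec ℕ n → ℕ) → (∀ xs → fun f xs ≡ g xs) → Fn n
respec f g f≗g = mkFn (code f) g λ xs → subst (code f · xs ⇓_) (f≗g xs) (computes f xs)

π : Fin n → Fn n
π i = mkFn (proj i) (λ xs → lookup xs i) λ _ → ⇓proj i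

compose : Fn k → Vec (Fn n) k → Fn n
compose {k} {n} f gs = mkFn (comp (code f) (Vec.map code gs)) (λ xs → fun f (Vec.map (λ g → fun g xs) gs))
  λ xs → ⇓comp (all gs xs) (computes f _)
  where
  all : ∀ {j} (gs : Vec (Fn n) j) xs → Vec.map code gs · xs ⇓* Vec.map (λ g → fun g xs) gs
  all [] xs = []
  all (g ∷ gs) xs = computes g xs ∷ all gs xs

infixr 8 _⟨_⟩ _⟨_⨾_⟩ _⟨_⨾_⨾_⟩

_⟨_⟩ : Fn 1 → Fn n → Fn n
f ⟨ g ⟩ = compose f (g ∷ [])

_⟨_⨾_⟩ : Fn 2 → Fn n → Fn n → Fn n
f ⟨ g ⨾ h ⟩ = compose f (g ∷ h ∷ [])

_⟨_⨾_⨾_⟩ : Fn 3 → Fn n → Fn n → Fn n → Fn n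
f ⟨ g ⨾ h ⨾ i ⟩ = compose f (g ∷ h ∷ i ∷ [])

sucᶠ : Fn 1
sucᶠ = mkFn sucᵣ (λ { (x ∷ []) → suc x }) λ { (x ∷ []) → ⇓suc }

constᵣ : ℕ → Rec n
constᵣ zero    = zeroᵣ
constᵣ (suc c) = comp sucᵣ (constᵣ c ∷ [])

constᶠ : ℕ → Fn n
constᶠ {n} c = mkFn (constᵣ c) (λ _ → c) (go c)
  where
  go : ∀ c (xs : Vec ℕ n) → constᵣ c · xs ⇓ c
  go zero    xs = ⇓zero
  go (suc c) xs = ⇓comp (go c xs ∷ []) ⇓suc

recursion : (Vec ℕ n → ℕ) → (Vec ℕ (2 + n) → ℕ) → Vec ℕ (1 + n) → ℕ
recursion f g (zero ∷ xs)  = f xs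
recursion f g (suc x ∷ xs) = g (x ∷ recursion f g (x ∷ xs) ∷ xs)

recᶠ : Fn n → Fn (2 + n) → Fn (1 + n)
recᶠ {n} f g = mkFn (prim (code f) (code g)) (recursion (fun f) (fun g)) go
  where
  go : (xs : Vec ℕ (1 + n)) → prim (code f) (code g) · xs ⇓ recursion (fun f) (fun g) xs
  go (zero ∷ xs)  = ⇓prim0 (computes f xs)
  go (suc x ∷ xs) = ⇓primS (go (x ∷ xs)) (computes g _)

addᶠ : Fn 2
addᶠ = respec (recᶠ (π (# 0)) (sucᶠ ⟨ π (# 1) ⟩)) (λ { (x ∷ y ∷ []) → x + y })
  λ { (x ∷ y ∷ []) → go x y }
  where
  go : ∀ x y → _ ≡ x + y
  go zero    y = refl
  go (suc x) y = cong suc (go x y)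

predᶠ : Fn 1
predᶠ = respec (recᶠ (constᶠ 0) (π (# 0))) (λ { (x ∷ []) → pred x })
  λ { (zero ∷ []) → refl ; (suc x ∷ []) → refl }

monusᶠ : Fn 2
monusᶠ = respec (recᶠ (π (# 0)) (predᶠ ⟨ π (# 1) ⟩) ⟨ π (# 1) ⨾ π (# 0) ⟩)
  (λ { (x ∷ y ∷ []) → x ∸ y }) λ { (x ∷ y ∷ []) → go x y }
  where
  go : ∀ x y → _ ≡ x ∸ y
  go x zero    = refl
  go x (suc y) = trans (cong pred (go x y)) (pred[m∸n]≡m∸[1+n] x y)

-- Truth values are numbers, with 0 for false and anything else for true.
caseᶠ : Fn 3
caseᶠ = recᶠ (π (# 1)) (π (# 2))

not : ℕ → ℕ
not zero    = 1
not (suc _) = 0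

notᶠ : Fn 1
notᶠ = respec (recᶠ (constᶠ 1) (constᶠ 0)) (λ { (x ∷ []) → not x })
  λ { (zero ∷ []) → refl ; (suc x ∷ []) → refl }

eqᵇ : ℕ → ℕ → ℕ
eqᵇ x y = not ((x ∸ y) + (y ∸ x))

eqᶠ : Fn 2
eqᶠ = respec (notᶠ ⟨ addᶠ ⟨ monusᶠ ⨾ monusᶠ ⟨ π (# 1) ⨾ π (# 0) ⟩ ⟩ ⟩)
  (λ { (x ∷ y ∷ []) → eqᵇ x y }) λ { (x ∷ y ∷ []) → refl }

eqᵇ-refl : ∀ x → eqᵇ x x ≡ 1
eqᵇ-refl x rewrite n∸n≡0 x = refl

≡⇒eqᵇ : ∀ {x y} → x ≡ y → eqᵇ x y ≡ 1
≡⇒eqᵇ {x} refl = eqᵇ-refl x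

eqᵇ⇒≡ : ∀ {x y} → eqᵇ x y ≢ 0 → x ≡ y
eqᵇ⇒≡ {x} {y} ne with (x ∸ y) + (y ∸ x) in eq
... | suc _ = contradiction refl ne
... | zero  = ≤-antisym (m∸n≡0⇒m≤n (m+n≡0⇒m≡0 _ eq)) (m∸n≡0⇒m≤n (m+n≡0⇒n≡0 (x ∸ y) eq))

≢⇒eqᵇ : ∀ {x y} → x ≢ y → eqᵇ x y ≡ 0
≢⇒eqᵇ {x} {y} x≢y with eqᵇ x y in eq
... | zero  = refl
... | suc _ = contradiction (eqᵇ⇒≡ λ z → 0≢1+n (trans (sym z) eq)) x≢y

-- Pairing and lists

triangleᶠ : Fn 1
triangleᶠ = respec (recᶠ (constᶠ 0) (addᶠ ⟨ sucᶠ ⟨ π (# 0) ⟩ ⨾ π (# 1) ⟩))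
  (λ { (x ∷ []) → triangle x }) λ { (x ∷ []) → go x }
  where
  go : ∀ x → _ ≡ triangle x
  go zero    = refl
  go (suc x) = cong (suc x +_) (go x)

-- Unfolding pair on literals blows up terms, so the pairing is kept abstract.
abstract
  ⟪_,_⟫ : ℕ → ℕ → ℕ
  ⟪ x , y ⟫ = pair x y

  ⟪⟫≡pair : ∀ x y → ⟪ x , y ⟫ ≡ pair x y
  ⟪⟫≡pair x y = refl

pairᶠ : Fn 2
pairᶠ = respec (addᶠ ⟨ triangleᶠ ⟨ addᶠ ⟩ ⨾ π (# 1) ⟩) (λ { (x ∷ y ∷ []) → ⟪ x , y ⟫ })
  λ { (x ∷ y ∷ []) → sym (⟪⟫≡pair x y) }

-- The largest r with triangle r ≤ z.
root : ℕ → ℕ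
root zero    = 0
root (suc z) = root z + eqᵇ (suc z) (triangle (suc (root z)))

rootᶠ : Fn 1
rootᶠ = respec (recᶠ (constᶠ 0) (addᶠ ⟨ π (# 1) ⨾ eqᶠ ⟨ sucᶠ ⟨ π (# 0) ⟩ ⨾ triangleᶠ ⟨ sucᶠ ⟨ π (# 1) ⟩ ⟩ ⟩ ⟩))
  (λ { (x ∷ []) → root x }) λ { (x ∷ []) → go x }
  where
  go : ∀ x → _ ≡ root x
  go zero    = refl
  go (suc x) = cong (λ r → r + eqᵇ (suc x) (triangle (suc r))) (go x)

root-bounds : ∀ z → triangle (root z) ≤ z × z < triangle (suc (root z))
root-bounds zero = z≤n , s≤s z≤n
root-bounds (suc z) with root-bounds z | suc z ≟ triangle (suc (root z))
... | lo , hi | yes eq rewrite ≡⇒eqᵇ eq | +-comm (root z) 1 =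
  ≤-reflexive (sym eq) , s≤s (≤-trans (≤-reflexive eq) (m≤n+m _ (suc (root z))))
... | lo , hi | no neq rewrite ≢⇒eqᵇ neq | +-identityʳ (root z) =
  m≤n⇒m≤1+n lo , ≤∧≢⇒< hi neq

triangle-mono : ∀ {x y} → x ≤ y → triangle x ≤ triangle y
triangle-mono z≤n       = z≤n
triangle-mono (s≤s x≤y) = +-mono-≤ (s≤s x≤y) (triangle-mono x≤y)

root-unique : ∀ {z r} → triangle r ≤ z → z < triangle (suc r) → root z ≡ r
root-unique {z} {r} lo hi with root-bounds z | <-cmp (root z) r
... | lo′ , hi′ | tri≈ _ eq _ = eq
... | lo′ , hi′ | tri< lt _ _ = contradiction (<-≤-trans hi′ (≤-trans (triangle-mono lt) lo)) (<-irrefl refl)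
... | lo′ , hi′ | tri> _ _ gt = contradiction (<-≤-trans hi (≤-trans (triangle-mono gt) lo′)) (<-irrefl refl)

root-pair : ∀ x y → root (pair x y) ≡ x + y
root-pair x y = root-unique (m≤m+n _ y) $ s≤s $
  subst (triangle (x + y) + y ≤_) (+-comm (triangle (x + y)) (x + y)) (+-monoʳ-≤ (triangle (x + y)) (m≤n+m y x))

abstract
  fst snd : ℕ → ℕ
  snd z = z ∸ triangle (root z)
  fst z = root z ∸ snd z

  snd-unfold : ∀ z → z ∸ triangle (root z) ≡ snd z
  snd-unfold z = refl

  fst-unfold : ∀ z → root z ∸ snd z ≡ fst z
  fst-unfold z = refl

sndᶠ fstᶠ : Fn 1
sndᶠ = respec (monusᶠ ⟨ π (# 0) ⨾ triangleᶠ ⟨ rootᶠ ⟩ ⟩) (λ { (z ∷ []) → snd z }) λ { (z ∷ []) → snd-unfold z }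
fstᶠ = respec (monusᶠ ⟨ rootᶠ ⨾ sndᶠ ⟩) (λ { (z ∷ []) → fst z }) λ { (z ∷ []) → fst-unfold z }

snd-pair : ∀ x y → snd ⟪ x , y ⟫ ≡ y
snd-pair x y rewrite sym (snd-unfold ⟪ x , y ⟫) | ⟪⟫≡pair x y | root-pair x y = m+n∸m≡n (triangle (x + y)) y

fst-pair : ∀ x y → fst ⟪ x , y ⟫ ≡ x
fst-pair x y rewrite sym (fst-unfold ⟪ x , y ⟫) | snd-pair x y | ⟪⟫≡pair x y | root-pair x y = m+n∸n≡m x y

pair-injective : ∀ {x y x′ y′} → ⟪ x , y ⟫ ≡ ⟪ x′ , y′ ⟫ → x ≡ x′ × y ≡ y′
pair-injective {x} {y} {x′} {y′} eq =
  trans (sym (fst-pair x y)) (trans (cong fst eq) (fst-pair x′ y′)) ,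
  trans (sym (snd-pair x y)) (trans (cong snd eq) (snd-pair x′ y′))

y≤pair : ∀ x y → y ≤ ⟪ x , y ⟫
y≤pair x y rewrite ⟪⟫≡pair x y = m≤n+m y _

encode : List ℕ → ℕ
encode []       = 0
encode (x ∷ xs) = suc (⟪ x , encode xs ⟫)

tail : ℕ → ℕ
tail l = snd (pred l)

tails : ℕ → ℕ → ℕ
tails zero    l = l
tails (suc i) l = tail (tails i l)

tailᶠ : Fn 1
tailᶠ = respec (sndᶠ ⟨ predᶠ ⟩) (λ { (l ∷ []) → tail l }) λ { (l ∷ []) → refl }

tailsᶠ : Fn 2
tailsᶠ = respec (recᶠ (π (# 0)) (tailᶠ ⟨ π (# 1) ⟩)) (λ { (i ∷ l ∷ []) → tails i l })
  λ { (i ∷ l ∷ []) → go i l }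
  where
  go : ∀ i l → _ ≡ tails i l
  go zero    l = refl
  go (suc i) l = cong tail (go i l)

headIs : ℕ → ℕ → ℕ
headIs c l = eqᵇ l (suc ⟪ c , tail l ⟫)

headIsᶠ : Fn 2
headIsᶠ = respec (eqᶠ ⟨ π (# 1) ⨾ sucᶠ ⟨ pairᶠ ⟨ π (# 0) ⨾ tailᶠ ⟨ π (# 1) ⟩ ⟩ ⟩ ⟩)
  (λ { (c ∷ l ∷ []) → headIs c l }) λ { (c ∷ l ∷ []) → refl }

occurs : ℕ → ℕ → ℕ → ℕ
occurs zero    c l = 0
occurs (suc i) c l = occurs i c l + headIs c (tails i l)

occursᶠ : Fn 3
occursᶠ = respec (recᶠ (constᶠ 0) (addᶠ ⟨ π (# 1) ⨾ headIsᶠ ⟨ π (# 2) ⨾ tailsᶠ ⟨ π (# 0) ⨾ π (# 3) ⟩ ⟩ ⟩))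
  (λ { (i ∷ c ∷ l ∷ []) → occurs i c l }) λ { (i ∷ c ∷ l ∷ []) → go i c l }
  where
  go : ∀ i c l → _ ≡ occurs i c l
  go zero    c l = refl
  go (suc i) c l = cong (_+ headIs c (tails i l)) (go i c l)

member : ℕ → ℕ → ℕ
member c l = occurs l c l

memberᶠ : Fn 2
memberᶠ = respec (occursᶠ ⟨ π (# 1) ⨾ π (# 0) ⨾ π (# 1) ⟩) (λ { (c ∷ l ∷ []) → member c l })
  λ { (c ∷ l ∷ []) → refl }

tail-encode : ∀ xs → tail (encode xs) ≡ encode (List.drop 1 xs)
tail-encode []       = sym (snd-unfold 0)
tail-encode (x ∷ xs) = snd-pair x (encode xs)

tails-encode : ∀ i xs → tails i (encode xs) ≡ encode (List.drop i xs)
tails-encode zero    xs = refl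
tails-encode (suc i) xs rewrite tails-encode i xs | tail-encode (List.drop i xs) =
  cong encode (drop-drop i xs)
  where
  drop-drop : ∀ i (xs : List ℕ) → List.drop 1 (List.drop i xs) ≡ List.drop (suc i) xs
  drop-drop zero    xs       = refl
  drop-drop (suc i) []       = refl
  drop-drop (suc i) (x ∷ xs) = drop-drop i xs

headIs-sound : ∀ c xs → headIs c (encode xs) ≢ 0 → c ∈ xs
headIs-sound c xs h with xs | eqᵇ⇒≡ {encode xs} h
... | x ∷ _ | eq = here (sym (proj₁ (pair-injective (suc-injective eq))))

drop-⊆ : ∀ {c} i (xs : List ℕ) → c ∈ List.drop i xs → c ∈ xs
drop-⊆ zero    xs       c∈ = c∈
drop-⊆ (suc i) (x ∷ xs) c∈ = there (drop-⊆ i xs c∈)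

occurs-sound : ∀ i c xs → occurs i c (encode xs) ≢ 0 → c ∈ xs
occurs-sound zero    c xs h = contradiction refl h
occurs-sound (suc i) c xs h with occurs i c (encode xs) in eq
... | suc _ = occurs-sound i c xs λ z → 0≢1+n (trans (sym z) eq)
... | zero  = drop-⊆ i xs (headIs-sound c _ (subst (λ l → headIs c l ≢ 0) (tails-encode i xs) h))

member-sound : ∀ {c xs} → member c (encode xs) ≢ 0 → c ∈ xs
member-sound {c} {xs} = occurs-sound (encode xs) c xs

position : ∀ {c} {xs : List ℕ} → c ∈ xs → ∃[ i ] i < encode xs × ∃[ ys ] List.drop i xs ≡ c ∷ ys
position {xs = x ∷ xs} (here refl) = 0 , s≤s z≤n , xs , refl
position {xs = x ∷ xs} (there c∈) with position c∈
... | i , i< , ys , eq = suc i , s≤s (≤-trans i< (y≤pair x _)) , ys , eq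

occurs-complete : ∀ {i j} c l → i < j → headIs c (tails i l) ≢ 0 → occurs j c l ≢ 0
occurs-complete {i} {suc j} c l i<1+j h z with i ≟ j
... | yes refl = h (m+n≡0⇒n≡0 (occurs i c l) z)
... | no i≢j   = occurs-complete c l (≤∧≢⇒< (s≤s⁻¹ i<1+j) i≢j) h (m+n≡0⇒m≡0 _ z)

member-complete : ∀ {c xs} → c ∈ xs → member c (encode xs) ≢ 0
member-complete {c} {xs} c∈ with position c∈
... | i , i< , ys , eq = occurs-complete c (encode xs) i< at
  where
  at : headIs c (tails i (encode xs)) ≢ 0
  at rewrite tails-encode i xs | eq | snd-pair c (encode ys) | eqᵇ-refl ⟪ c , encode ys ⟫ = λ ()

-- Unbounded search

least : (f : ℕ → ℕ) → ∀ b → f b ≡ 0 → ∃[ y ] f y ≡ 0 × (∀ i → i < y → f i ≢ 0)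
least f zero    z = 0 , z , λ _ ()
least f (suc b) z with f 0 ≟ 0
... | yes z₀ = 0 , z₀ , λ _ ()
... | no nz with least (f ∘ suc) b z
...   | y , fy , below = suc y , fy , λ { zero _ → nz ; (suc i) (s≤s i<y) → below i i<y }

search⇓ : (f : Fn (suc n)) (xs : Vec ℕ n) → ∀ b → fun f (b ∷ xs) ≡ 0 →
          ∃[ y ] mu (code f) · xs ⇓ y × fun f (y ∷ xs) ≡ 0
search⇓ f xs b z with least (λ i → fun f (i ∷ xs)) b z
... | y , fy , below = y , ⇓mu nonzero (subst (code f · _ ⇓_) fy (computes f _)) , fy
  where
  nonzero : ∀ i → i < y → ∃[ z ] code f · (i ∷ xs) ⇓ suc z
  nonzero i i<y with fun f (i ∷ xs) | below i i<y | computes f (i ∷ xs)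
  ... | zero  | nz | _ = contradiction refl nz
  ... | suc z | _  | d = z , d

search-found : (f : Fn (suc n)) (xs : Vec ℕ n) → ∀ {y} → mu (code f) · xs ⇓ y → fun f (y ∷ xs) ≡ 0
search-found f xs (⇓mu _ at) = ⇓-deterministic (computes f _) at

-- Horn clauses over codes

decodeVec : ∀ k → ℕ → Vec ℕ k
decodeVec zero    w = []
decodeVec (suc k) w = fst w ∷ decodeVec k (snd w)

encodeVec : Vec ℕ k → ℕ
encodeVec []       = 0
encodeVec (x ∷ xs) = ⟪ x , encodeVec xs ⟫

decode-encode : (xs : Vec ℕ k) → decodeVec k (encodeVec xs) ≡ xs
decode-encode []       = refl
decode-encode (x ∷ xs) rewrite fst-pair x (encodeVec xs) | snd-pair x (encodeVec xs) = cong (x ∷_) (decode-encode xs)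

encodeVec-injective : (xs ys : Vec ℕ k) → encodeVec xs ≡ encodeVec ys → xs ≡ ys
encodeVec-injective {k} xs ys eq = trans (sym (decode-encode xs)) (trans (cong (decodeVec k) eq) (decode-encode ys))

componentᶠ : Fin k → Fn 1
componentᶠ {k} i = respec (go i) (λ { (w ∷ []) → lookup (decodeVec k w) i }) λ { (w ∷ []) → spec i w }
  where
  go : ∀ {k} → Fin k → Fn 1
  go zero    = fstᶠ
  go (suc i) = go i ⟨ sndᶠ ⟩
  spec : ∀ {k} (i : Fin k) w → fun (go i) (w ∷ []) ≡ lookup (decodeVec k w) i
  spec zero    w = refl
  spec (suc i) w = spec i (snd w)

onCode : Fn k → Fn 1
onCode {k} f = respec (compose f (Vec.tabulate componentᶠ)) (λ { (w ∷ []) → fun f (decodeVec k w) })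
  λ { (w ∷ []) → cong (fun f) (spec w) }
  where
  spec : ∀ w → Vec.map (λ g → fun g (w ∷ [])) (Vec.tabulate componentᶠ) ≡ decodeVec k w
  spec w = trans (sym (tabulate-∘ (λ g → fun g (w ∷ [])) componentᶠ)) (tabulate∘lookup (decodeVec k w))

data Exp (k : ℕ) : Set where
  ‵_   : Fin k → Exp k
  lit  : ℕ → Exp k
  succ : Exp k → Exp k
  _&_  : Exp k → Exp k → Exp k

infixr 5 _&_
infix 9 ‵_

evalE : Exp k → Vec ℕ k → ℕ
evalE (‵ i)    xs = lookup xs i
evalE (lit c)  xs = c
evalE (succ e) xs = suc (evalE e xs)
evalE (d & e)  xs = ⟪ evalE d xs , evalE e xs ⟫

expᶠ : Exp k → Fn k
expᶠ e = respec (go e) (evalE e) (spec e)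
  where
  go : Exp k → Fn k
  go (‵ i)    = π i
  go (lit c)  = constᶠ c
  go (succ e) = sucᶠ ⟨ go e ⟩
  go (d & e)  = pairᶠ ⟨ go d ⨾ go e ⟩
  spec : (e : Exp k) (xs : Vec ℕ k) → fun (go e) xs ≡ evalE e xs
  spec (‵ i)    xs = refl
  spec (lit c)  xs = refl
  spec (succ e) xs = cong suc (spec e xs)
  spec (d & e)  xs = cong₂ ⟪_,_⟫ (spec d xs) (spec e xs)

andᶠ : Fn 2
andᶠ = caseᶠ ⟨ π (# 0) ⨾ π (# 1) ⨾ constᶠ 0 ⟩

and-elimˡ : ∀ x y → fun andᶠ (x ∷ y ∷ []) ≢ 0 → x ≢ 0
and-elimˡ zero    y h = h
and-elimˡ (suc x) y h = λ ()

and-elimʳ : ∀ x y → fun andᶠ (x ∷ y ∷ []) ≢ 0 → y ≢ 0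
and-elimʳ zero    y h = contradiction refl h
and-elimʳ (suc x) y h = h

and-intro : ∀ x y → x ≢ 0 → y ≢ 0 → fun andᶠ (x ∷ y ∷ []) ≢ 0
and-intro zero    y hx hy = hx
and-intro (suc x) y hx hy = hy

module Horn {Tag : Set} (tagCode : Tag → ℕ) (tagCode-injective : ∀ {s t} → tagCode s ≡ tagCode t → s ≡ t) where

  infix 2 _∙_ _⊢ʰ_

  record Judgment : Set where
    constructor _∙_
    field
      tag  : Tag
      args : Vec ℕ 3

  record Atom (k : ℕ) : Set where
    constructor atom
    field
      tag  : Tag
      args : Vec (Exp k) 3

  record Rule : Set where
    constructor rule
    field
      arity      : ℕ
      premises   : List (Atom arity)
      side       : Fn arity
      conclusion : Atom arity

  open Rule

  evalA : Vec ℕ k → Atom k → Judgment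
  evalA xs (atom t es) = t ∙ Vec.map (λ e → evalE e xs) es

  codeJ : Judgment → ℕ
  codeJ (t ∙ xs) = ⟪ tagCode t , encodeVec xs ⟫

  codeJ-injective : ∀ {i j} → codeJ i ≡ codeJ j → i ≡ j
  codeJ-injective {s ∙ xs} {t ∙ ys} eq
    with tagCode-injective {s} {t} (proj₁ (pair-injective eq))
       | encodeVec-injective xs ys (proj₂ (pair-injective eq))
  ... | refl | refl = refl

  data _⊢ʰ_ (rules : Vec Rule n) : Judgment → Set where
    step : (i : Fin n) → let r = lookup rules i in
           (xs : Vec ℕ (arity r)) → All (rules ⊢ʰ_) (List.map (evalA xs) (premises r)) →
           fun (side r) xs ≢ 0 → rules ⊢ʰ evalA xs (conclusion r)

  Preserves : (Judgment → Set) → Rule → Set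
  Preserves P r = ∀ xs → All P (List.map (evalA xs) (premises r)) → fun (side r) xs ≢ 0 →
                  P (evalA xs (conclusion r))

  module _ {rules : Vec Rule n} {P : Judgment → Set} (closed : ∀ i → Preserves P (lookup rules i)) where
    mutual
      ⊢ʰ-induction : ∀ {j} → rules ⊢ʰ j → P j
      ⊢ʰ-induction (step i xs ds s) = closed i xs (⊢ʰ-inductions ds) s

      ⊢ʰ-inductions : ∀ {js} → All (rules ⊢ʰ_) js → All P js
      ⊢ʰ-inductions []       = []
      ⊢ʰ-inductions (d ∷ ds) = ⊢ʰ-induction d ∷ ⊢ʰ-inductions ds

  atomᶠ : Atom k → Fn k
  atomᶠ a = respec (go a) (λ xs → codeJ (evalA xs a)) (spec a)
    where
    go : Atom k → Fn k
    go (atom t (d ∷ e ∷ f ∷ [])) =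
      pairᶠ ⟨ constᶠ (tagCode t) ⨾ pairᶠ ⟨ expᶠ d ⨾ pairᶠ ⟨ expᶠ e ⨾ pairᶠ ⟨ expᶠ f ⨾ constᶠ 0 ⟩ ⟩ ⟩ ⟩
    spec : ∀ a xs → fun (go a) xs ≡ codeJ (evalA xs a)
    spec (atom t (d ∷ e ∷ f ∷ [])) xs = refl

  -- All functions below take the code of an instance of the variables and
  -- the encoded list of what has been derived so far.
  presentᶠ : List (Atom k) → Fn 2
  presentᶠ []       = constᶠ 1
  presentᶠ (a ∷ as) = andᶠ ⟨ memberᶠ ⟨ onCode (atomᶠ a) ⟨ π (# 0) ⟩ ⨾ π (# 1) ⟩ ⨾ presentᶠ as ⟩

  present-sound : ∀ {w l} (as : List (Atom k)) → fun (presentᶠ as) (w ∷ encode l ∷ []) ≢ 0 →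
                  All (λ j → codeJ j ∈ l) (List.map (evalA (decodeVec k w)) as)
  present-sound []       h = []
  present-sound {k} {w} {l} (a ∷ as) h = member-sound {xs = l} (and-elimˡ x y h) ∷ present-sound as (and-elimʳ x y h)
    where
    x = member (codeJ (evalA (decodeVec k w) a)) (encode l)
    y = fun (presentᶠ as) (w ∷ encode l ∷ [])

  present-complete : ∀ {w l} (as : List (Atom k)) →
                     All (λ j → codeJ j ∈ l) (List.map (evalA (decodeVec k w)) as) →
                     fun (presentᶠ as) (w ∷ encode l ∷ []) ≢ 0
  present-complete []       _ = λ ()
  present-complete {k} {w} {l} (a ∷ as) (h ∷ hs) =
    and-intro _ (fun (presentᶠ as) (w ∷ encode l ∷ [])) (member-complete h) (present-complete as hs)

  firesᶠ : Rule → Fn 2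
  firesᶠ r = andᶠ ⟨ onCode (side r) ⟨ π (# 0) ⟩ ⨾ presentᶠ (premises r) ⟩

  result : Rule → ℕ → Judgment
  result r w = evalA (decodeVec (arity r) w) (conclusion r)

  applyᶠ : Rule → Fn 2
  applyᶠ r = caseᶠ ⟨ firesᶠ r ⨾ sucᶠ ⟨ pairᶠ ⟨ onCode (atomᶠ (conclusion r)) ⟨ π (# 0) ⟩ ⨾ π (# 1) ⟩ ⟩ ⨾ π (# 1) ⟩

  apply : Rule → ℕ → List ℕ → List ℕ
  apply r w l with fun (firesᶠ r) (w ∷ encode l ∷ [])
  ... | zero  = l
  ... | suc _ = codeJ (result r w) ∷ l

  apply-spec : ∀ r w l → fun (applyᶠ r) (w ∷ encode l ∷ []) ≡ encode (apply r w l)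
  apply-spec r w l with fun (firesᶠ r) (w ∷ encode l ∷ [])
  ... | zero  = refl
  ... | suc _ = refl

  applyAllᶠ : Vec Rule n → Fn 2
  applyAllᶠ []       = π (# 1)
  applyAllᶠ (r ∷ rs) = applyᶠ r ⟨ π (# 0) ⨾ applyAllᶠ rs ⟩

  applyAll : Vec Rule n → ℕ → List ℕ → List ℕ
  applyAll []       w l = l
  applyAll (r ∷ rs) w l = apply r w (applyAll rs w l)

  applyAll-spec : ∀ (rs : Vec Rule n) w l → fun (applyAllᶠ rs) (w ∷ encode l ∷ []) ≡ encode (applyAll rs w l)
  applyAll-spec []       w l = refl
  applyAll-spec (r ∷ rs) w l rewrite applyAll-spec rs w l = apply-spec r w (applyAll rs w l)

  apply-⊆ : ∀ r w l {c} → c ∈ l → c ∈ apply r w l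
  apply-⊆ r w l c∈ with fun (firesᶠ r) (w ∷ encode l ∷ [])
  ... | zero  = c∈
  ... | suc _ = there c∈

  applyAll-⊆ : ∀ (rs : Vec Rule n) w l {c} → c ∈ l → c ∈ applyAll rs w l
  applyAll-⊆ []       w l c∈ = c∈
  applyAll-⊆ (r ∷ rs) w l c∈ = apply-⊆ r w _ (applyAll-⊆ rs w l c∈)

  apply-complete : ∀ r w l → fun (side r) (decodeVec _ w) ≢ 0 →
                   All (λ j → codeJ j ∈ l) (List.map (evalA (decodeVec _ w)) (premises r)) →
                   codeJ (result r w) ∈ apply r w l
  apply-complete r w l s ps
    with fun (firesᶠ r) (w ∷ encode l ∷ [])
       | and-intro (fun (side r) (decodeVec _ w)) (fun (presentᶠ (premises r)) (w ∷ encode l ∷ []))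
                   s (present-complete (premises r) ps)
  ... | zero  | nz = contradiction refl nz
  ... | suc _ | _  = here refl

  applyAll-complete : ∀ (rs : Vec Rule n) i w l → let r = lookup rs i in
                      fun (side r) (decodeVec _ w) ≢ 0 →
                      All (λ j → codeJ j ∈ l) (List.map (evalA (decodeVec _ w)) (premises r)) →
                      codeJ (result r w) ∈ applyAll rs w l
  applyAll-complete (r ∷ rs) zero    w l s ps = apply-complete r w _ s (All.map (applyAll-⊆ rs w l) ps)
  applyAll-complete (r ∷ rs) (suc i) w l s ps = apply-⊆ r w _ (applyAll-complete rs i w l s ps)

  module Enumeration (rules : Vec Rule n) where

    -- Stage s tries the instance fst s of every rule; each instance is
    -- tried at infinitely many stages.
    stageL : ℕ → List ℕ
    stageL zero    = []
    stageL (suc s) = applyAll rules (fst s) (stageL s)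

    stageᶠ : Fn 1
    stageᶠ = respec (recᶠ (constᶠ 0) (applyAllᶠ rules ⟨ fstᶠ ⟨ π (# 0) ⟩ ⨾ π (# 1) ⟩))
      (λ { (s ∷ []) → encode (stageL s) }) λ { (s ∷ []) → go s }
      where
      go : ∀ s → _ ≡ encode (stageL s)
      go zero    = refl
      go (suc s) = trans (cong (λ l → fun (applyAllᶠ rules) (fst s ∷ l ∷ [])) (go s))
                         (applyAll-spec rules (fst s) (stageL s))

    Sound : List ℕ → Set
    Sound l = ∀ {j} → codeJ j ∈ l → rules ⊢ʰ j

    apply-sound : ∀ i w l → Sound l → Sound (apply (lookup rules i) w l)
    apply-sound i w l sound c∈ with fun (firesᶠ (lookup rules i)) (w ∷ encode l ∷ []) in fires
    apply-sound i w l sound c∈         | zero  = sound c∈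
    apply-sound i w l sound (there c∈) | suc _ = sound c∈
    apply-sound i w l sound (here eq)  | suc _ =
      subst (rules ⊢ʰ_) (sym (codeJ-injective eq))
        (step i xs (All.map sound (present-sound (premises r) (and-elimʳ x y nz))) (and-elimˡ x y nz))
      where
      r = lookup rules i
      xs = decodeVec (arity r) w
      x = fun (side r) xs
      y = fun (presentᶠ (premises r)) (w ∷ encode l ∷ [])
      nz : fun (firesᶠ r) (w ∷ encode l ∷ []) ≢ 0
      nz z = 0≢1+n (trans (sym z) fires)

    applyAll-sound : ∀ {m} (rs : Vec Rule m) (f : Fin m → Fin n) → (∀ i → lookup rs i ≡ lookup rules (f i)) →
                     ∀ w l → Sound l → Sound (applyAll rs w l)
    applyAll-sound []       f eq w l sound = sound
    applyAll-sound (r ∷ rs) f eq w l sound rewrite eq zero =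
      apply-sound (f zero) w _ (applyAll-sound rs (f ∘ suc) (eq ∘ suc) w l sound)

    stage-sound : ∀ s → Sound (stageL s)
    stage-sound zero    ()
    stage-sound (suc s) = applyAll-sound rules (λ i → i) (λ _ → refl) (fst s) (stageL s) (stage-sound s)

    stage-⊆ : ∀ {s t c} → s ≤′ t → c ∈ stageL s → c ∈ stageL t
    stage-⊆ ≤′-refl c∈ = c∈
    stage-⊆ (≤′-step {t} s≤t) c∈ = applyAll-⊆ rules (fst t) (stageL t) (stage-⊆ s≤t c∈)

    mutual
      stage-complete : ∀ {j} → rules ⊢ʰ j → ∃[ s ] codeJ j ∈ stageL s
      stage-complete (step i xs ds sd) with stages-complete ds
      ... | b , ps = suc s , in-stage
        where
        w = encodeVec xs
        s = ⟪ w , b ⟫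
        r = lookup rules i
        in-stage : codeJ (evalA xs (conclusion r)) ∈ stageL (suc s)
        in-stage rewrite fst-pair w b =
          subst (λ ys → codeJ (evalA ys (conclusion r)) ∈ applyAll rules w (stageL s)) (decode-encode xs)
            (applyAll-complete rules i w (stageL s)
              (subst (λ ys → fun (side r) ys ≢ 0) (sym (decode-encode xs)) sd)
              (subst (λ ys → All (λ j → codeJ j ∈ stageL s) (List.map (evalA ys) (premises r))) (sym (decode-encode xs))
                (All.map (stage-⊆ (≤⇒≤′ (y≤pair w b))) ps)))

      stages-complete : ∀ {js} → All (rules ⊢ʰ_) js → ∃[ s ] All (λ j → codeJ j ∈ stageL s) js
      stages-complete []       = 0 , []
      stages-complete (d ∷ ds) with stage-complete d | stages-complete ds
      ... | s , p | t , ps = s ⊔ t , stage-⊆ (≤⇒≤′ (m≤m⊔n s t)) p ∷ All.map (stage-⊆ (≤⇒≤′ (m≤n⊔m s t))) ps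

    provedᶠ : Fn 1 → Fn 2
    provedᶠ f = memberᶠ ⟨ f ⟨ π (# 1) ⟩ ⨾ stageᶠ ⟨ π (# 0) ⟩ ⟩

    proved-sound : ∀ {f j s n} → fun f (n ∷ []) ≡ codeJ j → fun (provedᶠ f) (s ∷ n ∷ []) ≢ 0 → rules ⊢ʰ j
    proved-sound {s = s} eq h rewrite eq = stage-sound s (member-sound {xs = stageL s} h)

    proved-complete : ∀ {f j n} → fun f (n ∷ []) ≡ codeJ j → rules ⊢ʰ j → ∃[ s ] fun (provedᶠ f) (s ∷ n ∷ []) ≢ 0
    proved-complete eq d with stage-complete d
    ... | s , c∈ rewrite eq = s , member-complete c∈

    -- Of two families of judgments, exactly one of which is derivable at each
    -- index, a search through the stages decides the first.
    module Decision (p q : ℕ → Judgment) (pᶠ qᶠ : Fn 1)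
                    (p-code : ∀ n → fun pᶠ (n ∷ []) ≡ codeJ (p n)) (q-code : ∀ n → fun qᶠ (n ∷ []) ≡ codeJ (q n))
                    (either : ∀ n → (rules ⊢ʰ p n) ⊎ (rules ⊢ʰ q n))
                    (exclusive : ∀ n → rules ⊢ʰ p n → ¬ (rules ⊢ʰ q n)) where

      undecidedᶠ : Fn 2
      undecidedᶠ = notᶠ ⟨ addᶠ ⟨ provedᶠ pᶠ ⨾ provedᶠ qᶠ ⟩ ⟩

      not≡0⇒≢0 : ∀ {x} → not x ≡ 0 → x ≢ 0
      not≡0⇒≢0 eq refl = contradiction eq λ ()

      ≢0⇒not≡0 : ∀ {x} → x ≢ 0 → not x ≡ 0
      ≢0⇒not≡0 {zero}  h = contradiction refl h
      ≢0⇒not≡0 {suc x} h = refl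

      decided-stage : ∀ n → ∃[ s ] fun undecidedᶠ (s ∷ n ∷ []) ≡ 0
      decided-stage n with either n
      ... | inj₁ d = let (s , h) = proved-complete {pᶠ} (p-code n) d in
        s , ≢0⇒not≡0 λ z → h (m+n≡0⇒m≡0 _ z)
      ... | inj₂ d = let (s , h) = proved-complete {qᶠ} (q-code n) d in
        s , ≢0⇒not≡0 λ z → h (m+n≡0⇒n≡0 (fun (provedᶠ pᶠ) (s ∷ n ∷ [])) z)

      signᶠ : Fn 2
      signᶠ = notᶠ ⟨ notᶠ ⟨ provedᶠ pᶠ ⟩ ⟩

      decideᵣ : Rec 1
      decideᵣ = comp (code signᶠ) (mu (code undecidedᶠ) ∷ proj (# 0) ∷ [])

      decidable : Recursive (λ n → rules ⊢ʰ p n)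
      decidable = decideᵣ , λ { (n ∷ []) → go n }
        where
        go : ∀ n → ((rules ⊢ʰ p n) × decideᵣ · (n ∷ []) ⇓ 1) ⊎ (¬ (rules ⊢ʰ p n) × decideᵣ · (n ∷ []) ⇓ 0)
        go n with search⇓ undecidedᶠ (n ∷ []) (proj₁ (decided-stage n)) (proj₂ (decided-stage n))
        ... | s , found , z = decide _ refl
          where
          run : decideᵣ · (n ∷ []) ⇓ fun signᶠ (s ∷ n ∷ [])
          run = ⇓comp (found ∷ ⇓proj (# 0) ∷ []) (computes signᶠ (s ∷ n ∷ []))
          decide : ∀ x → fun (provedᶠ pᶠ) (s ∷ n ∷ []) ≡ x →
                   ((rules ⊢ʰ p n) × decideᵣ · (n ∷ []) ⇓ 1) ⊎ (¬ (rules ⊢ʰ p n) × decideᵣ · (n ∷ []) ⇓ 0)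
          decide (suc _) eq = inj₁ (proved-sound {pᶠ} {s = s} (p-code n) (λ z → 0≢1+n (trans (sym z) eq)) ,
                                    subst (λ x → decideᵣ · (n ∷ []) ⇓ not (not x)) eq run)
          decide zero    eq = inj₂ ((λ d → exclusive n d (proved-sound {qᶠ} {s = s} (q-code n)
                                      (subst (λ x → x + _ ≢ 0) eq (not≡0⇒≢0 z)))) ,
                                    subst (λ x → decideᵣ · (n ∷ []) ⇓ not (not x)) eq run)

-- Gödel numbers

-- The codes of Defs, written with the abstract pairing.
mutual
  cT : Term L n → ℕ
  cT         (var x)       = ⟪ 0 , toℕ x ⟫
  cT {L = L} (fn {k} f ts) = ⟪ 1 , ⟪ k , ⟪ Language.codeF L f , cTs ts ⟫ ⟫ ⟫

  cTs : Vec (Term L n) k → ℕ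
  cTs []       = 0
  cTs (t ∷ ts) = suc ⟪ cT t , cTs ts ⟫

cF : Formula L n → ℕ
cF ⊥'                     = ⟪ 0 , 0 ⟫
cF (t ≐ u)                = ⟪ 1 , ⟪ cT t , cT u ⟫ ⟫
cF {L = L} (rel {k} r ts) = ⟪ 2 , ⟪ k , ⟪ Language.codeR L r , cTs ts ⟫ ⟫ ⟫
cF (φ ⇒ ψ)                = ⟪ 3 , ⟪ cF φ , cF ψ ⟫ ⟫
cF (∀' φ)                 = ⟪ 4 , cF φ ⟫

abstract
  unfold : ∀ {x x′ y y′} → x ≡ x′ → y ≡ y′ → ⟪ x , y ⟫ ≡ pair x′ y′
  unfold {x} {y = y} refl refl = ⟪⟫≡pair x y

mutual
  cT≡codeT : (t : Term L n) → cT t ≡ codeT t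
  cT≡codeT (var x)   = unfold refl refl
  cT≡codeT (fn f ts) = unfold refl (unfold refl (unfold refl (cTs≡codeTs ts)))

  cTs≡codeTs : (ts : Vec (Term L n) k) → cTs ts ≡ codeTs ts
  cTs≡codeTs []       = refl
  cTs≡codeTs (t ∷ ts) = cong suc (unfold (cT≡codeT t) (cTs≡codeTs ts))

cF≡⌜⌝ : (φ : Formula L n) → cF φ ≡ ⌜ φ ⌝
cF≡⌜⌝ ⊥'         = unfold refl refl
cF≡⌜⌝ (t ≐ u)    = unfold refl (unfold (cT≡codeT t) (cT≡codeT u))
cF≡⌜⌝ (rel r ts) = unfold refl (unfold refl (unfold refl (cTs≡codeTs ts)))
cF≡⌜⌝ (φ ⇒ ψ)    = unfold refl (unfold (cF≡⌜⌝ φ) (cF≡⌜⌝ ψ))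
cF≡⌜⌝ (∀' φ)     = unfold refl (cF≡⌜⌝ φ)

invert-var : (t : Term L n) → ∀ {a} → cT t ≡ ⟪ 0 , a ⟫ → Σ[ x ∈ Fin n ] t ≡ var x × toℕ x ≡ a
invert-var (var x)   eq = x , refl , proj₂ (pair-injective eq)
invert-var (fn f ts) eq = contradiction (proj₁ (pair-injective eq)) λ ()

invert-fn : (t : Term L n) → ∀ {k c a} → cT t ≡ ⟪ 1 , ⟪ k , ⟪ c , a ⟫ ⟫ ⟫ →
            Σ[ f ∈ Language.Fun L k ] Σ[ ts ∈ Vec (Term L n) k ] t ≡ fn f ts × Language.codeF L f ≡ c × cTs ts ≡ a
invert-fn (var x)   eq = contradiction (proj₁ (pair-injective eq)) λ ()
invert-fn (fn f ts) eq with pair-injective (proj₂ (pair-injective eq))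
... | refl , eq′ = f , ts , refl , pair-injective eq′

invert-⊥ : (φ : Formula L n) → cF φ ≡ ⟪ 0 , 0 ⟫ → φ ≡ ⊥'
invert-⊥ ⊥'         eq = refl
invert-⊥ (t ≐ u)    eq = contradiction (proj₁ (pair-injective eq)) λ ()
invert-⊥ (rel r ts) eq = contradiction (proj₁ (pair-injective eq)) λ ()
invert-⊥ (φ ⇒ ψ)    eq = contradiction (proj₁ (pair-injective eq)) λ ()
invert-⊥ (∀' φ)     eq = contradiction (proj₁ (pair-injective eq)) λ ()

invert-≐ : (φ : Formula L n) → ∀ {a b} → cF φ ≡ ⟪ 1 , ⟪ a , b ⟫ ⟫ →
           Σ[ t ∈ Term L n ] Σ[ u ∈ Term L n ] φ ≡ t ≐ u × cT t ≡ a × cT u ≡ b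
invert-≐ ⊥'         eq = contradiction (proj₁ (pair-injective eq)) λ ()
invert-≐ (t ≐ u)    eq = t , u , refl , pair-injective (proj₂ (pair-injective eq))
invert-≐ (rel r ts) eq = contradiction (proj₁ (pair-injective eq)) λ ()
invert-≐ (φ ⇒ ψ)    eq = contradiction (proj₁ (pair-injective eq)) λ ()
invert-≐ (∀' φ)     eq = contradiction (proj₁ (pair-injective eq)) λ ()

invert-rel : (φ : Formula L n) → ∀ {k c a} → cF φ ≡ ⟪ 2 , ⟪ k , ⟪ c , a ⟫ ⟫ ⟫ →
             Σ[ r ∈ Language.Rel L k ] Σ[ ts ∈ Vec (Term L n) k ] φ ≡ rel r ts × Language.codeR L r ≡ c × cTs ts ≡ a
invert-rel ⊥'         eq = contradiction (proj₁ (pair-injective eq)) λ ()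
invert-rel (t ≐ u)    eq = contradiction (proj₁ (pair-injective eq)) λ ()
invert-rel (rel r ts) eq with pair-injective (proj₂ (pair-injective eq))
... | refl , eq′ = r , ts , refl , pair-injective eq′
invert-rel (φ ⇒ ψ)    eq = contradiction (proj₁ (pair-injective eq)) λ ()
invert-rel (∀' φ)     eq = contradiction (proj₁ (pair-injective eq)) λ ()

invert-⇒ : (φ : Formula L n) → ∀ {a b} → cF φ ≡ ⟪ 3 , ⟪ a , b ⟫ ⟫ →
           Σ[ ψ ∈ Formula L n ] Σ[ χ ∈ Formula L n ] φ ≡ (ψ ⇒ χ) × cF ψ ≡ a × cF χ ≡ b
invert-⇒ ⊥'         eq = contradiction (proj₁ (pair-injective eq)) λ ()
invert-⇒ (t ≐ u)    eq = contradiction (proj₁ (pair-injective eq)) λ ()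
invert-⇒ (rel r ts) eq = contradiction (proj₁ (pair-injective eq)) λ ()
invert-⇒ (φ ⇒ ψ)    eq = φ , ψ , refl , pair-injective (proj₂ (pair-injective eq))
invert-⇒ (∀' φ)     eq = contradiction (proj₁ (pair-injective eq)) λ ()

invert-∀ : (φ : Formula L n) → ∀ {a} → cF φ ≡ ⟪ 4 , a ⟫ →
           Σ[ ψ ∈ Formula L (suc n) ] φ ≡ ∀' ψ × cF ψ ≡ a
invert-∀ ⊥'         eq = contradiction (proj₁ (pair-injective eq)) λ ()
invert-∀ (t ≐ u)    eq = contradiction (proj₁ (pair-injective eq)) λ ()
invert-∀ (rel r ts) eq = contradiction (proj₁ (pair-injective eq)) λ ()
invert-∀ (φ ⇒ ψ)    eq = contradiction (proj₁ (pair-injective eq)) λ ()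
invert-∀ (∀' φ)     eq = φ , refl , proj₂ (pair-injective eq)

mutual
  cT-injective : (t u : Term L n) → cT t ≡ cT u → t ≡ u
  cT-injective (var x) u eq with invert-var u (sym eq)
  ... | y , refl , p = cong var (toℕ-injective (sym p))
  cT-injective {L = L} (fn f ts) u eq with invert-fn u (sym eq)
  ... | g , us , refl , p , q = cong₂ fn (Language.codeF-injective L (sym p)) (cTs-injective ts us (sym q))

  cTs-injective : (ts us : Vec (Term L n) k) → cTs ts ≡ cTs us → ts ≡ us
  cTs-injective []       []       eq = refl
  cTs-injective (t ∷ ts) (u ∷ us) eq with pair-injective (suc-injective eq)
  ... | p , q = cong₂ _∷_ (cT-injective t u p) (cTs-injective ts us q)

cF-injective : (φ ψ : Formula L n) → cF φ ≡ cF ψ → φ ≡ ψ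
cF-injective ⊥' ψ eq = sym (invert-⊥ ψ (sym eq))
cF-injective (t ≐ u) ψ eq with invert-≐ ψ (sym eq)
... | t′ , u′ , refl , p , q = cong₂ _≐_ (cT-injective t t′ (sym p)) (cT-injective u u′ (sym q))
cF-injective {L = L} (rel r ts) ψ eq with invert-rel ψ (sym eq)
... | s , us , refl , p , q = cong₂ rel (Language.codeR-injective L (sym p)) (cTs-injective ts us (sym q))
cF-injective (φ ⇒ χ) ψ eq with invert-⇒ ψ (sym eq)
... | φ′ , χ′ , refl , p , q = cong₂ _⇒_ (cF-injective φ φ′ (sym p)) (cF-injective χ χ′ (sym q))
cF-injective (∀' φ) ψ eq with invert-∀ ψ (sym eq)
... | φ′ , refl , p = cong ∀' (cF-injective φ φ′ (sym p))

-- Substitution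

mutual
  renT≡subT : (ρ : Fin m → Fin n) (t : Term L m) → renT ρ t ≡ subT (var ∘ ρ) t
  renT≡subT ρ (var x)   = refl
  renT≡subT ρ (fn f ts) = cong (fn f) (renTs≡subTs ρ ts)

  renTs≡subTs : (ρ : Fin m → Fin n) (ts : Vec (Term L m) k) → renTs ρ ts ≡ subTs (var ∘ ρ) ts
  renTs≡subTs ρ []       = refl
  renTs≡subTs ρ (t ∷ ts) = cong₂ _∷_ (renT≡subT ρ t) (renTs≡subTs ρ ts)

mutual
  subT-id : {σ : Fin n → Term L n} → σ ≗ var → (t : Term L n) → subT σ t ≡ t
  subT-id h (var x)   = h x
  subT-id h (fn f ts) = cong (fn f) (subTs-id h ts)

  subTs-id : {σ : Fin n → Term L n} → σ ≗ var → (ts : Vec (Term L n) k) → subTs σ ts ≡ ts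
  subTs-id h []       = refl
  subTs-id h (t ∷ ts) = cong₂ _∷_ (subT-id h t) (subTs-id h ts)

sub-id : {σ : Fin n → Term L n} → σ ≗ var → (φ : Formula L n) → sub σ φ ≡ φ
sub-id h ⊥'         = refl
sub-id h (t ≐ u)    = cong₂ _≐_ (subT-id h t) (subT-id h u)
sub-id h (rel r ts) = cong (rel r) (subTs-id h ts)
sub-id h (φ ⇒ ψ)    = cong₂ _⇒_ (sub-id h φ) (sub-id h ψ)
sub-id h (∀' φ)     = cong ∀' (sub-id (λ { zero → refl ; (suc x) → cong (renT suc) (h x) }) φ)

-- Codes do not see the scope, so substituting variables with the same
-- indices gives the same code even in different scopes.
data SameVar {L : Language} {n n′ : ℕ} : Term L n → Term L n′ → Set where
  same : ∀ {x y} → toℕ x ≡ toℕ y → SameVar (var x) (var y)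

SameVar-lift : {σ : Fin m → Term L n} {σ′ : Fin m → Term L n′} → (∀ x → SameVar (σ x) (σ′ x)) →
               ∀ x → SameVar ((var zero ▸ (renT suc ∘ σ)) x) ((var zero ▸ (renT suc ∘ σ′)) x)
SameVar-lift h zero = same refl
SameVar-lift {σ = σ} {σ′ = σ′} h (suc x) with σ x | σ′ x | h x
... | _ | _ | same eq = same (cong suc eq)

mutual
  cT-sub : {σ : Fin m → Term L n} {σ′ : Fin m → Term L n′} → (∀ x → SameVar (σ x) (σ′ x)) → ∀ t → cT (subT σ t) ≡ cT (subT σ′ t)
  cT-sub {σ = σ} {σ′ = σ′} h (var x) with σ x | σ′ x | h x
  ... | _ | _ | same eq = cong ⟪ 0 ,_⟫ eq
  cT-sub {L = L} h (fn {k} f ts) = cong (λ c → ⟪ 1 , ⟪ k , ⟪ Language.codeF L f , c ⟫ ⟫ ⟫) (cTs-sub h ts)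

  cTs-sub : {σ : Fin m → Term L n} {σ′ : Fin m → Term L n′} → (∀ x → SameVar (σ x) (σ′ x)) → ∀ (ts : Vec (Term L m) k) → cTs (subTs σ ts) ≡ cTs (subTs σ′ ts)
  cTs-sub h []       = refl
  cTs-sub h (t ∷ ts) = cong₂ (λ a b → suc ⟪ a , b ⟫) (cT-sub h t) (cTs-sub h ts)

cF-sub : {σ : Fin m → Term L n} {σ′ : Fin m → Term L n′} → (∀ x → SameVar (σ x) (σ′ x)) → ∀ φ → cF (sub σ φ) ≡ cF (sub σ′ φ)
cF-sub h ⊥'         = refl
cF-sub h (t ≐ u)    = cong₂ (λ a b → ⟪ 1 , ⟪ a , b ⟫ ⟫) (cT-sub h t) (cT-sub h u)
cF-sub {L = L} h (rel {k} r ts) = cong (λ c → ⟪ 2 , ⟪ k , ⟪ Language.codeR L r , c ⟫ ⟫ ⟫) (cTs-sub h ts)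
cF-sub h (φ ⇒ ψ)    = cong₂ (λ a b → ⟪ 3 , ⟪ a , b ⟫ ⟫) (cF-sub h φ) (cF-sub h ψ)
cF-sub h (∀' φ)     = cong ⟪ 4 ,_⟫ (cF-sub (SameVar-lift h) φ)

cF-sub-ε : (φ : Sentence L) → cF (sub {n = n} ε φ) ≡ cF φ
cF-sub-ε φ = trans (cF-sub {σ′ = var} (λ ()) φ) (cong cF (sub-id (λ ()) φ))

-- Derivations as Horn clauses

module _ {X : Vec ℕ k → Set} (rec : RecursiveRel X) where

  characteristicᶠ : Fn k
  characteristicᶠ = mkFn (proj₁ rec) χ computesχ
    where
    χ : Vec ℕ k → ℕ
    χ xs with proj₂ rec xs
    ... | inj₁ _ = 1
    ... | inj₂ _ = 0
    computesχ : ∀ xs → proj₁ rec · xs ⇓ χ xs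
    computesχ xs with proj₂ rec xs
    ... | inj₁ (_ , d) = d
    ... | inj₂ (_ , d) = d

  characteristic-sound : ∀ xs → fun characteristicᶠ xs ≢ 0 → X xs
  characteristic-sound xs h with proj₂ rec xs
  ... | inj₁ (x , _) = x
  ... | inj₂ _       = contradiction refl h

  characteristic-complete : ∀ xs → X xs → fun characteristicᶠ xs ≢ 0
  characteristic-complete xs x with proj₂ rec xs
  ... | inj₁ _        = λ ()
  ... | inj₂ (¬x , _) = contradiction x ¬x

-- Well-formedness, substitution and membership are judgments like provability,
-- so no recursive function on codes has to be programmed.
data Tag : Set where
  lt wfT wfTs wfF look subT′ subTs′ subF shiftCtx mem prv : Tag

tagCode : Tag → ℕ
tagCode lt       = 0
tagCode wfT      = 1
tagCode wfTs     = 2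
tagCode wfF      = 3
tagCode look     = 4
tagCode subT′    = 5
tagCode subTs′   = 6
tagCode subF     = 7
tagCode shiftCtx = 8
tagCode mem      = 9
tagCode prv      = 10

tagOf : ℕ → Tag
tagOf 0 = lt
tagOf 1 = wfT
tagOf 2 = wfTs
tagOf 3 = wfF
tagOf 4 = look
tagOf 5 = subT′
tagOf 6 = subTs′
tagOf 7 = subF
tagOf 8 = shiftCtx
tagOf 9 = mem
tagOf _ = prv

tagOf-tagCode : ∀ t → tagOf (tagCode t) ≡ t
tagOf-tagCode lt       = refl
tagOf-tagCode wfT      = refl
tagOf-tagCode wfTs     = refl
tagOf-tagCode wfF      = refl
tagOf-tagCode look     = refl
tagOf-tagCode subT′    = refl
tagOf-tagCode subTs′   = refl
tagOf-tagCode subF     = refl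
tagOf-tagCode shiftCtx = refl
tagOf-tagCode mem      = refl
tagOf-tagCode prv      = refl

tagCode-injective : ∀ {s t} → tagCode s ≡ tagCode t → s ≡ t
tagCode-injective {s} {t} eq = trans (sym (tagOf-tagCode s)) (trans (cong tagOf eq) (tagOf-tagCode t))

v : ∀ i {n} {i<n : _} → Exp n
v i {n} {i<n} = ‵ (#_ i {n} {i<n})

varᴱ : Exp k → Exp k
varᴱ i = lit 0 & i

fnᴱ : Exp k → Exp k → Exp k → Exp k
fnᴱ k c ts = lit 1 & k & c & ts

nilᴱ : Exp k
nilᴱ = lit 0

infixr 4 _∷ᴱ_
_∷ᴱ_ : Exp k → Exp k → Exp k
a ∷ᴱ b = succ (a & b)

infixr 5 _⇒ᴱ_
⊥ᴱ : Exp k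
⊥ᴱ = lit 0 & lit 0
_≐ᴱ_ _⇒ᴱ_ : Exp k → Exp k → Exp k
a ≐ᴱ b = lit 1 & a & b
a ⇒ᴱ b = lit 3 & a & b
relᴱ : Exp k → Exp k → Exp k → Exp k
relᴱ k c ts = lit 2 & k & c & ts
∀ᴱ ¬ᴱ : Exp k → Exp k
∀ᴱ a = lit 4 & a
¬ᴱ a = a ⇒ᴱ ⊥ᴱ

open Horn tagCode tagCode-injective

module ProofRules {L : Language} (recL : RecursiveLanguage L) (T : Theory L) (recT : Recursive (Codes T)) where

  open Language L

  funᶠ relᶠ : Fn 2
  funᶠ = characteristicᶠ (proj₁ recL)
  relᶠ = characteristicᶠ (proj₂ recL)

  axiomᶠ : Fn 1
  axiomᶠ = characteristicᶠ recT

  shiftᴱ : Exp k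
  shiftᴱ = lit 0 & lit 0
  instᴱ liftᴱ : Exp k → Exp k
  instᴱ t = lit 1 & t
  liftᴱ σ = lit 2 & σ

  infix 2 _⟶_
  _⟶_ : List (Atom k) → Atom k → Rule
  ps ⟶ c = rule _ ps (constᶠ 1) c

  at₂ : Tag → Exp k → Exp k → Atom k
  at₂ t a b = atom t (a ∷ b ∷ lit 0 ∷ [])
  at₃ : Tag → Exp k → Exp k → Exp k → Atom k
  at₃ t a b c = atom t (a ∷ b ∷ c ∷ [])

  rules : Vec Rule 39
  rules =
      (_⟶_ {1} [] (at₂ lt (lit 0) (succ (v 0))))
    ∷ (_⟶_ {2} (at₂ lt (v 0) (v 1) ∷ []) (at₂ lt (succ (v 0)) (succ (v 1))))
    ∷ (_⟶_ {2} (at₂ lt (v 0) (v 1) ∷ []) (at₂ wfT (v 1) (varᴱ (v 0))))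
    ∷ rule 4 (at₃ wfTs (v 0) (v 1) (v 3) ∷ []) (funᶠ ⟨ π (# 1) ⨾ π (# 2) ⟩) (at₂ wfT (v 0) (fnᴱ (v 1) (v 2) (v 3)))
    ∷ (_⟶_ {1} [] (at₃ wfTs (v 0) (lit 0) nilᴱ))
    ∷ (_⟶_ {4} (at₂ wfT (v 0) (v 2) ∷ at₃ wfTs (v 0) (v 1) (v 3) ∷ []) (at₃ wfTs (v 0) (succ (v 1)) (v 2 ∷ᴱ v 3)))
    ∷ (_⟶_ {1} [] (at₂ wfF (v 0) ⊥ᴱ))
    ∷ (_⟶_ {3} (at₂ wfT (v 0) (v 1) ∷ at₂ wfT (v 0) (v 2) ∷ []) (at₂ wfF (v 0) (v 1 ≐ᴱ v 2)))
    ∷ rule 4 (at₃ wfTs (v 0) (v 1) (v 3) ∷ []) (relᶠ ⟨ π (# 1) ⨾ π (# 2) ⟩) (at₂ wfF (v 0) (relᴱ (v 1) (v 2) (v 3)))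
    ∷ (_⟶_ {3} (at₂ wfF (v 0) (v 1) ∷ at₂ wfF (v 0) (v 2) ∷ []) (at₂ wfF (v 0) (v 1 ⇒ᴱ v 2)))
    ∷ (_⟶_ {2} (at₂ wfF (succ (v 0)) (v 1) ∷ []) (at₂ wfF (v 0) (∀ᴱ (v 1))))
    ∷ (_⟶_ {1} [] (at₃ look shiftᴱ (v 0) (varᴱ (succ (v 0)))))
    ∷ (_⟶_ {1} [] (at₃ look (instᴱ (v 0)) (lit 0) (v 0)))
    ∷ (_⟶_ {2} [] (at₃ look (instᴱ (v 0)) (succ (v 1)) (varᴱ (v 1))))
    ∷ (_⟶_ {1} [] (at₃ look (liftᴱ (v 0)) (lit 0) (varᴱ (lit 0))))
    ∷ (_⟶_ {4} (at₃ look (v 0) (v 1) (v 2) ∷ at₃ subT′ shiftᴱ (v 2) (v 3) ∷ []) (at₃ look (liftᴱ (v 0)) (succ (v 1)) (v 3)))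
    ∷ (_⟶_ {3} (at₃ look (v 0) (v 1) (v 2) ∷ []) (at₃ subT′ (v 0) (varᴱ (v 1)) (v 2)))
    ∷ (_⟶_ {5} (at₃ subTs′ (v 0) (v 3) (v 4) ∷ []) (at₃ subT′ (v 0) (fnᴱ (v 1) (v 2) (v 3)) (fnᴱ (v 1) (v 2) (v 4))))
    ∷ (_⟶_ {1} [] (at₃ subTs′ (v 0) nilᴱ nilᴱ))
    ∷ (_⟶_ {5} (at₃ subT′ (v 0) (v 1) (v 2) ∷ at₃ subTs′ (v 0) (v 3) (v 4) ∷ []) (at₃ subTs′ (v 0) (v 1 ∷ᴱ v 3) (v 2 ∷ᴱ v 4)))
    ∷ (_⟶_ {1} [] (at₃ subF (v 0) ⊥ᴱ ⊥ᴱ))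
    ∷ (_⟶_ {5} (at₃ subT′ (v 0) (v 1) (v 2) ∷ at₃ subT′ (v 0) (v 3) (v 4) ∷ []) (at₃ subF (v 0) (v 1 ≐ᴱ v 3) (v 2 ≐ᴱ v 4)))
    ∷ (_⟶_ {5} (at₃ subTs′ (v 0) (v 3) (v 4) ∷ []) (at₃ subF (v 0) (relᴱ (v 1) (v 2) (v 3)) (relᴱ (v 1) (v 2) (v 4))))
    ∷ (_⟶_ {5} (at₃ subF (v 0) (v 1) (v 2) ∷ at₃ subF (v 0) (v 3) (v 4) ∷ []) (at₃ subF (v 0) (v 1 ⇒ᴱ v 3) (v 2 ⇒ᴱ v 4)))
    ∷ (_⟶_ {3} (at₃ subF (liftᴱ (v 0)) (v 1) (v 2) ∷ []) (at₃ subF (v 0) (∀ᴱ (v 1)) (∀ᴱ (v 2))))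
    ∷ (_⟶_ {0} [] (at₂ shiftCtx nilᴱ nilᴱ))
    ∷ (_⟶_ {4} (at₃ subF shiftᴱ (v 0) (v 1) ∷ at₂ shiftCtx (v 2) (v 3) ∷ []) (at₂ shiftCtx (v 0 ∷ᴱ v 2) (v 1 ∷ᴱ v 3)))
    ∷ (_⟶_ {2} [] (at₂ mem (v 0) (v 0 ∷ᴱ v 1)))
    ∷ (_⟶_ {3} (at₂ mem (v 0) (v 2) ∷ []) (at₂ mem (v 0) (v 1 ∷ᴱ v 2)))
    ∷ rule 3 [] (axiomᶠ ⟨ π (# 2) ⟩) (at₃ prv (v 0) (v 1) (v 2))
    ∷ (_⟶_ {3} (at₂ mem (v 2) (v 1) ∷ []) (at₃ prv (v 0) (v 1) (v 2)))
    ∷ (_⟶_ {4} (at₂ wfF (v 0) (v 2) ∷ at₃ prv (v 0) (v 2 ∷ᴱ v 1) (v 3) ∷ []) (at₃ prv (v 0) (v 1) (v 2 ⇒ᴱ v 3)))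
    ∷ (_⟶_ {4} (at₃ prv (v 0) (v 1) (v 2 ⇒ᴱ v 3) ∷ at₃ prv (v 0) (v 1) (v 2) ∷ []) (at₃ prv (v 0) (v 1) (v 3)))
    ∷ (_⟶_ {3} (at₂ wfF (v 0) (v 2) ∷ at₃ prv (v 0) (¬ᴱ (v 2) ∷ᴱ v 1) ⊥ᴱ ∷ []) (at₃ prv (v 0) (v 1) (v 2)))
    ∷ (_⟶_ {4} (at₂ shiftCtx (v 1) (v 2) ∷ at₃ prv (succ (v 0)) (v 2) (v 3) ∷ []) (at₃ prv (v 0) (v 1) (∀ᴱ (v 3))))
    ∷ (_⟶_ {5} (at₂ wfT (v 0) (v 2) ∷ at₃ prv (v 0) (v 1) (∀ᴱ (v 3)) ∷ at₃ subF (instᴱ (v 2)) (v 3) (v 4) ∷ []) (at₃ prv (v 0) (v 1) (v 4)))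
    ∷ (_⟶_ {3} (at₂ wfT (v 0) (v 2) ∷ []) (at₃ prv (v 0) (v 1) (v 2 ≐ᴱ v 2)))
    ∷ (_⟶_ {7} (at₂ wfF (succ (v 0)) (v 4) ∷ at₃ prv (v 0) (v 1) (v 2 ≐ᴱ v 3) ∷ at₃ subF (instᴱ (v 2)) (v 4) (v 5)
               ∷ at₃ prv (v 0) (v 1) (v 5) ∷ at₃ subF (instᴱ (v 3)) (v 4) (v 6) ∷ []) (at₃ prv (v 0) (v 1) (v 6)))
    ∷ (_⟶_ {2} [] (at₃ prv (v 0) (v 1) (¬ᴱ (∀ᴱ (¬ᴱ (varᴱ (lit 0) ≐ᴱ varᴱ (lit 0)))))))
    ∷ []

  cC : List (Formula L n) → ℕ
  cC Γ = encode (List.map cF Γ)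

  -- Codes of the three kinds of substitution that occur in derivations.
  data Represents : {m n : ℕ} → ℕ → (Fin m → Term L n) → Set where
    by-shift : ∀ {c} → c ≡ ⟪ 0 , 0 ⟫ → Represents {n} c (var ∘ suc)
    by-inst  : ∀ {c} (t : Term L n) → c ≡ ⟪ 1 , cT t ⟫ → Represents c (t ▸ var)
    by-lift  : ∀ {c d} {σ : Fin m → Term L n} → Represents d σ → c ≡ ⟪ 2 , d ⟫ →
               Represents c (var zero ▸ (renT suc ∘ σ))

  Holds : Judgment → Set
  Holds (lt ∙ i ∷ n ∷ _ ∷ [])       = i < n
  Holds (wfT ∙ n ∷ a ∷ _ ∷ [])      = Σ[ t ∈ Term L n ] cT t ≡ a
  Holds (wfTs ∙ n ∷ k ∷ a ∷ [])     = Σ[ ts ∈ Vec (Term L n) k ] cTs ts ≡ a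
  Holds (wfF ∙ n ∷ a ∷ _ ∷ [])      = Σ[ φ ∈ Formula L n ] cF φ ≡ a
  Holds (look ∙ s ∷ i ∷ a ∷ [])     = ∀ {m n} {σ : Fin m → Term L n} → Represents s σ →
                                      ∀ x → toℕ x ≡ i → cT (σ x) ≡ a
  Holds (subT′ ∙ s ∷ a ∷ b ∷ [])    = ∀ {m n} {σ : Fin m → Term L n} → Represents s σ →
                                      ∀ t → cT t ≡ a → cT (subT σ t) ≡ b
  Holds (subTs′ ∙ s ∷ a ∷ b ∷ [])   = ∀ {m n} {σ : Fin m → Term L n} → Represents s σ →
                                      ∀ {k} (ts : Vec (Term L m) k) → cTs ts ≡ a → cTs (subTs σ ts) ≡ b
  Holds (subF ∙ s ∷ a ∷ b ∷ [])     = ∀ {m n} {σ : Fin m → Term L n} → Represents s σ →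
                                      ∀ φ → cF φ ≡ a → cF (sub σ φ) ≡ b
  Holds (shiftCtx ∙ a ∷ b ∷ _ ∷ []) = ∀ {n} (Γ : List (Formula L n)) → cC Γ ≡ a → cC (List.map shift Γ) ≡ b
  Holds (mem ∙ a ∷ b ∷ _ ∷ [])      = ∀ {n} (Γ : List (Formula L n)) → cC Γ ≡ b → Σ[ φ ∈ Formula L n ] φ ∈ Γ × cF φ ≡ a
  Holds (prv ∙ n ∷ a ∷ b ∷ [])      = ∀ (Γ : List (Formula L n)) → cC Γ ≡ a →
                                      Σ[ φ ∈ Formula L n ] cF φ ≡ b × (T ∣ Γ ⊢ φ)

  rules-sound : VAll.All (Preserves Holds) rules
  rules-sound =
      (λ { (n ∷ []) _ _ → s≤s z≤n })
    ∷ (λ { (i ∷ n ∷ []) (i<n ∷ []) _ → s≤s i<n })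
    ∷ (λ { (i ∷ n ∷ []) (i<n ∷ []) _ → var (fromℕ< i<n) , cong ⟪ 0 ,_⟫ (toℕ-fromℕ< i<n) })
    ∷ (λ { (n ∷ k ∷ c ∷ a ∷ []) ((ts , refl) ∷ []) s →
           let (f , eq) = characteristic-sound (proj₁ recL) (k ∷ c ∷ []) s in
           fn f ts , cong (λ c → ⟪ 1 , ⟪ k , ⟪ c , a ⟫ ⟫ ⟫) eq })
    ∷ (λ { (n ∷ []) _ _ → [] , refl })
    ∷ (λ { (n ∷ k ∷ _ ∷ _ ∷ []) ((t , refl) ∷ (ts , refl) ∷ []) _ → (t ∷ ts) , refl })
    ∷ (λ { (n ∷ []) _ _ → ⊥' , refl })
    ∷ (λ { (n ∷ _ ∷ _ ∷ []) ((t , refl) ∷ (u , refl) ∷ []) _ → (t ≐ u) , refl })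
    ∷ (λ { (n ∷ k ∷ c ∷ a ∷ []) ((ts , refl) ∷ []) s →
           let (r , eq) = characteristic-sound (proj₂ recL) (k ∷ c ∷ []) s in
           rel r ts , cong (λ c → ⟪ 2 , ⟪ k , ⟪ c , a ⟫ ⟫ ⟫) eq })
    ∷ (λ { (n ∷ _ ∷ _ ∷ []) ((φ , refl) ∷ (ψ , refl) ∷ []) _ → (φ ⇒ ψ) , refl })
    ∷ (λ { (n ∷ _ ∷ []) ((φ , refl) ∷ []) _ → ∀' φ , refl })
    ∷ (λ { (i ∷ []) _ _ → λ { (by-shift _) x refl → refl
                            ; (by-inst _ eq) → contradiction (proj₁ (pair-injective eq)) λ ()
                            ; (by-lift _ eq) → contradiction (proj₁ (pair-injective eq)) λ () } })
    ∷ (λ { (a ∷ []) _ _ → λ { (by-shift eq) → contradiction (proj₁ (pair-injective eq)) λ ()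
                            ; (by-inst _ eq) zero _ → sym (proj₂ (pair-injective eq))
                            ; (by-lift _ eq) → contradiction (proj₁ (pair-injective eq)) λ () } })
    ∷ (λ { (a ∷ i ∷ []) _ _ → λ { (by-shift eq) → contradiction (proj₁ (pair-injective eq)) λ ()
                                ; (by-inst _ _) (suc x) eq → cong ⟪ 0 ,_⟫ (suc-injective eq)
                                ; (by-lift _ eq) → contradiction (proj₁ (pair-injective eq)) λ () } })
    ∷ (λ { (s ∷ []) _ _ → λ { (by-shift eq) → contradiction (proj₁ (pair-injective eq)) λ ()
                            ; (by-inst _ eq) → contradiction (proj₁ (pair-injective eq)) λ ()
                            ; (by-lift _ _) zero _ → refl } })
    ∷ (λ { (s ∷ i ∷ a ∷ b ∷ []) (looked ∷ shifted ∷ []) _ →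
           λ { (by-shift eq) → contradiction (proj₁ (pair-injective eq)) λ ()
             ; (by-inst _ eq) → contradiction (proj₁ (pair-injective eq)) λ ()
             ; (by-lift {σ = σ} r eq) (suc x) x≡i →
                 trans (cong cT (renT≡subT suc (σ x)))
                   (shifted (by-shift refl) (σ x)
                     (looked (subst (λ d → Represents d σ) (sym (proj₂ (pair-injective eq))) r) x (suc-injective x≡i))) } })
    ∷ (λ { (s ∷ i ∷ a ∷ []) (looked ∷ []) _ r t eq → var-case looked r t (invert-var t eq) })
    ∷ (λ { (s ∷ k ∷ c ∷ a ∷ b ∷ []) (subbed ∷ []) _ r t eq → fn-case subbed r t (invert-fn t eq) })
    ∷ (λ { (s ∷ []) _ _ r [] eq → refl })
    ∷ (λ { (s ∷ a ∷ b ∷ c ∷ d ∷ []) (subbed ∷ subbeds ∷ []) _ r (t ∷ ts) eq →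
           let (p , q) = pair-injective (suc-injective eq) in
           cong₂ (λ x y → suc ⟪ x , y ⟫) (subbed r t p) (subbeds r ts q) })
    ∷ (λ { (s ∷ []) _ _ r φ eq → cong (λ φ → cF (sub _ φ)) (invert-⊥ φ eq) })
    ∷ (λ { (s ∷ a ∷ b ∷ c ∷ d ∷ []) (p ∷ q ∷ []) _ r φ eq → ≐-case p q r (invert-≐ φ eq) })
    ∷ (λ { (s ∷ k ∷ c ∷ a ∷ b ∷ []) (p ∷ []) _ r φ eq → rel-case p r (invert-rel φ eq) })
    ∷ (λ { (s ∷ a ∷ b ∷ c ∷ d ∷ []) (p ∷ q ∷ []) _ r φ eq → ⇒-case p q r (invert-⇒ φ eq) })
    ∷ (λ { (s ∷ a ∷ b ∷ []) (p ∷ []) _ r φ eq → ∀-case p r (invert-∀ φ eq) })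
    ∷ (λ { [] _ _ [] _ → refl })
    ∷ (λ { (a ∷ b ∷ c ∷ d ∷ []) (p ∷ q ∷ []) _ (φ ∷ Γ) eq →
           let (e , f) = pair-injective (suc-injective eq) in
           cong₂ (λ x y → suc ⟪ x , y ⟫) (p (by-shift refl) φ e) (q Γ f) })
    ∷ (λ { (a ∷ b ∷ []) _ _ (φ ∷ Γ) eq → φ , here refl , proj₁ (pair-injective (suc-injective eq)) })
    ∷ (λ { (a ∷ b ∷ c ∷ []) (p ∷ []) _ (φ ∷ Γ) eq →
           let (ψ , ψ∈ , e) = p Γ (proj₂ (pair-injective (suc-injective eq))) in ψ , there ψ∈ , e })
    ∷ (λ { (n ∷ a ∷ b ∷ []) _ s Γ eq →
           let (φ , Tφ , e) = characteristic-sound recT (b ∷ []) s in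
           sub ε φ , trans (cF-sub-ε φ) (trans (cF≡⌜⌝ φ) e) , axiom Tφ })
    ∷ (λ { (n ∷ a ∷ b ∷ []) (p ∷ []) _ Γ eq → let (φ , φ∈ , e) = p Γ eq in φ , e , hyp φ∈ })
    ∷ (λ { (n ∷ a ∷ b ∷ c ∷ []) ((φ , refl) ∷ p ∷ []) _ Γ refl →
           let (ψ , e , d) = p (φ ∷ Γ) refl in (φ ⇒ ψ) , cong (λ c → ⟪ 3 , ⟪ cF φ , c ⟫ ⟫) e , ⇒I d })
    ∷ (λ { (n ∷ a ∷ b ∷ c ∷ []) (p ∷ q ∷ []) _ Γ eq → ⇒E-case (p Γ eq) (q Γ eq) })
    ∷ (λ { (n ∷ a ∷ b ∷ []) ((φ , refl) ∷ p ∷ []) _ Γ refl →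
           let (ψ , e , d) = p ((φ ⇒ ⊥') ∷ Γ) refl in φ , refl , raa (subst (T ∣ _ ∷ Γ ⊢_) (invert-⊥ ψ e) d) })
    ∷ (λ { (n ∷ a ∷ b ∷ c ∷ []) (p ∷ q ∷ []) _ Γ eq →
           let (φ , e , d) = q (List.map shift Γ) (p Γ eq) in ∀' φ , cong ⟪ 4 ,_⟫ e , ∀I d })
    ∷ (λ { (n ∷ a ∷ b ∷ c ∷ d ∷ []) ((t , refl) ∷ p ∷ q ∷ []) _ Γ eq → ∀E-case t q (p Γ eq) })
    ∷ (λ { (n ∷ a ∷ b ∷ []) ((t , refl) ∷ []) _ Γ eq → (t ≐ t) , refl , ≐refl t })
    ∷ (λ { (n ∷ a ∷ b ∷ c ∷ d ∷ e ∷ f ∷ []) ((φ , refl) ∷ p ∷ s ∷ q ∷ s′ ∷ []) _ Γ eq → subst-case φ s s′ (p Γ eq) (q Γ eq) })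
    ∷ (λ { (n ∷ a ∷ []) _ _ Γ eq → ∃' (var zero ≐ var zero) , refl , nonempty })
    ∷ []
    where
    var-case : ∀ {s i a} {σ : Fin m → Term L n} → Holds (look ∙ s ∷ i ∷ a ∷ []) → Represents s σ → ∀ t →
               Σ[ x ∈ Fin m ] t ≡ var x × toℕ x ≡ i → cT (subT σ t) ≡ a
    var-case looked r _ (x , refl , x≡i) = looked r x x≡i

    fn-case : ∀ {s k c a b} {σ : Fin m → Term L n} → Holds (subTs′ ∙ s ∷ a ∷ b ∷ []) → Represents s σ → ∀ t →
              Σ[ f ∈ Fun k ] Σ[ ts ∈ Vec (Term L m) k ] t ≡ fn f ts × codeF f ≡ c × cTs ts ≡ a →
              cT (subT σ t) ≡ ⟪ 1 , ⟪ k , ⟪ c , b ⟫ ⟫ ⟫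
    fn-case subbed r _ (f , ts , refl , refl , eq) = cong (λ b → ⟪ 1 , ⟪ _ , ⟪ _ , b ⟫ ⟫ ⟫) (subbed r ts eq)

    ≐-case : ∀ {s a b c d φ} {σ : Fin m → Term L n} → Holds (subT′ ∙ s ∷ a ∷ b ∷ []) → Holds (subT′ ∙ s ∷ c ∷ d ∷ []) →
             Represents s σ → Σ[ t ∈ Term L m ] Σ[ u ∈ Term L m ] φ ≡ t ≐ u × cT t ≡ a × cT u ≡ c →
             cF (sub σ φ) ≡ ⟪ 1 , ⟪ b , d ⟫ ⟫
    ≐-case p q r (t , u , refl , e , f) = cong₂ (λ x y → ⟪ 1 , ⟪ x , y ⟫ ⟫) (p r t e) (q r u f)

    rel-case : ∀ {s k c a b φ} {σ : Fin m → Term L n} → Holds (subTs′ ∙ s ∷ a ∷ b ∷ []) → Represents s σ →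
               Σ[ r ∈ Rel k ] Σ[ ts ∈ Vec (Term L m) k ] φ ≡ rel r ts × codeR r ≡ c × cTs ts ≡ a →
               cF (sub σ φ) ≡ ⟪ 2 , ⟪ k , ⟪ c , b ⟫ ⟫ ⟫
    rel-case p r (_ , ts , refl , refl , eq) = cong (λ b → ⟪ 2 , ⟪ _ , ⟪ _ , b ⟫ ⟫ ⟫) (p r ts eq)

    ⇒-case : ∀ {s a b c d φ} {σ : Fin m → Term L n} → Holds (subF ∙ s ∷ a ∷ b ∷ []) → Holds (subF ∙ s ∷ c ∷ d ∷ []) →
             Represents s σ → Σ[ ψ ∈ Formula L m ] Σ[ χ ∈ Formula L m ] φ ≡ (ψ ⇒ χ) × cF ψ ≡ a × cF χ ≡ c →
             cF (sub σ φ) ≡ ⟪ 3 , ⟪ b , d ⟫ ⟫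
    ⇒-case p q r (ψ , χ , refl , e , f) = cong₂ (λ x y → ⟪ 3 , ⟪ x , y ⟫ ⟫) (p r ψ e) (q r χ f)

    ∀-case : ∀ {s a b φ} {σ : Fin m → Term L n} → Holds (subF ∙ ⟪ 2 , s ⟫ ∷ a ∷ b ∷ []) → Represents s σ →
             Σ[ ψ ∈ Formula L (suc m) ] φ ≡ ∀' ψ × cF ψ ≡ a → cF (sub σ φ) ≡ ⟪ 4 , b ⟫
    ∀-case p r (ψ , refl , e) = cong ⟪ 4 ,_⟫ (p (by-lift r refl) ψ e)

    ⇒E-case : ∀ {a b} {Γ : List (Formula L n)} → Σ[ φ ∈ Formula L n ] cF φ ≡ ⟪ 3 , ⟪ a , b ⟫ ⟫ × (T ∣ Γ ⊢ φ) →
              Σ[ φ ∈ Formula L n ] cF φ ≡ a × (T ∣ Γ ⊢ φ) → Σ[ φ ∈ Formula L n ] cF φ ≡ b × (T ∣ Γ ⊢ φ)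
    ⇒E-case (φ , e , d) (ψ , f , d′) with invert-⇒ φ e
    ... | ψ′ , χ , refl , g , h with cF-injective ψ ψ′ (trans f (sym g))
    ...   | refl = χ , h , ⇒E d d′

    ∀E-case : ∀ {a b} {Γ : List (Formula L n)} (t : Term L n) → Holds (subF ∙ ⟪ 1 , cT t ⟫ ∷ a ∷ b ∷ []) →
              Σ[ φ ∈ Formula L n ] cF φ ≡ ⟪ 4 , a ⟫ × (T ∣ Γ ⊢ φ) → Σ[ φ ∈ Formula L n ] cF φ ≡ b × (T ∣ Γ ⊢ φ)
    ∀E-case t p (φ , e , d) with invert-∀ φ e
    ... | ψ , refl , f = inst ψ t , p (by-inst t refl) ψ f , ∀E t d

    subst-case : ∀ {a b c d} {Γ : List (Formula L n)} (φ : Formula L (suc n)) →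
                 Holds (subF ∙ ⟪ 1 , a ⟫ ∷ cF φ ∷ c ∷ []) → Holds (subF ∙ ⟪ 1 , b ⟫ ∷ cF φ ∷ d ∷ []) →
                 Σ[ φ ∈ Formula L n ] cF φ ≡ ⟪ 1 , ⟪ a , b ⟫ ⟫ × (T ∣ Γ ⊢ φ) →
                 Σ[ φ ∈ Formula L n ] cF φ ≡ c × (T ∣ Γ ⊢ φ) → Σ[ φ ∈ Formula L n ] cF φ ≡ d × (T ∣ Γ ⊢ φ)
    subst-case φ p q (ε , e , d) (ψ , f , d′) with invert-≐ ε e
    ... | t , u , refl , refl , refl with cF-injective ψ (inst φ t) (trans f (sym (p (by-inst t refl) φ refl)))
    ...   | refl = inst φ u , q (by-inst u refl) φ refl , ≐subst φ d d′

  ⊢ʰ-sound : ∀ {j} → rules ⊢ʰ j → Holds j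
  ⊢ʰ-sound = ⊢ʰ-induction (lookup⁺ rules-sound)

  -- The numbers # i are positions in the list of rules.
  derive-lt : {n : ℕ} (x : Fin n) → rules ⊢ʰ (lt ∙ toℕ x ∷ n ∷ 0 ∷ [])
  derive-lt zero    = step (# 0) (_ ∷ []) [] λ ()
  derive-lt (suc x) = step (# 1) (toℕ x ∷ _ ∷ []) (derive-lt x ∷ []) λ ()

  mutual
    derive-wfT : (t : Term L n) → rules ⊢ʰ (wfT ∙ n ∷ cT t ∷ 0 ∷ [])
    derive-wfT (var x)   = step (# 2) (toℕ x ∷ _ ∷ []) (derive-lt x ∷ []) λ ()
    derive-wfT (fn f ts) = step (# 3) (_ ∷ _ ∷ codeF f ∷ cTs ts ∷ []) (derive-wfTs ts ∷ [])
                             (characteristic-complete (proj₁ recL) (_ ∷ _ ∷ []) (f , refl))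

    derive-wfTs : (ts : Vec (Term L n) k) → rules ⊢ʰ (wfTs ∙ n ∷ k ∷ cTs ts ∷ [])
    derive-wfTs []       = step (# 4) (_ ∷ []) [] λ ()
    derive-wfTs (t ∷ ts) = step (# 5) (_ ∷ _ ∷ cT t ∷ cTs ts ∷ []) (derive-wfT t ∷ derive-wfTs ts ∷ []) λ ()

  derive-wfF : (φ : Formula L n) → rules ⊢ʰ (wfF ∙ n ∷ cF φ ∷ 0 ∷ [])
  derive-wfF ⊥'         = step (# 6) (_ ∷ []) [] λ ()
  derive-wfF (t ≐ u)    = step (# 7) (_ ∷ cT t ∷ cT u ∷ []) (derive-wfT t ∷ derive-wfT u ∷ []) λ ()
  derive-wfF (rel r ts) = step (# 8) (_ ∷ _ ∷ codeR r ∷ cTs ts ∷ []) (derive-wfTs ts ∷ [])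
                            (characteristic-complete (proj₂ recL) (_ ∷ _ ∷ []) (r , refl))
  derive-wfF (φ ⇒ ψ)    = step (# 9) (_ ∷ cF φ ∷ cF ψ ∷ []) (derive-wfF φ ∷ derive-wfF ψ ∷ []) λ ()
  derive-wfF (∀' φ)     = step (# 10) (_ ∷ cF φ ∷ []) (derive-wfF φ ∷ []) λ ()

  DerivesLook : ℕ → (Fin m → Term L n) → Set
  DerivesLook s σ = ∀ x → rules ⊢ʰ (look ∙ s ∷ toℕ x ∷ cT (σ x) ∷ [])

  mutual
    derive-subT : ∀ {s} {σ : Fin m → Term L n} → DerivesLook s σ →
                  ∀ t → rules ⊢ʰ (subT′ ∙ s ∷ cT t ∷ cT (subT σ t) ∷ [])
    derive-subT {σ = σ} l (var x)   = step (# 16) (_ ∷ toℕ x ∷ cT (σ x) ∷ []) (l x ∷ []) λ ()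
    derive-subT {σ = σ} l (fn f ts) = step (# 17) (_ ∷ _ ∷ codeF f ∷ cTs ts ∷ cTs (subTs σ ts) ∷ []) (derive-subTs l ts ∷ []) λ ()

    derive-subTs : ∀ {s} {σ : Fin m → Term L n} → DerivesLook s σ →
                   ∀ (ts : Vec (Term L m) k) → rules ⊢ʰ (subTs′ ∙ s ∷ cTs ts ∷ cTs (subTs σ ts) ∷ [])
    derive-subTs l [] = step (# 18) (_ ∷ []) [] λ ()
    derive-subTs {σ = σ} l (t ∷ ts) =
      step (# 19) (_ ∷ cT t ∷ cT (subT σ t) ∷ cTs ts ∷ cTs (subTs σ ts) ∷ []) (derive-subT l t ∷ derive-subTs l ts ∷ []) λ ()

  derive-look-shift : DerivesLook ⟪ 0 , 0 ⟫ (var ∘ suc {n})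
  derive-look-shift x = step (# 11) (toℕ x ∷ []) [] λ ()

  derive-look : ∀ {s} {σ : Fin m → Term L n} → Represents s σ → DerivesLook s σ
  derive-look (by-shift refl)          = derive-look-shift
  derive-look (by-inst t refl) zero    = step (# 12) (cT t ∷ []) [] λ ()
  derive-look (by-inst t refl) (suc x) = step (# 13) (cT t ∷ toℕ x ∷ []) [] λ ()
  derive-look (by-lift r refl) zero    = step (# 14) (_ ∷ []) [] λ ()
  derive-look (by-lift {σ = σ} r refl) (suc x) =
    subst (λ t → rules ⊢ʰ (look ∙ _ ∷ _ ∷ cT t ∷ [])) (sym (renT≡subT suc (σ x)))
      (step (# 15) (_ ∷ toℕ x ∷ cT (σ x) ∷ _ ∷ [])
        (derive-look r x ∷ derive-subT derive-look-shift (σ x) ∷ []) λ ())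

  derive-subF : ∀ {s} {σ : Fin m → Term L n} → Represents s σ →
                ∀ φ → rules ⊢ʰ (subF ∙ s ∷ cF φ ∷ cF (sub σ φ) ∷ [])
  derive-subF r ⊥' = step (# 20) (_ ∷ []) [] λ ()
  derive-subF {σ = σ} r (t ≐ u) = step (# 21) (_ ∷ cT t ∷ cT (subT σ t) ∷ cT u ∷ cT (subT σ u) ∷ [])
    (derive-subT (derive-look r) t ∷ derive-subT (derive-look r) u ∷ []) λ ()
  derive-subF {σ = σ} r (rel p ts) = step (# 22) (_ ∷ _ ∷ codeR p ∷ cTs ts ∷ cTs (subTs σ ts) ∷ [])
    (derive-subTs (derive-look r) ts ∷ []) λ ()
  derive-subF {σ = σ} r (φ ⇒ ψ) = step (# 23) (_ ∷ cF φ ∷ cF (sub σ φ) ∷ cF ψ ∷ cF (sub σ ψ) ∷ [])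
    (derive-subF r φ ∷ derive-subF r ψ ∷ []) λ ()
  derive-subF {s = s} r (∀' φ) = step (# 24) (s ∷ cF φ ∷ _ ∷ []) (derive-subF (by-lift r refl) φ ∷ []) λ ()

  derive-shiftCtx : (Γ : List (Formula L n)) → rules ⊢ʰ (shiftCtx ∙ cC Γ ∷ cC (List.map shift Γ) ∷ 0 ∷ [])
  derive-shiftCtx []      = step (# 25) [] [] λ ()
  derive-shiftCtx (φ ∷ Γ) = step (# 26) (cF φ ∷ cF (shift φ) ∷ cC Γ ∷ cC (List.map shift Γ) ∷ [])
    (derive-subF (by-shift refl) φ ∷ derive-shiftCtx Γ ∷ []) λ ()

  derive-mem : {Γ : List (Formula L n)} {φ : Formula L n} → φ ∈ Γ → rules ⊢ʰ (mem ∙ cF φ ∷ cC Γ ∷ 0 ∷ [])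
  derive-mem {Γ = ψ ∷ Γ} (here refl) = step (# 27) (cF ψ ∷ cC Γ ∷ []) [] λ ()
  derive-mem {Γ = ψ ∷ Γ} (there φ∈)  = step (# 28) (_ ∷ cF ψ ∷ cC Γ ∷ []) (derive-mem φ∈ ∷ []) λ ()

  derive-prv : {Γ : List (Formula L n)} {φ : Formula L n} → T ∣ Γ ⊢ φ → rules ⊢ʰ (prv ∙ n ∷ cC Γ ∷ cF φ ∷ [])
  derive-prv {Γ = Γ} (axiom {φ} Tφ) = step (# 29) (_ ∷ cC Γ ∷ cF (sub ε φ) ∷ []) []
    (characteristic-complete recT (_ ∷ []) (φ , Tφ , trans (sym (cF≡⌜⌝ φ)) (sym (cF-sub-ε φ))))
  derive-prv {Γ = Γ} {φ} (hyp φ∈) = step (# 30) (_ ∷ cC Γ ∷ cF φ ∷ []) (derive-mem φ∈ ∷ []) λ ()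
  derive-prv {Γ = Γ} (⇒I {φ} {ψ} d) = step (# 31) (_ ∷ cC Γ ∷ cF φ ∷ cF ψ ∷ []) (derive-wfF φ ∷ derive-prv d ∷ []) λ ()
  derive-prv {Γ = Γ} (⇒E {φ} {ψ} d e) = step (# 32) (_ ∷ cC Γ ∷ cF φ ∷ cF ψ ∷ []) (derive-prv d ∷ derive-prv e ∷ []) λ ()
  derive-prv {Γ = Γ} {φ} (raa d) = step (# 33) (_ ∷ cC Γ ∷ cF φ ∷ []) (derive-wfF φ ∷ derive-prv d ∷ []) λ ()
  derive-prv {Γ = Γ} (∀I {φ} d) = step (# 34) (_ ∷ cC Γ ∷ cC (List.map shift Γ) ∷ cF φ ∷ []) (derive-shiftCtx Γ ∷ derive-prv d ∷ []) λ ()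
  derive-prv {Γ = Γ} (∀E {φ} t d) = step (# 35) (_ ∷ cC Γ ∷ cT t ∷ cF φ ∷ cF (inst φ t) ∷ [])
    (derive-wfT t ∷ derive-prv d ∷ derive-subF (by-inst t refl) φ ∷ []) λ ()
  derive-prv {Γ = Γ} (≐refl t) = step (# 36) (_ ∷ cC Γ ∷ cT t ∷ []) (derive-wfT t ∷ []) λ ()
  derive-prv {Γ = Γ} (≐subst {t} {u} φ d e) =
    step (# 37) (_ ∷ cC Γ ∷ cT t ∷ cT u ∷ cF φ ∷ cF (inst φ t) ∷ cF (inst φ u) ∷ [])
      (derive-wfF φ ∷ derive-prv d ∷ derive-subF (by-inst t refl) φ ∷ derive-prv e ∷ derive-subF (by-inst u refl) φ ∷ []) λ ()
  derive-prv {Γ = Γ} nonempty = step (# 38) (_ ∷ cC Γ ∷ []) [] λ ()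

  theorem : ℕ → Judgment
  theorem c = prv ∙ 0 ∷ 0 ∷ c ∷ []

  theorem-sound : (φ : Sentence L) → rules ⊢ʰ theorem (cF φ) → T ⊢ φ
  theorem-sound φ d with ⊢ʰ-sound d [] refl
  ... | ψ , eq , e = subst (T ⊢_) (cF-injective ψ φ eq) e

  theorem-complete : {φ : Sentence L} → T ⊢ φ → rules ⊢ʰ theorem (cF φ)
  theorem-complete = derive-prv

  theoremᶠ : Fn 1
  theoremᶠ = respec (atomᶠ (at₃ prv (lit 0) (lit 0) (v 0))) (λ { (c ∷ []) → codeJ (theorem c) }) λ { (c ∷ []) → refl }

  complete⇒decidable : Consistent T → Complete T →
                       (χ : ℕ → Sentence L) (χᶠ : Fn 1) → (∀ n → fun χᶠ (n ∷ []) ≡ cF (χ n)) →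
                       Recursive (λ n → T ⊢ χ n)
  complete⇒decidable consistent complete χ χᶠ χ-code = proj₁ decidable , λ { (n ∷ []) → transport n (proj₂ decidable (n ∷ [])) }
    where
    ¬χᶠ : Fn 1
    ¬χᶠ = expᶠ (¬ᴱ (v 0)) ⟨ χᶠ ⟩
    either : ∀ n → (rules ⊢ʰ theorem (cF (χ n))) ⊎ (rules ⊢ʰ theorem (cF (¬' χ n)))
    either n with complete (χ n)
    ... | inj₁ d = inj₁ (theorem-complete d)
    ... | inj₂ d = inj₂ (theorem-complete d)
    open Enumeration rules
    open Decision (λ n → theorem (cF (χ n))) (λ n → theorem (cF (¬' χ n))) (theoremᶠ ⟨ χᶠ ⟩) (theoremᶠ ⟨ ¬χᶠ ⟩)
      (λ n → cong (λ c → codeJ (theorem c)) (χ-code n))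
      (λ n → cong (λ c → codeJ (theorem ⟪ 3 , ⟪ c , ⟪ 0 , 0 ⟫ ⟫ ⟫)) (χ-code n))
      either
      (λ n d e → consistent (⇒E (theorem-sound (¬' χ n) e) (theorem-sound (χ n) d)))
    transport : ∀ n → ((rules ⊢ʰ theorem (cF (χ n))) × decideᵣ · (n ∷ []) ⇓ 1) ⊎
                      (¬ (rules ⊢ʰ theorem (cF (χ n))) × decideᵣ · (n ∷ []) ⇓ 0) →
                ((T ⊢ χ n) × decideᵣ · (n ∷ []) ⇓ 1) ⊎ (¬ (T ⊢ χ n) × decideᵣ · (n ∷ []) ⇓ 0)
    transport n (inj₁ (d , r))  = inj₁ (theorem-sound (χ n) d , r)
    transport n (inj₂ (¬d , r)) = inj₂ ((λ e → ¬d (theorem-complete e)) , r)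

-- The first incompleteness theorem for U

∃ᴱ : Exp k → Exp k
∃ᴱ a = ¬ᴱ (∀ᴱ (¬ᴱ a))

_∧ᴱ_ : Exp k → Exp k → Exp k
a ∧ᴱ b = ¬ᴱ (a ⇒ᴱ ¬ᴱ b)

module TranslatedNumerals {L′ : Language} (τ : Translation LU L′) where

  open Translation τ

  domCode zeroCode sucCode : ℕ
  domCode  = cF (Dom {1} zero)
  zeroCode = cF (value {n = 0} {m = 1} (λ ()) (numU 0) zero)
  sucCode  = cF (Graph {m = 2} 𝐒 (_↑ˡ 1) (suc zero))

  Dom-code : cF (Dom {suc m} zero) ≡ domCode
  Dom-code = cF-sub (λ { zero → same refl }) dom

  stepᴱ : Exp 1
  stepᴱ = ∃ᴱ (lit domCode ∧ᴱ ((v 0 ∧ᴱ ¬ᴱ ⊥ᴱ) ∧ᴱ lit sucCode))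

  valueCode : ℕ → ℕ
  valueCode zero    = zeroCode
  valueCode (suc n) = evalE stepᴱ (valueCode n ∷ [])

  value-code : ∀ n (ρ : Fin 0 → Fin m) {y} → toℕ y ≡ 0 → cF (value ρ (numU n) y) ≡ valueCode n
  value-code zero ρ y≡0 = cong (λ c → ⟪ 3 , ⟪ ⟪ 3 , ⟪ _ , ⟪ 3 , ⟪ c , _ ⟫ ⟫ ⟫ ⟫ , _ ⟫ ⟫)
    (cF-sub (λ { zero → same y≡0 ; (suc ()) }) (funᵗ 𝟎))
  value-code {m} (suc n) ρ y≡0 = trans
    (cong₂ (λ d g → ex d (cF (value (suc ∘ ρ) (numU n) zero)) g)
      (Dom-code {m}) (cF-sub {σ′ = var ∘ (suc zero ▸ (_↑ˡ 1))} (λ { zero → same (cong suc y≡0) ; (suc zero) → same refl }) (funᵗ 𝐒)))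
    (cong (λ c → ex domCode c sucCode) (value-code n (suc ∘ ρ) refl))
    where
    ex : ℕ → ℕ → ℕ → ℕ
    ex d c g = evalE (∃ᴱ (v 0 ∧ᴱ ((v 1 ∧ᴱ ¬ᴱ ⊥ᴱ) ∧ᴱ v 2))) (d ∷ c ∷ g ∷ [])

  P̂ : ℕ → Sentence L′
  P̂ n = (rel 𝐏 (numU n ∷ [])) ᵗ

  P̂ᶠ : Fn 1
  P̂ᶠ = expᶠ (∃ᴱ (lit domCode ∧ᴱ ((v 0 ∧ᴱ ¬ᴱ ⊥ᴱ) ∧ᴱ lit (cF (Relᵗ {m = 1} 𝐏 (_↑ˡ 0))))))
         ⟨ respec (recᶠ (constᶠ zeroCode) (expᶠ stepᴱ ⟨ π (# 1) ⟩)) (λ { (n ∷ []) → valueCode n }) (λ { (n ∷ []) → go n }) ⟩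
    where
    go : ∀ n → _ ≡ valueCode n
    go zero    = refl
    go (suc n) = cong (λ c → evalE stepᴱ (c ∷ [])) (go n)

  P̂-code : ∀ n → fun P̂ᶠ (n ∷ []) ≡ cF (P̂ n)
  P̂-code n = cong (λ c → evalE (∃ᴱ (lit domCode ∧ᴱ ((v 0 ∧ᴱ ¬ᴱ ⊥ᴱ) ∧ᴱ lit (cF (Relᵗ {m = 1} 𝐏 (_↑ˡ 0)))))) (c ∷ []))
    (sym (value-code n (1 ↑ʳ_) refl))

G1-U : ∀ {A B} → RecursivelyInseparable A B → G1 (U A B)
G1-U {A} {B} insep S (recL , T , recT , S⇔T) consistent (τ , int) complete =
  inseparable ((λ n → T ⊢ P̂ n) , complete⇒decidable consistentT completeT P̂ P̂ᶠ P̂-code ,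
    (λ n a → S⇒T (axioms _ (positive a))) ,
    (λ n (d , b) → consistentT (⇒E (S⇒T (axioms _ (negative b))) d)))
  where
  open RecursivelyInseparable insep
  open IsInterpretation int
  open TranslatedNumerals τ
  open ProofRules recL T recT
  S⇒T : ∀ {φ} → S ⊢ φ → T ⊢ φ
  S⇒T = Equivalence.to (S⇔T _)
  consistentT : Consistent T
  consistentT d = consistent (Equivalence.from (S⇔T _) d)
  completeT : Complete T
  completeT φ = Sum.map S⇒T S⇒T (complete φ)

-- U is recursively enumerable

recursiveRel : {X : Vec ℕ k → Set} (f : Fn k) →
               (∀ xs → (X xs × fun f xs ≡ 1) ⊎ (¬ X xs × fun f xs ≡ 0)) → RecursiveRel X
recursiveRel f decides = code f , λ xs →
  Sum.map (λ (x , eq) → x , subst (code f · xs ⇓_) eq (computes f xs))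
          (λ (¬x , eq) → ¬x , subst (code f · xs ⇓_) eq (computes f xs)) (decides xs)

recursive-LU : RecursiveLanguage LU
recursive-LU =
    recursiveRel (andᶠ ⟨ notᶠ ⟨ predᶠ ⟨ π (# 1) ⟩ ⟩ ⨾ eqᶠ ⟩)
      (λ { (0 ∷ 0 ∷ [])           → inj₁ ((𝟎 , refl) , refl)
         ; (0 ∷ 1 ∷ [])           → inj₂ ((λ { (𝟎 , ()) }) , refl)
         ; (0 ∷ suc (suc c) ∷ []) → inj₂ ((λ { (𝟎 , ()) }) , refl)
         ; (1 ∷ 0 ∷ [])           → inj₂ ((λ { (𝐒 , ()) }) , refl)
         ; (1 ∷ 1 ∷ [])           → inj₁ ((𝐒 , refl) , refl)
         ; (1 ∷ suc (suc c) ∷ []) → inj₂ ((λ { (𝐒 , ()) }) , refl)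
         ; (suc (suc k) ∷ 0 ∷ []) → inj₂ ((λ { (() , _) }) , refl)
         ; (suc (suc k) ∷ 1 ∷ []) → inj₂ ((λ { (() , _) }) , refl)
         ; (suc (suc k) ∷ suc (suc c) ∷ []) → inj₂ ((λ { (() , _) }) , refl) })
  , recursiveRel (andᶠ ⟨ eqᶠ ⟨ π (# 0) ⨾ constᶠ 1 ⟩ ⨾ notᶠ ⟨ π (# 1) ⟩ ⟩)
      (λ { (0 ∷ c ∷ [])           → inj₂ ((λ { (() , _) }) , refl)
         ; (1 ∷ 0 ∷ [])           → inj₁ ((𝐏 , refl) , refl)
         ; (1 ∷ suc c ∷ [])       → inj₂ ((λ { (𝐏 , ()) }) , refl)
         ; (suc (suc k) ∷ c ∷ []) → inj₂ ((λ { (() , _) }) , refl) })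

numU-injective : ∀ {a b} → numU {n} a ≡ numU b → a ≡ b
numU-injective {n = n} {a} {b} eq = trans (sym (depth-numU a)) (trans (cong depth eq) (depth-numU b))
  where
  depth : Term LU n → ℕ
  depth (var x)         = 0
  depth (fn 𝟎 [])       = 0
  depth (fn 𝐒 (t ∷ [])) = suc (depth t)
  depth-numU : ∀ a → depth (numU a) ≡ a
  depth-numU zero    = refl
  depth-numU (suc a) = cong suc (depth-numU a)

numᶠ : Fn 1
numᶠ = respec (recᶠ (constᶠ (cT {LU} {0} (numU 0))) (expᶠ (fnᴱ (lit 1) (lit 1) (v 1 ∷ᴱ nilᴱ))))
  (λ { (n ∷ []) → cT {LU} {0} (numU n) }) λ { (n ∷ []) → go n }
  where
  go : ∀ n → _ ≡ cT {LU} {0} (numU n)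
  go zero    = refl
  go (suc n) = cong (λ c → ⟪ 1 , ⟪ 1 , ⟪ 1 , suc ⟪ c , 0 ⟫ ⟫ ⟫ ⟫) (go n)

axiomOf : ℕ → ℕ → ℕ → Sentence LU
axiomOf 0 m n             = ¬' (numU m ≐ numU n)
axiomOf 1 m n             = rel 𝐏 (numU n ∷ [])
axiomOf (suc (suc _)) m n = ¬' rel 𝐏 (numU n ∷ [])

axiomOfᶠ : Fn 3
axiomOfᶠ = respec
  (caseᶠ ⟨ π (# 0)
         ⨾ caseᶠ ⟨ predᶠ ⟨ π (# 0) ⟩
                 ⨾ expᶠ (¬ᴱ (relᴱ (lit 1) (lit 0) (v 0 ∷ᴱ nilᴱ))) ⟨ numᶠ ⟨ π (# 2) ⟩ ⟩
                 ⨾ expᶠ (relᴱ (lit 1) (lit 0) (v 0 ∷ᴱ nilᴱ)) ⟨ numᶠ ⟨ π (# 2) ⟩ ⟩ ⟩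
         ⨾ expᶠ (¬ᴱ (v 0 ≐ᴱ v 1)) ⟨ numᶠ ⟨ π (# 1) ⟩ ⨾ numᶠ ⟨ π (# 2) ⟩ ⟩ ⟩)
  (λ { (t ∷ m ∷ n ∷ []) → cF (axiomOf t m n) })
  λ { (0 ∷ m ∷ n ∷ []) → refl ; (1 ∷ m ∷ n ∷ []) → refl ; (suc (suc _) ∷ m ∷ n ∷ []) → refl }

-- The argument is ⟪ t , ⟪ m , n ⟫ ⟫.
tagᶠ mᶠ nᶠ axiomCodeᶠ validᶠ : Fn 1
tagᶠ = fstᶠ
mᶠ = fstᶠ ⟨ sndᶠ ⟩
nᶠ = sndᶠ ⟨ sndᶠ ⟩
axiomCodeᶠ = axiomOfᶠ ⟨ tagᶠ ⨾ mᶠ ⨾ nᶠ ⟩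
validᶠ = caseᶠ ⟨ tagᶠ ⨾ constᶠ 1 ⨾ notᶠ ⟨ eqᶠ ⟨ mᶠ ⨾ nᶠ ⟩ ⟩ ⟩

mismatchᶠ : Fn 2
mismatchᶠ = notᶠ ⟨ andᶠ ⟨ eqᶠ ⟨ axiomCodeᶠ ⟨ π (# 0) ⟩ ⨾ π (# 1) ⟩ ⨾ validᶠ ⟨ π (# 0) ⟩ ⟩ ⟩

runIf : Rec 1 → Rec 2
runIf c = prim zeroᵣ (comp c (proj (# 2) ∷ []))

runIf-on : ∀ {c n} → (∃[ y ] runIf c · (1 ∷ n ∷ []) ⇓ y) ⇔ (∃[ y ] c · (n ∷ []) ⇓ y)
runIf-on = mk⇔ (λ { (y , ⇓primS _ (⇓comp (⇓proj _ ∷ []) d)) → y , d })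
               (λ { (y , d) → y , ⇓primS (⇓prim0 ⇓zero) (⇓comp (⇓proj (# 2) ∷ []) d) })

isPositiveᶠ isNegativeᶠ : Fn 1
isPositiveᶠ = caseᶠ ⟨ tagᶠ ⨾ notᶠ ⟨ predᶠ ⟨ tagᶠ ⟩ ⟩ ⨾ constᶠ 0 ⟩
isNegativeᶠ = notᶠ ⟨ notᶠ ⟨ predᶠ ⟨ tagᶠ ⟩ ⟩ ⟩

module _ {A B : ℕ → Set} (re-A : RE A) (re-B : RE B) where

  verify : Rec 1
  verify = comp (zeroᵣ {2})
    ( comp (runIf (proj₁ re-A)) (code isPositiveᶠ ∷ code nᶠ ∷ [])
    ∷ comp (runIf (proj₁ re-B)) (code isNegativeᶠ ∷ code nᶠ ∷ []) ∷ [])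

  enumerate : Rec 1
  enumerate = comp verify (mu (code mismatchᶠ) ∷ [])

  Verified : ℕ → ℕ → Set
  Verified 0             n = ⊤
  Verified 1             n = A n
  Verified (suc (suc _)) n = B n

  run-flag : ∀ {c} {flag : Fn 1} {w x y} → fun flag (w ∷ []) ≡ x →
             comp (runIf c) (code flag ∷ code nᶠ ∷ []) · (w ∷ []) ⇓ y →
             runIf c · (x ∷ fun nᶠ (w ∷ []) ∷ []) ⇓ y
  run-flag {c} {flag} {w} eq (⇓comp (d ∷ e ∷ []) r)
    with ⇓-deterministic d (computes flag (w ∷ [])) | ⇓-deterministic e (computes nᶠ (w ∷ []))
  ... | refl | refl rewrite eq = r

  verify-sound : ∀ {w y} → verify · (w ∷ []) ⇓ y → Verified (fst w) (fun nᶠ (w ∷ []))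
  verify-sound {w} (⇓comp (a ∷ b ∷ []) _) = go (fst w) refl
    where
    go : ∀ t → fst w ≡ t → Verified t (fun nᶠ (w ∷ []))
    go 0 eq = tt
    go 1 eq = Equivalence.from (proj₂ re-A _) (Equivalence.to runIf-on
      (_ , run-flag {flag = isPositiveᶠ} (cong (λ t → fun caseᶠ (t ∷ not (pred t) ∷ 0 ∷ [])) eq) a))
    go (suc (suc _)) eq = Equivalence.from (proj₂ re-B _) (Equivalence.to runIf-on
      (_ , run-flag {flag = isNegativeᶠ} (cong (λ t → not (not (pred t))) eq) b))

  flag-run : ∀ {c} {flag : Fn 1} {w x} → fun flag (w ∷ []) ≡ x →
             ∃[ y ] runIf c · (x ∷ fun nᶠ (w ∷ []) ∷ []) ⇓ y →
             ∃[ y ] comp (runIf c) (code flag ∷ code nᶠ ∷ []) · (w ∷ []) ⇓ y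
  flag-run {flag = flag} {w} refl (y , d) = y , ⇓comp (computes flag (w ∷ []) ∷ computes nᶠ (w ∷ []) ∷ []) d

  verify-complete : ∀ {w} → Verified (fst w) (fun nᶠ (w ∷ [])) → ∃[ y ] verify · (w ∷ []) ⇓ y
  verify-complete {w} h = 0 , ⇓comp (proj₂ runA ∷ proj₂ runB ∷ []) ⇓zero
    where
    goA : ∀ t → fst w ≡ t → Verified t (fun nᶠ (w ∷ [])) →
          ∃[ y ] comp (runIf (proj₁ re-A)) (code isPositiveᶠ ∷ code nᶠ ∷ []) · (w ∷ []) ⇓ y
    goA 0 eq _ = flag-run {flag = isPositiveᶠ} (cong (λ t → fun caseᶠ (t ∷ not (pred t) ∷ 0 ∷ [])) eq) (0 , ⇓prim0 ⇓zero)
    goA 1 eq a = flag-run {flag = isPositiveᶠ} (cong (λ t → fun caseᶠ (t ∷ not (pred t) ∷ 0 ∷ [])) eq)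
      (Equivalence.from runIf-on (Equivalence.to (proj₂ re-A _) a))
    goA (suc (suc _)) eq _ = flag-run {flag = isPositiveᶠ} (cong (λ t → fun caseᶠ (t ∷ not (pred t) ∷ 0 ∷ [])) eq) (0 , ⇓prim0 ⇓zero)
    goB : ∀ t → fst w ≡ t → Verified t (fun nᶠ (w ∷ [])) →
          ∃[ y ] comp (runIf (proj₁ re-B)) (code isNegativeᶠ ∷ code nᶠ ∷ []) · (w ∷ []) ⇓ y
    goB 0 eq _ = flag-run {flag = isNegativeᶠ} (cong (λ t → not (not (pred t))) eq) (0 , ⇓prim0 ⇓zero)
    goB 1 eq _ = flag-run {flag = isNegativeᶠ} (cong (λ t → not (not (pred t))) eq) (0 , ⇓prim0 ⇓zero)
    goB (suc (suc _)) eq b = flag-run {flag = isNegativeᶠ} (cong (λ t → not (not (pred t))) eq)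
      (Equivalence.from runIf-on (Equivalence.to (proj₂ re-B _) b))
    runA = goA (fst w) refl h
    runB = goB (fst w) refl h

  valid : ℕ → ℕ → ℕ → ℕ
  valid t m n = fun caseᶠ (t ∷ 1 ∷ not (eqᵇ m n) ∷ [])

  axiom-sound : ∀ t m n → valid t m n ≢ 0 → Verified t n → U A B (axiomOf t m n)
  axiom-sound 0 m n ok _ = distinct λ { refl → ok (cong not (eqᵇ-refl m)) }
  axiom-sound 1 m n _ a = positive a
  axiom-sound (suc (suc _)) m n _ b = negative b

  U-positive : ∀ {φ n} → U A B φ → φ ≡ rel 𝐏 (numU n ∷ []) → A n
  U-positive (positive a) eq = subst A (numU-injective (rel-arg eq)) a
    where
    rel-arg : ∀ {t u : Term LU 0} → _≡_ {A = Sentence LU} (rel 𝐏 (t ∷ [])) (rel 𝐏 (u ∷ [])) → t ≡ u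
    rel-arg refl = refl

  U-negative : ∀ {φ n} → U A B φ → φ ≡ ¬' rel 𝐏 (numU n ∷ []) → B n
  U-negative (negative b) eq = subst B (numU-injective (rel-arg eq)) b
    where
    rel-arg : ∀ {t u : Term LU 0} → _≡_ {A = Sentence LU} (¬' rel 𝐏 (t ∷ [])) (¬' rel 𝐏 (u ∷ [])) → t ≡ u
    rel-arg refl = refl

  axiom-verified : ∀ t m n → U A B (axiomOf t m n) → Verified t n
  axiom-verified 0 m n _ = tt
  axiom-verified 1 m n u = U-positive u refl
  axiom-verified (suc (suc _)) m n u = U-negative u refl

  axiom-complete : ∀ {φ} → U A B φ → ∃[ t ] ∃[ m ] ∃[ n ] axiomOf t m n ≡ φ × valid t m n ≢ 0
  axiom-complete (distinct {m} {n} m≢n) = 0 , m , n , refl , λ z → contradiction (trans (sym (cong not (≢⇒eqᵇ m≢n))) z) λ ()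
  axiom-complete (positive {n} _) = 1 , 0 , n , refl , λ ()
  axiom-complete (negative {n} _) = 2 , 0 , n , refl , λ ()

  mismatch-sound : ∀ {w x} → fun mismatchᶠ (w ∷ x ∷ []) ≡ 0 → fun axiomCodeᶠ (w ∷ []) ≡ x × fun validᶠ (w ∷ []) ≢ 0
  mismatch-sound {w} {x} z = eqᵇ⇒≡ (and-elimˡ a b nz) , and-elimʳ a b nz
    where
    a = eqᵇ (fun axiomCodeᶠ (w ∷ [])) x
    b = fun validᶠ (w ∷ [])
    nz : fun andᶠ (a ∷ b ∷ []) ≢ 0
    nz eq = contradiction (trans (sym (cong not eq)) z) λ ()

  mismatch-complete : ∀ {w x} → fun axiomCodeᶠ (w ∷ []) ≡ x → fun validᶠ (w ∷ []) ≢ 0 → fun mismatchᶠ (w ∷ x ∷ []) ≡ 0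
  mismatch-complete {w} refl ok with fun andᶠ (eqᵇ c c ∷ fun validᶠ (w ∷ []) ∷ [])
                                   | and-intro (eqᵇ c c) _ (λ z → 0≢1+n (trans (sym z) (eqᵇ-refl c))) ok
    where c = fun axiomCodeᶠ (w ∷ [])
  ... | zero  | nz = contradiction refl nz
  ... | suc _ | _  = refl

  search-axiom : ∀ t m n x → cF (axiomOf t m n) ≡ x → valid t m n ≢ 0 →
                 ∃[ w ] mu (code mismatchᶠ) · (x ∷ []) ⇓ w × fun mismatchᶠ (w ∷ x ∷ []) ≡ 0
  search-axiom t m n x eq ok = search⇓ mismatchᶠ (x ∷ []) w (mismatch-complete {w} code-w valid-w)
    where
    w = ⟪ t , ⟪ m , n ⟫ ⟫
    code-w : fun axiomCodeᶠ (w ∷ []) ≡ x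
    code-w rewrite fst-pair t ⟪ m , n ⟫ | snd-pair t ⟪ m , n ⟫ | fst-pair m n | snd-pair m n = eq
    valid-w : fun validᶠ (w ∷ []) ≢ 0
    valid-w rewrite fst-pair t ⟪ m , n ⟫ | snd-pair t ⟪ m , n ⟫ | fst-pair m n | snd-pair m n = ok

  re-U : RE (Codes (U A B))
  re-U = enumerate , λ x → mk⇔ (complete x) (sound x)
    where
    sound : ∀ x → ∃[ y ] enumerate · (x ∷ []) ⇓ y → Codes (U A B) x
    sound x (y , ⇓comp {ys = w ∷ []} (d ∷ []) e) =
      let (eq , ok) = mismatch-sound {w} (search-found mismatchᶠ (x ∷ []) d) in
      axiomOf (fst w) (fst (snd w)) (snd (snd w)) , axiom-sound (fst w) _ _ ok (verify-sound {w} e) ,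
      trans (sym (cF≡⌜⌝ (axiomOf (fst w) _ _))) eq
    complete : ∀ x → Codes (U A B) x → ∃[ y ] enumerate · (x ∷ []) ⇓ y
    complete x (φ , u , φ≡x) =
      let (t , m , n , eq , ok) = axiom-complete u
          cφ≡x = trans (cF≡⌜⌝ φ) φ≡x
          (w , found , z) = search-axiom t m n x (trans (cong cF eq) cφ≡x) ok
          same-axiom = cF-injective φ (axiomOf (fst w) (fst (snd w)) (snd (snd w)))
                         (trans cφ≡x (sym (proj₁ (mismatch-sound {w} z))))
          (y , e) = verify-complete {w} (axiom-verified (fst w) _ _ (subst (U A B) same-axiom u))
      in y , ⇓comp (found ∷ []) e

-- Gödel's β function

module GödelBeta where

  open import Data.Nat.Coprimality using (Coprime; coprime-divisor; coprime-Bézout)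
  open import Data.Nat.Divisibility
  open import Data.Nat.GCD using (module Bézout)

  chinese : ∀ {M m} → Coprime M (suc m) → ∀ a r → r < suc m → ∃[ t ] (a + M * t) % suc m ≡ r
  chinese {M} {m} c a r r<m with coprime-Bézout c
  ... | Bézout.+- x y eq = x * (r + a * m) , (begin
    (a + M * (x * (r + a * m))) % suc m                   ≡⟨ cong (λ z → (a + z) % suc m) (assoc M x (r + a * m)) ⟩
    (a + x * M * (r + a * m)) % suc m                     ≡⟨ cong (λ z → (a + z * (r + a * m)) % suc m) (sym eq) ⟩
    (a + (1 + y * suc m) * (r + a * m)) % suc m           ≡⟨ cong (_% suc m) (regroup a r m y) ⟩
    (r + (a + y * (r + a * m)) * suc m) % suc m           ≡⟨ [m+kn]%n≡m%n r (a + y * (r + a * m)) (suc m) ⟩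
    r % suc m                                             ≡⟨ m<n⇒m%n≡m r<m ⟩
    r                                                     ∎)
    where
    open ≡-Reasoning
    assoc : ∀ M x z → M * (x * z) ≡ x * M * z
    assoc = solve-∀
    regroup : ∀ a r m y → a + (1 + y * suc m) * (r + a * m) ≡ r + (a + y * (r + a * m)) * suc m
    regroup = solve-∀
  ... | Bézout.-+ x y eq = x * (a + r * m) , (begin
    (a + M * (x * (a + r * m))) % suc m                   ≡⟨ [m+kn]%n≡m%n (a + M * (x * (a + r * m))) r (suc m) ⟨
    (a + M * (x * (a + r * m)) + r * suc m) % suc m       ≡⟨ cong (_% suc m) (regroup a r m M x) ⟩
    (r + (1 + x * M) * (a + r * m)) % suc m               ≡⟨ cong (λ z → (r + z * (a + r * m)) % suc m) eq ⟩
    (r + y * suc m * (a + r * m)) % suc m                 ≡⟨ cong (λ z → (r + z) % suc m) (exchange y (suc m) (a + r * m)) ⟩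
    (r + y * (a + r * m) * suc m) % suc m                 ≡⟨ [m+kn]%n≡m%n r (y * (a + r * m)) (suc m) ⟩
    r % suc m                                             ≡⟨ m<n⇒m%n≡m r<m ⟩
    r                                                     ∎)
    where
    open ≡-Reasoning
    regroup : ∀ a r m M x → a + M * (x * (a + r * m)) + r * suc m ≡ r + (1 + x * M) * (a + r * m)
    regroup = solve-∀
    exchange : ∀ y m z → y * m * z ≡ y * z * m
    exchange = solve-∀

  coprime-* : ∀ {m n k} → Coprime m k → Coprime n k → Coprime (m * n) k
  coprime-* {m} c d {p} (p∣mn , p∣k) = d (coprime-divisor {p} {m} (λ (q∣p , q∣m) → c (q∣m , ∣-trans q∣p p∣k)) p∣mn , p∣k)

  modulus : ℕ → ℕ → ℕ
  modulus b i = suc (suc i * b)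

  product : (ℕ → ℕ) → ℕ → ℕ
  product f zero    = 1
  product f (suc k) = product f k * f k

  ∣-product : ∀ f {i k} → i < k → f i ∣ product f k
  ∣-product f {i} {suc k} i<1+k with i ≟ k
  ... | yes refl = n∣m*n (product f k)
  ... | no i≢k   = ∣-trans (∣-product f (≤∧≢⇒< (s≤s⁻¹ i<1+k) i≢k)) (m∣m*n (f k))

  coprime-product : ∀ f k {m} → (∀ i → i < k → Coprime (f i) m) → Coprime (product f k) m
  coprime-product f zero    h (d∣1 , _) = ∣1⇒≡1 d∣1
  coprime-product f (suc k) h = coprime-* {m = product f k} (coprime-product f k λ i i<k → h i (m≤n⇒m≤1+n i<k)) (h k ≤-refl)

  β : ℕ → ℕ → ℕ → ℕ
  β a b i = a % modulus b i

  modulus-coprime : ∀ {b i j} → i < j → j ∸ i ∣ b → Coprime (modulus b i) (modulus b j)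
  modulus-coprime {b} {i} {j} i<j d∣b {p} (p∣i , p∣j) = coprime-b (∣-refl , p∣b)
    where
    coprime-b : Coprime p b
    coprime-b {q} (q∣p , q∣b) = ∣1⇒≡1 (∣m+n∣m⇒∣n (subst (q ∣_) (+-comm 1 (suc i * b)) (∣-trans q∣p p∣i)) (∣-trans q∣b (n∣m*n (suc i))))
    difference : modulus b j ≡ modulus b i + b * (j ∸ i)
    difference = begin
      suc (suc j * b)                    ≡⟨ cong (λ k → suc (suc k * b)) (m+[n∸m]≡n (<⇒≤ i<j)) ⟨
      suc (suc (i + (j ∸ i)) * b)        ≡⟨ distribute i (j ∸ i) b ⟩
      suc (suc i * b) + b * (j ∸ i)      ∎
      where
      open ≡-Reasoning
      distribute : ∀ i d b → suc (suc (i + d) * b) ≡ suc (suc i * b) + b * d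
      distribute = solve-∀
    p∣b : p ∣ b
    p∣b = ∣-trans (coprime-divisor {p} {b} coprime-b (∣m+n∣m⇒∣n (subst (p ∣_) difference p∣j) p∣i)) d∣b

  β-solve : ∀ b N (s : ℕ → ℕ) → (∀ i j → i < j → j < N → Coprime (modulus b i) (modulus b j)) →
            (∀ i → i < N → s i ≤ b) → ∀ k → k ≤ N → ∃[ a ] ∀ i → i < k → β a b i ≡ s i
  β-solve b N s coprime small zero    _   = 0 , λ _ ()
  β-solve b N s coprime small (suc k) k<N with β-solve b N s coprime small k (<⇒≤ k<N)
  ... | a , h with chinese (coprime-product (modulus b) k λ i i<k → coprime i k i<k k<N) a (s k)
                           (s≤s (≤-trans (small k k<N) (m≤m+n b (k * b))))
  ...   | t , at-k = a + M * t , solves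
    where
    M = product (modulus b) k
    solves : ∀ i → i < suc k → β (a + M * t) b i ≡ s i
    solves i i<1+k with i ≟ k
    ... | yes refl = at-k
    ... | no i≢k with ∣-product (modulus b) (≤∧≢⇒< (s≤s⁻¹ i<1+k) i≢k)
    ...   | divides q M≡ = trans (trans (cong (λ z → (a + z) % modulus b i) (trans (cong (_* t) M≡) (exchange q (modulus b i) t)))
                                        ([m+kn]%n≡m%n a (q * t) (modulus b i)))
                                 (h i (≤∧≢⇒< (s≤s⁻¹ i<1+k) i≢k))
      where
      exchange : ∀ y m z → y * m * z ≡ y * z * m
      exchange = solve-∀

  total : (ℕ → ℕ) → ℕ → ℕ
  total s zero    = 0
  total s (suc k) = total s k + s k

  ≤-total-sum : ∀ s {i k} → i < k → s i ≤ total s k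
  ≤-total-sum s {i} {suc k} i<1+k with i ≟ k
  ... | yes refl = m≤n+m (s i) (total s k)
  ... | no i≢k   = ≤-trans (≤-total-sum s (≤∧≢⇒< (s≤s⁻¹ i<1+k) i≢k)) (m≤m+n _ (s k))

  β-surjective : ∀ (s : ℕ → ℕ) N → ∃[ a ] ∃[ b ] ∀ i → i < N → β a b i ≡ s i
  β-surjective s N = proj₁ solution , b , proj₂ solution
    where
    b = N ! * suc (total s N)
    difference-∣ : ∀ i j → i < j → j < N → j ∸ i ∣ b
    difference-∣ i j i<j j<N with j ∸ i | m<n⇒0<n∸m i<j | ≤-trans (m∸n≤m j i) (<⇒≤ j<N)
    ... | suc d | _ | d<N = ∣-trans (∣-trans (m∣m*n (d !)) (m≤n⇒m!∣n! d<N)) (m∣m*n (suc (total s N)))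
    small : ∀ i → i < N → s i ≤ b
    small i i<N = ≤-trans (≤-total-sum s i<N) (≤-trans (n≤1+n _) (≤-trans (≤-reflexive (sym (*-identityˡ _))) (*-monoˡ-≤ (suc (total s N)) (1≤n! N))))
    solution = β-solve b N s (λ i j i<j j<N → modulus-coprime i<j (difference-∣ i j i<j j<N)) small N ≤-refl

open GödelBeta

-- Bounded formulas for partial recursive functions

infixl 7 _⊗ᵖ_
infixl 6 _⊕ᵖ_

data Poly (n : ℕ) : Set where
  varᵖ      : Fin n → Poly n
  conᵖ      : ℕ → Poly n
  _⊕ᵖ_ _⊗ᵖ_ : Poly n → Poly n → Poly n

evalP : Poly n → (Fin n → ℕ) → ℕ
evalP (varᵖ i) ρ = ρ i
evalP (conᵖ c) ρ = c
evalP (p ⊕ᵖ q) ρ = evalP p ρ + evalP q ρ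
evalP (p ⊗ᵖ q) ρ = evalP p ρ * evalP q ρ

infix  5 _≈ᵇ_
infixr 4 _∧ᵇ_
infixr 3 _∨ᵇ_

-- Positive bounded formulas. All existential quantifiers share one bound,
-- given from outside, and formulas are monotone in it.
data BF (n : ℕ) : Set where
  _≈ᵇ_      : Poly n → Poly n → BF n
  _∧ᵇ_ _∨ᵇ_ : BF n → BF n → BF n
  ∃ᵇ        : BF (suc n) → BF n
  ∀ᵇ        : Fin n → BF (suc n) → BF n

⟦_⟧ : BF n → ℕ → (Fin n → ℕ) → Set
⟦ p ≈ᵇ q ⟧ w ρ = evalP p ρ ≡ evalP q ρ
⟦ a ∧ᵇ b ⟧ w ρ = ⟦ a ⟧ w ρ × ⟦ b ⟧ w ρ
⟦ a ∨ᵇ b ⟧ w ρ = ⟦ a ⟧ w ρ ⊎ ⟦ b ⟧ w ρ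
⟦ ∃ᵇ a ⟧   w ρ = ∃[ i ] i ≤ w × ⟦ a ⟧ w (i ▸ ρ)
⟦ ∀ᵇ x a ⟧ w ρ = ∀ i → i ≤ ρ x → ⟦ a ⟧ w (i ▸ ρ)

⟦⟧-mono : ∀ (a : BF n) {w w′ ρ} → w ≤ w′ → ⟦ a ⟧ w ρ → ⟦ a ⟧ w′ ρ
⟦⟧-mono (p ≈ᵇ q) w≤ h             = h
⟦⟧-mono (a ∧ᵇ b) w≤ (h , h′)      = ⟦⟧-mono a w≤ h , ⟦⟧-mono b w≤ h′
⟦⟧-mono (a ∨ᵇ b) w≤ h             = Sum.map (⟦⟧-mono a w≤) (⟦⟧-mono b w≤) h
⟦⟧-mono (∃ᵇ a)   w≤ (i , i≤ , h)  = i , ≤-trans i≤ w≤ , ⟦⟧-mono a w≤ h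
⟦⟧-mono (∀ᵇ x a) w≤ h             = λ i i≤ → ⟦⟧-mono a w≤ (h i i≤)

record Sat (a : BF n) (ρ : Fin n → ℕ) : Set where
  constructor sat
  field
    bound : ℕ
    holds : ⟦ a ⟧ bound ρ

sat-≈ : ∀ {p q : Poly n} {ρ} → evalP p ρ ≡ evalP q ρ → Sat (p ≈ᵇ q) ρ
sat-≈ eq = sat 0 eq

sat-∧ : ∀ {a b : BF n} {ρ} → Sat a ρ → Sat b ρ → Sat (a ∧ᵇ b) ρ
sat-∧ {a = a} {b} (sat w h) (sat w′ h′) = sat (w ⊔ w′) (⟦⟧-mono a (m≤m⊔n w w′) h , ⟦⟧-mono b (m≤n⊔m w w′) h′)

sat-∨ : ∀ {a b : BF n} {ρ} → Sat a ρ ⊎ Sat b ρ → Sat (a ∨ᵇ b) ρ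
sat-∨ (inj₁ (sat w h)) = sat w (inj₁ h)
sat-∨ (inj₂ (sat w h)) = sat w (inj₂ h)

sat-∃ : ∀ {a : BF (suc n)} {ρ} i → Sat a (i ▸ ρ) → Sat (∃ᵇ a) ρ
sat-∃ {a = a} i (sat w h) = sat (i ⊔ w) (i , m≤m⊔n i w , ⟦⟧-mono a (m≤n⊔m i w) h)

sat-∀ : ∀ {x} {a : BF (suc n)} {ρ} → (∀ i → i ≤ ρ x → Sat a (i ▸ ρ)) → Sat (∀ᵇ x a) ρ
sat-∀ {x = x} {a} {ρ} h = let (w , s) = collect (ρ x) h in sat w s
  where
  collect : ∀ b → (∀ i → i ≤ b → Sat a (i ▸ ρ)) → ∃[ w ] ∀ i → i ≤ b → ⟦ a ⟧ w (i ▸ ρ)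
  collect zero h with h 0 z≤n
  ... | sat w s = w , λ { zero z≤n → s }
  collect (suc b) h with collect b (λ i i≤b → h i (m≤n⇒m≤1+n i≤b)) | h (suc b) ≤-refl
  ... | w , below | sat w′ at = w ⊔ w′ , combined
    where
    combined : ∀ i → i ≤ suc b → ⟦ a ⟧ (w ⊔ w′) (i ▸ ρ)
    combined i i≤ with i ≟ suc b
    ... | yes refl = ⟦⟧-mono a (m≤n⊔m w w′) at
    ... | no i≢    = ⟦⟧-mono a (m≤m⊔n w w′) (below i (s≤s⁻¹ (≤∧≢⇒< i≤ i≢)))

infixr 5 _⧺_

_⧺_ : Vec ℕ k → (Fin m → ℕ) → Fin (k + m) → ℕ
[]       ⧺ ρ = ρ
(v ∷ vs) ⧺ ρ = v ▸ (vs ⧺ ρ)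

⧺-↑ʳ : (vs : Vec ℕ k) {ρ : Fin m → ℕ} (i : Fin m) → (vs ⧺ ρ) (k ↑ʳ i) ≡ ρ i
⧺-↑ʳ []       i = refl
⧺-↑ʳ (v ∷ vs) i = ⧺-↑ʳ vs i

⧺-↑ˡ : (vs : Vec ℕ k) {ρ : Fin m → ℕ} (i : Fin k) → (vs ⧺ ρ) (i ↑ˡ m) ≡ lookup vs i
⧺-↑ˡ (v ∷ vs) zero    = refl
⧺-↑ˡ (v ∷ vs) (suc i) = ⧺-↑ˡ vs i

∃ᵇ* : ∀ k → BF (k + m) → BF m
∃ᵇ* zero    a = a
∃ᵇ* (suc k) a = ∃ᵇ* k (∃ᵇ a)

∃ᵇ*-elim : ∀ k (a : BF (k + m)) {w ρ} → ⟦ ∃ᵇ* k a ⟧ w ρ → ∃[ vs ] ⟦ a ⟧ w (vs ⧺ ρ)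
∃ᵇ*-elim zero    a h = [] , h
∃ᵇ*-elim (suc k) a h with ∃ᵇ*-elim k (∃ᵇ a) h
... | vs , v , _ , h′ = v ∷ vs , h′

sat-∃* : ∀ {k} {a : BF (k + m)} {ρ} (vs : Vec ℕ k) → Sat a (vs ⧺ ρ) → Sat (∃ᵇ* k a) ρ
sat-∃* []       s = s
sat-∃* (v ∷ vs) s = sat-∃* vs (sat-∃ v s)

module _ {m : ℕ} where
  up : Vec (Fin m) n → Vec (Fin (suc m)) n
  up = Vec.map suc

  map-▸ : ∀ {v : ℕ} {ρ : Fin m → ℕ} (xs : Vec (Fin m) n) → Vec.map (v ▸ ρ) (up xs) ≡ Vec.map ρ xs
  map-▸ xs = sym (map-∘ _ _ xs)

  map-⧺ : ∀ {vs : Vec ℕ k} {ρ : Fin m → ℕ} (xs : Vec (Fin m) n) → Vec.map (vs ⧺ ρ) (Vec.map (k ↑ʳ_) xs) ≡ Vec.map ρ xs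
  map-⧺ {vs = vs} xs = trans (sym (map-∘ _ _ xs)) (map-cong (⧺-↑ʳ vs) xs)

map-⧺-new : ∀ {vs : Vec ℕ k} {ρ : Fin m → ℕ} → Vec.map (vs ⧺ ρ) (Vec.tabulate (_↑ˡ m)) ≡ vs
map-⧺-new {vs = vs} = trans (sym (tabulate-∘ _ _)) (trans (tabulate-cong (⧺-↑ˡ vs)) (tabulate∘lookup vs))

-- The index i lives under the two quantifiers.
βᵇ : (a b : Fin m) → Poly (2 + m) → (u : Fin m) → BF m
βᵇ a b i u = ∃ᵇ (∃ᵇ
  ( varᵖ (2 ↑ʳ a) ≈ᵇ varᵖ (2 ↑ʳ u) ⊕ᵖ varᵖ (suc zero) ⊗ᵖ (conᵖ 1 ⊕ᵖ (conᵖ 1 ⊕ᵖ i) ⊗ᵖ varᵖ (2 ↑ʳ b))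
  ∧ᵇ varᵖ (2 ↑ʳ u) ⊕ᵖ varᵖ zero ≈ᵇ (conᵖ 1 ⊕ᵖ i) ⊗ᵖ varᵖ (2 ↑ʳ b)))

βᵇ-sound : ∀ {a b u : Fin m} {i w ρ} → ⟦ βᵇ a b i u ⟧ w ρ →
           ∃[ q ] ∃[ t ] β (ρ a) (ρ b) (evalP i (t ▸ q ▸ ρ)) ≡ ρ u
βᵇ-sound {a = a} {b} {u} {i} {w} {ρ} (q , _ , t , _ , eq , eq′) = q , t , (begin
  ρ a % modulus (ρ b) j                          ≡⟨ cong (_% modulus (ρ b) j) eq ⟩
  (ρ u + q * modulus (ρ b) j) % modulus (ρ b) j  ≡⟨ [m+kn]%n≡m%n (ρ u) q (modulus (ρ b) j) ⟩
  ρ u % modulus (ρ b) j                          ≡⟨ m<n⇒m%n≡m (s≤s (subst (ρ u ≤_) eq′ (m≤m+n (ρ u) t))) ⟩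
  ρ u                                            ∎)
  where
  open ≡-Reasoning
  j = evalP i (t ▸ q ▸ ρ)

βᵇ-complete : ∀ {a b u : Fin m} {i ρ} j → (∀ {q t} → evalP i (t ▸ q ▸ ρ) ≡ j) → β (ρ a) (ρ b) j ≡ ρ u → Sat (βᵇ a b i u) ρ
βᵇ-complete {a = a} {b} {u} {i} {ρ} j i≡j eq = sat-∃ q (sat-∃ t (sat-∧ (sat-≈ division) (sat-≈ remainder)))
  where
  q = ρ a / modulus (ρ b) j
  t = suc j * ρ b ∸ ρ u
  division : ρ a ≡ ρ u + q * suc (suc (evalP i (t ▸ q ▸ ρ)) * ρ b)
  division rewrite i≡j {q} {t} = trans (m≡m%n+[m/n]*n (ρ a) (modulus (ρ b) j)) (cong (_+ q * modulus (ρ b) j) eq)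
  remainder : ρ u + t ≡ suc (evalP i (t ▸ q ▸ ρ)) * ρ b
  remainder rewrite i≡j {q} {t} = m+[n∸m]≡n (s≤s⁻¹ (subst (_< modulus (ρ b) j) eq (m%n<n (ρ a) (modulus (ρ b) j))))

mutual
  rep : Rec n → Vec (Fin m) n → Fin m → BF m
  rep zeroᵣ xs y = varᵖ y ≈ᵇ conᵖ 0
  rep sucᵣ (x ∷ []) y = varᵖ y ≈ᵇ conᵖ 1 ⊕ᵖ varᵖ x
  rep (proj i) xs y = varᵖ y ≈ᵇ varᵖ (lookup xs i)
  rep {m = m} (comp {k} f gs) xs y =
    ∃ᵇ* k (reps gs (Vec.map (k ↑ʳ_) xs) (Vec.tabulate (_↑ˡ m)) ∧ᵇ rep f (Vec.tabulate (_↑ˡ m)) (k ↑ʳ y))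
  rep (prim f g) (x ∷ xs) y = ∃ᵇ (∃ᵇ
    ( ∃ᵇ (βᵇ (# 2) (# 1) (conᵖ 0) zero ∧ᵇ rep f (up (up (up xs))) zero)
    ∧ᵇ βᵇ (# 1) (# 0) (varᵖ (4 ↑ʳ x)) (2 ↑ʳ y)
    ∧ᵇ ∀ᵇ (2 ↑ʳ x) (primStep g x xs)))
  rep (mu f) xs y =
    ∃ᵇ (varᵖ zero ≈ᵇ conᵖ 0 ∧ᵇ rep f (suc y ∷ up xs) zero)
    ∧ᵇ ∀ᵇ y (muStep f xs y)

  primStep : Rec (2 + n) → Fin m → Vec (Fin m) n → BF (3 + m)
  primStep g x xs = varᵖ zero ≈ᵇ varᵖ (3 ↑ʳ x)
    ∨ᵇ ∃ᵇ (∃ᵇ ( βᵇ (# 4) (# 3) (varᵖ (# 4)) (# 1)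
              ∧ᵇ βᵇ (# 4) (# 3) (conᵖ 1 ⊕ᵖ varᵖ (# 4)) (# 0)
              ∧ᵇ rep g (# 2 ∷ # 1 ∷ up (up (up (up (up xs))))) zero))

  muStep : Rec (suc n) → Vec (Fin m) n → Fin m → BF (suc m)
  muStep f xs y = varᵖ zero ≈ᵇ varᵖ (suc y)
    ∨ᵇ ∃ᵇ (∃ᵇ (varᵖ zero ≈ᵇ conᵖ 1 ⊕ᵖ varᵖ (suc zero) ∧ᵇ rep f (# 2 ∷ up (up (up xs))) zero))

  reps : Vec (Rec n) k → Vec (Fin m) n → Vec (Fin m) k → BF m
  reps []       xs []       = conᵖ 0 ≈ᵇ conᵖ 0
  reps (g ∷ gs) xs (y ∷ ys) = rep g xs y ∧ᵇ reps gs xs ys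

mutual
  rep-sound : ∀ (c : Rec n) (xs : Vec (Fin m) n) y {w ρ} → ⟦ rep c xs y ⟧ w ρ → c · Vec.map ρ xs ⇓ ρ y
  rep-sound zeroᵣ xs y h rewrite h = ⇓zero
  rep-sound sucᵣ (x ∷ []) y h rewrite h = ⇓suc
  rep-sound (proj i) xs y {ρ = ρ} h = subst (proj i · Vec.map ρ xs ⇓_) (trans (lookup-map i ρ xs) (sym h)) (⇓proj i)
  rep-sound {m = m} (comp {k} f gs) xs y {w} {ρ} h with ∃ᵇ*-elim k _ h
  ... | vs , hs , hf = ⇓comp
    (subst₂ (gs ·_⇓*_) (map-⧺ {vs = vs} xs) (map-⧺-new {vs = vs}) (reps-sound gs _ _ hs))
    (subst₂ (f ·_⇓_) (map-⧺-new {vs = vs}) (⧺-↑ʳ vs y) (rep-sound f _ _ hf))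
  rep-sound (prim f g) (x ∷ xs) y {w} {ρ} (a , _ , b , _ , (u , _ , β₀ , hf) , βx , steps) =
    subst (prim f g · (ρ x ∷ Vec.map ρ xs) ⇓_) (proj₂ (proj₂ (βᵇ-sound {a = # 1} {# 0} {2 ↑ʳ y} {varᵖ (4 ↑ʳ x)} {w} {b ▸ a ▸ ρ} βx))) (values (ρ x) ≤-refl)
    where
    values : ∀ i → i ≤ ρ x → prim f g · (i ∷ Vec.map ρ xs) ⇓ β a b i
    values zero _ = ⇓prim0 (subst₂ (f ·_⇓_) (trans (map-▸ (up (up xs))) (trans (map-▸ (up xs)) (map-▸ xs)))
                             (sym (proj₂ (proj₂ (βᵇ-sound {a = # 2} {# 1} {# 0} {conᵖ 0} {w} {u ▸ b ▸ a ▸ ρ} β₀)))) (rep-sound f _ _ hf))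
    values (suc i) i<x with steps i (<⇒≤ i<x)
    ... | inj₁ eq = contradiction eq (<⇒≢ i<x)
    ... | inj₂ (u , _ , v , _ , βu , βv , hg) = ⇓primS (values i (<⇒≤ i<x))
      (subst₂ (g ·_⇓_)
        (cong₂ (λ u ys → i ∷ u ∷ ys) (sym (proj₂ (proj₂ (βᵇ-sound {a = # 4} {# 3} {# 1} {varᵖ (# 4)} {w} {v ▸ u ▸ i ▸ b ▸ a ▸ ρ} βu))))
          (trans (map-▸ (up (up (up (up xs))))) (trans (map-▸ (up (up (up xs)))) (trans (map-▸ (up (up xs))) (trans (map-▸ (up xs)) (map-▸ xs))))))
        (sym (proj₂ (proj₂ (βᵇ-sound {a = # 4} {# 3} {# 0} {conᵖ 1 ⊕ᵖ varᵖ (# 4)} {w} {v ▸ u ▸ i ▸ b ▸ a ▸ ρ} βv)))) (rep-sound g _ _ hg))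
  rep-sound (mu f) xs y {w} {ρ} ((z , _ , z≡0 , h) , below) = ⇓mu positive′
    (subst₂ (f ·_⇓_) (cong (ρ y ∷_) (map-▸ xs)) z≡0 (rep-sound f _ _ h))
    where
    positive′ : ∀ i → i < ρ y → ∃[ z ] f · (i ∷ Vec.map ρ xs) ⇓ suc z
    positive′ i i<y with below i (<⇒≤ i<y)
    ... | inj₁ eq = contradiction eq (<⇒≢ i<y)
    ... | inj₂ (z , _ , z′ , _ , z′≡ , h′) =
      z , subst₂ (f ·_⇓_) (cong (i ∷_) (trans (map-▸ (up (up xs))) (trans (map-▸ (up xs)) (map-▸ xs)))) z′≡ (rep-sound f _ _ h′)

  reps-sound : ∀ (cs : Vec (Rec n) k) (xs : Vec (Fin m) n) ys {w ρ} → ⟦ reps cs xs ys ⟧ w ρ → cs · Vec.map ρ xs ⇓* Vec.map ρ ys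
  reps-sound []       xs []       h        = []
  reps-sound (c ∷ cs) xs (y ∷ ys) (h , hs) = rep-sound c xs y h ∷ reps-sound cs xs ys hs

RepAt : Rec n → Vec ℕ n → ℕ → Set
RepAt {n} c args r = ∀ {m} (xs : Vec (Fin m) n) y {ρ} → Vec.map ρ xs ≡ args → ρ y ≡ r → Sat (rep c xs y) ρ

record Trace (Base : ℕ → Set) (Step : ℕ → ℕ → ℕ → Set) (x y : ℕ) : Set where
  field
    value : ℕ → ℕ
    base  : Base (value 0)
    next  : ∀ i → i < x → Step i (value i) (value (suc i))
    last  : value x ≡ y

extend : ∀ {Base Step x y z} → Trace Base Step x y → Step x y z → Trace Base Step (suc x) z
extend {Base} {Step} {x} {y} {z} t s =
  record { value = u ; base = subst Base (sym (u-old 0 z≤n)) (Trace.base t) ; next = step′ ; last = u-new }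
  where
  u : ℕ → ℕ
  u i with i ≤? x
  ... | yes _ = Trace.value t i
  ... | no  _ = z
  u-old : ∀ i → i ≤ x → u i ≡ Trace.value t i
  u-old i i≤x with i ≤? x
  ... | yes _   = refl
  ... | no i≰x  = contradiction i≤x i≰x
  u-new : u (suc x) ≡ z
  u-new with suc x ≤? x
  ... | yes 1+x≤x = contradiction 1+x≤x (<⇒≱ ≤-refl)
  ... | no _      = refl
  step′ : ∀ i → i < suc x → Step i (u i) (u (suc i))
  step′ i i<1+x with i ≟ x
  ... | yes refl = subst₂ (Step i) (trans (sym (Trace.last t)) (sym (u-old i ≤-refl))) (sym u-new) s
  ... | no i≢x   = subst₂ (Step i) (sym (u-old i (s≤s⁻¹ i<1+x))) (sym (u-old (suc i) (≤∧≢⇒< (s≤s⁻¹ i<1+x) i≢x)))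
                     (Trace.next t i (≤∧≢⇒< (s≤s⁻¹ i<1+x) i≢x))

rep-prim : ∀ {f : Rec n} {g xs x y} → Trace (RepAt f xs) (λ i u v → RepAt g (i ∷ u ∷ xs) v) x y →
           RepAt (prim f g) (x ∷ xs) y
rep-prim {g = g} t (x ∷ xs) y {ρ} refl refl with β-surjective (Trace.value t) (suc (ρ x))
... | a , b , β≡ = sat-∃ a (sat-∃ b (sat-∧
      (sat-∃ (Trace.value t 0) (sat-∧ (βᵇ-complete {a = # 2} {# 1} {# 0} 0 refl (β≡ 0 (s≤s z≤n)))
        (Trace.base t (up (up (up xs))) zero (trans (map-▸ (up (up xs))) (trans (map-▸ (up xs)) (map-▸ xs))) refl)))
      (sat-∧ (βᵇ-complete {a = # 1} {# 0} {2 ↑ʳ y} (ρ x) refl (trans (β≡ (ρ x) ≤-refl) (Trace.last t)))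
        (sat-∀ steps))))
  where
  steps : ∀ i → i ≤ ρ x → Sat (primStep g x xs) (i ▸ b ▸ a ▸ ρ)
  steps i i≤x with i ≟ ρ x
  ... | yes i≡x = sat 0 (inj₁ i≡x)
  ... | no i≢x = sat-∨ (inj₂ (sat-∃ (Trace.value t i) (sat-∃ (Trace.value t (suc i)) (sat-∧
          (βᵇ-complete {a = # 4} {# 3} {# 1} i refl (β≡ i (s≤s i≤x)))
          (sat-∧ (βᵇ-complete {a = # 4} {# 3} {# 0} (suc i) refl (β≡ (suc i) (s≤s i<x)))
            (Trace.next t i i<x (# 2 ∷ # 1 ∷ up (up (up (up (up xs))))) zero
              (cong (λ ys → i ∷ Trace.value t i ∷ ys) (trans (map-▸ (up (up (up (up xs))))) (trans (map-▸ (up (up (up xs)))) (trans (map-▸ (up (up xs))) (trans (map-▸ (up xs)) (map-▸ xs))))))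
              refl))))))
    where i<x = ≤∧≢⇒< i≤x i≢x

mutual
  rep-complete : ∀ {c : Rec n} {args r} → c · args ⇓ r → RepAt c args r
  rep-complete ⇓zero xs y refl eq = sat 0 eq
  rep-complete ⇓suc (x ∷ []) y refl eq = sat 0 eq
  rep-complete (⇓proj i) xs y {ρ} refl eq = sat 0 $ trans eq (lookup-map i ρ xs)
  rep-complete (⇓comp {ys = vs} gs f) xs y refl refl = sat-∃* vs
    (sat-∧ (reps-complete gs _ _ (map-⧺ {vs = vs} xs) (map-⧺-new {vs = vs})) (rep-complete f _ _ (map-⧺-new {vs = vs}) (⧺-↑ʳ vs y)))
  rep-complete d@(⇓prim0 _)   = rep-prim (trace d)
  rep-complete d@(⇓primS _ _) = rep-prim (trace d)
  rep-complete (⇓mu {f = f} below at) xs y {ρ} refl refl = sat-∧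
    (sat-∃ 0 (sat-∧ (sat-≈ refl) (rep-complete at (suc y ∷ up xs) zero (cong (ρ y ∷_) (map-▸ xs)) refl)))
    (sat-∀ steps)
    where
    steps : ∀ i → i ≤ ρ y → Sat (muStep f xs y) (i ▸ ρ)
    steps i i≤y with i ≟ ρ y
    ... | yes i≡y = sat 0 (inj₁ i≡y)
    ... | no i≢y with below i (≤∧≢⇒< i≤y i≢y)
    ...   | z , d = sat-∨ (inj₂ (sat-∃ z (sat-∃ (suc z) (sat-∧ (sat-≈ refl)
              (rep-complete d (# 2 ∷ up (up (up xs))) zero
                (cong (i ∷_) (trans (map-▸ (up (up xs))) (trans (map-▸ (up xs)) (map-▸ xs)))) refl)))))

  reps-complete : ∀ {cs : Vec (Rec n) k} {args rs} → cs · args ⇓* rs →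
                  ∀ (xs : Vec (Fin m) n) ys {ρ} → Vec.map ρ xs ≡ args → Vec.map ρ ys ≡ rs → Sat (reps cs xs ys) ρ
  reps-complete []       xs []       eq eq′ = sat 0 refl
  reps-complete (d ∷ ds) xs (y ∷ ys) eq refl = sat-∧ (rep-complete d xs y eq refl) (reps-complete ds xs ys eq refl)

  trace : ∀ {f : Rec n} {g x xs y} → prim f g · (x ∷ xs) ⇓ y → Trace (RepAt f xs) (λ i u v → RepAt g (i ∷ u ∷ xs) v) x y
  trace {y = y} (⇓prim0 d) = record { value = λ _ → y ; base = rep-complete d ; next = λ _ () ; last = refl }
  trace (⇓primS d e) = extend (trace d) (rep-complete e)

-- Natural deduction

mutual
  subT-subT : {σ : Fin k → Term L m} {θ : Fin m → Term L n} {σ′ : Fin k → Term L n} →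
              (∀ x → subT θ (σ x) ≡ σ′ x) → ∀ t → subT θ (subT σ t) ≡ subT σ′ t
  subT-subT h (var x)   = h x
  subT-subT h (fn f ts) = cong (fn f) (subTs-subTs h ts)

  subTs-subTs : ∀ {j} {σ : Fin k → Term L m} {θ : Fin m → Term L n} {σ′ : Fin k → Term L n} →
                (∀ x → subT θ (σ x) ≡ σ′ x) → ∀ (ts : Vec (Term L k) j) → subTs θ (subTs σ ts) ≡ subTs σ′ ts
  subTs-subTs h []       = refl
  subTs-subTs h (t ∷ ts) = cong₂ _∷_ (subT-subT h t) (subTs-subTs h ts)

lift : (Fin m → Term L n) → Fin (suc m) → Term L (suc n)
lift σ = var zero ▸ (renT suc ∘ σ)

subT-renT : {θ : Fin m → Term L n} {ρ : Fin k → Fin m} {σ : Fin k → Term L n} → (∀ x → θ (ρ x) ≡ σ x) →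
            ∀ t → subT θ (renT ρ t) ≡ subT σ t
subT-renT {ρ = ρ} h t = trans (cong (subT _) (renT≡subT ρ t)) (subT-subT h t)

subT-lift : (θ : Fin m → Term L n) (t : Term L m) → subT (lift θ) (renT suc t) ≡ renT suc (subT θ t)
subT-lift θ t = trans (subT-renT (λ _ → refl) t)
  (sym (trans (renT≡subT suc (subT θ t)) (subT-subT (λ x → sym (renT≡subT suc (θ x))) t)))

subT-inst : (u : Term L n) (t : Term L n) → subT (u ▸ var) (renT suc t) ≡ t
subT-inst u t = trans (subT-renT {σ = var} (λ _ → refl) t) (subT-id (λ _ → refl) t)

module _ {T : Theory L} where

  weaken : {Γ Δ : List (Formula L n)} {φ : Formula L n} → (∀ {ψ} → ψ ∈ Γ → ψ ∈ Δ) → T ∣ Γ ⊢ φ → T ∣ Δ ⊢ φ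
  weaken Γ⊆Δ (axiom a)     = axiom a
  weaken Γ⊆Δ (hyp φ∈)      = hyp (Γ⊆Δ φ∈)
  weaken Γ⊆Δ (⇒I d)        = ⇒I (weaken (λ { (here eq) → here eq ; (there ψ∈) → there (Γ⊆Δ ψ∈) }) d)
  weaken Γ⊆Δ (⇒E d e)      = ⇒E (weaken Γ⊆Δ d) (weaken Γ⊆Δ e)
  weaken Γ⊆Δ (raa d)       = raa (weaken (λ { (here eq) → here eq ; (there ψ∈) → there (Γ⊆Δ ψ∈) }) d)
  weaken {Γ = Γ} {Δ} Γ⊆Δ (∀I d) = ∀I (weaken map-⊆ d)
    where
    map-⊆ : ∀ {ψ} → ψ ∈ List.map shift Γ → ψ ∈ List.map shift Δ
    map-⊆ ψ∈ with ∈-map⁻ shift ψ∈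
    ... | χ , χ∈ , refl = ∈-map⁺ shift (Γ⊆Δ χ∈)
  weaken Γ⊆Δ (∀E t d)      = ∀E t (weaken Γ⊆Δ d)
  weaken Γ⊆Δ (≐refl t)     = ≐refl t
  weaken Γ⊆Δ (≐subst φ d e) = ≐subst φ (weaken Γ⊆Δ d) (weaken Γ⊆Δ e)
  weaken Γ⊆Δ nonempty      = nonempty

  private variable
    Γ : List (Formula L n)
    φ ψ χ : Formula L n

  cast : φ ≡ ψ → T ∣ Γ ⊢ φ → T ∣ Γ ⊢ ψ
  cast refl d = d

  wk : T ∣ Γ ⊢ φ → T ∣ ψ ∷ Γ ⊢ φ
  wk = weaken there

  hyp₀ : T ∣ φ ∷ Γ ⊢ φ
  hyp₀ = hyp (here refl)

  hyp₁ : T ∣ ψ ∷ φ ∷ Γ ⊢ φ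
  hyp₁ = hyp (there (here refl))

  ⊥E : T ∣ Γ ⊢ ⊥' → T ∣ Γ ⊢ φ
  ⊥E d = raa (wk d)

  ⊤I : T ∣ Γ ⊢ ⊤'
  ⊤I = ⇒I hyp₀

  ∧I : T ∣ Γ ⊢ φ → T ∣ Γ ⊢ ψ → T ∣ Γ ⊢ φ ∧' ψ
  ∧I d e = ⇒I (⇒E (⇒E hyp₀ (wk d)) (wk e))

  ∧E₁ : T ∣ Γ ⊢ φ ∧' ψ → T ∣ Γ ⊢ φ
  ∧E₁ d = raa (⇒E (wk d) (⇒I (⊥E (⇒E hyp₁ hyp₀))))

  ∧E₂ : T ∣ Γ ⊢ φ ∧' ψ → T ∣ Γ ⊢ ψ
  ∧E₂ d = raa (⇒E (wk d) (⇒I hyp₁))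

  ∨I₁ : T ∣ Γ ⊢ φ → T ∣ Γ ⊢ φ ∨' ψ
  ∨I₁ d = ⇒I (⊥E (⇒E hyp₀ (wk d)))

  ∨I₂ : T ∣ Γ ⊢ ψ → T ∣ Γ ⊢ φ ∨' ψ
  ∨I₂ d = ⇒I (wk d)

  ∨E : T ∣ Γ ⊢ φ ∨' ψ → T ∣ φ ∷ Γ ⊢ χ → T ∣ ψ ∷ Γ ⊢ χ → T ∣ Γ ⊢ χ
  ∨E d e f = raa (⇒E hyp₀ (⇒E (wk (⇒I f)) (⇒E (wk d) (⇒I (⇒E hyp₁ (⇒E (wk (wk (⇒I e))) hyp₀))))))

  ∃I : (φ : Formula L (suc n)) (t : Term L n) → T ∣ Γ ⊢ inst φ t → T ∣ Γ ⊢ ∃' φ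
  ∃I φ t d = ⇒I (⇒E (∀E t hyp₀) (wk d))

  ∃E : {φ : Formula L (suc n)} {χ : Formula L n} → T ∣ Γ ⊢ ∃' φ → T ∣ φ ∷ List.map shift Γ ⊢ shift χ → T ∣ Γ ⊢ χ
  ∃E d e = raa (⇒E (wk d) (∀I (⇒I (⇒E hyp₁ (weaken (λ { (here eq) → here eq ; (there ψ∈) → there (there ψ∈) }) e)))))

  ≐sym : {t u : Term L n} → T ∣ Γ ⊢ t ≐ u → T ∣ Γ ⊢ u ≐ t
  ≐sym {Γ = Γ} {t = t} {u} d = subst (λ v → T ∣ Γ ⊢ u ≐ v) (subT-inst u t)
    (≐subst (var zero ≐ renT suc t) d (subst (λ v → T ∣ Γ ⊢ t ≐ v) (sym (subT-inst t t)) (≐refl t)))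

  ≐trans : {t u v : Term L n} → T ∣ Γ ⊢ t ≐ u → T ∣ Γ ⊢ u ≐ v → T ∣ Γ ⊢ t ≐ v
  ≐trans {Γ = Γ} {t = t} {u} {v} d e = subst (λ s → T ∣ Γ ⊢ s ≐ v) (subT-inst v t)
    (≐subst (renT suc t ≐ var zero) e (subst (λ s → T ∣ Γ ⊢ s ≐ u) (sym (subT-inst u t)) d))

  ≐cong₁ : {f : Language.Fun L 1} {t u : Term L n} → T ∣ Γ ⊢ t ≐ u → T ∣ Γ ⊢ fn f (t ∷ []) ≐ fn f (u ∷ [])
  ≐cong₁ {Γ = Γ} {f = f} {t} {u} d = subst (λ s → T ∣ Γ ⊢ fn f (s ∷ []) ≐ fn f (u ∷ [])) (subT-inst u t)
    (≐subst (fn f (renT suc t ∷ []) ≐ fn f (var zero ∷ [])) d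
      (subst (λ s → T ∣ Γ ⊢ fn f (s ∷ []) ≐ fn f (t ∷ [])) (sym (subT-inst t t)) (≐refl _)))

  ≐cong₂ : {f : Language.Fun L 2} {t t′ u u′ : Term L n} → T ∣ Γ ⊢ t ≐ t′ → T ∣ Γ ⊢ u ≐ u′ →
           T ∣ Γ ⊢ fn f (t ∷ u ∷ []) ≐ fn f (t′ ∷ u′ ∷ [])
  ≐cong₂ {Γ = Γ} {f = f} {t} {t′} {u} {u′} d e = ≐trans left right
    where
    left : T ∣ Γ ⊢ fn f (t ∷ u ∷ []) ≐ fn f (t′ ∷ u ∷ [])
    left = subst (λ (s , v , v′) → T ∣ Γ ⊢ fn f (s ∷ v ∷ []) ≐ fn f (t′ ∷ v′ ∷ []))
                 (cong₂ _,_ (subT-inst t′ t) (cong₂ _,_ (subT-inst t′ u) (subT-inst t′ u)))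
      (≐subst (fn f (renT suc t ∷ renT suc u ∷ []) ≐ fn f (var zero ∷ renT suc u ∷ [])) d
        (subst (λ (s , v , v′) → T ∣ Γ ⊢ fn f (s ∷ v ∷ []) ≐ fn f (t ∷ v′ ∷ []))
               (sym (cong₂ _,_ (subT-inst t t) (cong₂ _,_ (subT-inst t u) (subT-inst t u)))) (≐refl _)))
    right : T ∣ Γ ⊢ fn f (t′ ∷ u ∷ []) ≐ fn f (t′ ∷ u′ ∷ [])
    right = subst (λ (s , v , s′) → T ∣ Γ ⊢ fn f (s ∷ v ∷ []) ≐ fn f (s′ ∷ u′ ∷ []))
                 (cong₂ _,_ (subT-inst u′ t′) (cong₂ _,_ (subT-inst u′ u) (subT-inst u′ t′)))
      (≐subst (fn f (renT suc t′ ∷ renT suc u ∷ []) ≐ fn f (renT suc t′ ∷ var zero ∷ [])) e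
        (subst (λ (s , v , s′) → T ∣ Γ ⊢ fn f (s ∷ v ∷ []) ≐ fn f (s′ ∷ u ∷ []))
               (sym (cong₂ _,_ (subT-inst u t′) (cong₂ _,_ (subT-inst u u) (subT-inst u t′)))) (≐refl _)))

-- Deductions in R

subT-numR : (σ : Fin m → Term LR n) → ∀ k → subT σ (numR k) ≡ numR k
subT-numR σ zero    = refl
subT-numR σ (suc k) = cong (λ t → fn 𝐒 (t ∷ [])) (subT-numR σ k)

renT-numR : (ρ : Fin m → Fin n) → ∀ k → renT ρ (numR k) ≡ numR k
renT-numR ρ k = trans (renT≡subT ρ (numR k)) (subT-numR _ k)

sub-oneOf : (σ : Fin m → Term LR n) → ∀ k t → sub σ (oneOf k t) ≡ oneOf k (subT σ t)
sub-oneOf σ zero    t = refl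
sub-oneOf σ (suc k) t = cong₂ (λ φ u → φ ∨' subT σ t ≐ u) (sub-oneOf σ k t) (subT-numR σ (suc k))

private variable
  Γ : List (Formula LR n)
  ψ : Formula LR n

R-add : ∀ a b → 𝐑 ∣ Γ ⊢ fn ⊕ (numR a ∷ numR b ∷ []) ≐ numR (a + b)
R-add {Γ = Γ} a b = cast
  (cong₂ _≐_ (cong₂ (λ t u → fn ⊕ (t ∷ u ∷ [])) (subT-numR ε a) (subT-numR ε b)) (subT-numR ε (a + b))) (axiom (add a b))

R-mul : ∀ a b → 𝐑 ∣ Γ ⊢ fn ⊗ (numR a ∷ numR b ∷ []) ≐ numR (a * b)
R-mul {Γ = Γ} a b = cast
  (cong₂ _≐_ (cong₂ (λ t u → fn ⊗ (t ∷ u ∷ [])) (subT-numR ε a) (subT-numR ε b)) (subT-numR ε (a * b))) (axiom (mul a b))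

R-distinct : ∀ {a b} → a ≢ b → 𝐑 ∣ Γ ⊢ ¬' (numR a ≐ numR b)
R-distinct {Γ = Γ} {a} {b} a≢b = cast (cong₂ (λ t u → ¬' (t ≐ u)) (subT-numR ε a) (subT-numR ε b)) (axiom (distinct a≢b))

R-bounded : ∀ b (t : Term LR n) → 𝐑 ∣ Γ ⊢ t ≤' numR b ⇒ oneOf b t
R-bounded {Γ = Γ} b t = cast
  (cong₂ (λ u φ → t ≤' u ⇒ φ)
    (trans (cong (subT (t ▸ var)) (subT-numR _ b)) (subT-numR _ b))
    (trans (cong (sub (t ▸ var)) (sub-oneOf _ b (var zero))) (sub-oneOf _ b (var zero))))
  (∀E t (axiom (bounded b)))

R-compare : ∀ b (t : Term LR n) → 𝐑 ∣ Γ ⊢ t ≤' numR b ∨' numR b ≤' t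
R-compare {Γ = Γ} b t = cast
  (cong (λ u → t ≤' u ∨' u ≤' t) (trans (cong (subT (t ▸ var)) (subT-numR _ b)) (subT-numR _ b)))
  (∀E t (axiom (compare b)))

oneOf-elim : ∀ b {t : Term LR n} → (∀ k → k ≤ b → 𝐑 ∣ Γ ⊢ t ≐ numR k ⇒ ψ) → 𝐑 ∣ Γ ⊢ oneOf b t ⇒ ψ
oneOf-elim zero    h = h 0 z≤n
oneOf-elim (suc b) h = ⇒I (∨E hyp₀ (⇒E (wk (wk (oneOf-elim b λ k k≤b → h k (m≤n⇒m≤1+n k≤b)))) hyp₀)
                                   (⇒E (wk (wk (h (suc b) ≤-refl))) hyp₀))

≤-elim : ∀ b {t : Term LR n} → (∀ k → k ≤ b → 𝐑 ∣ Γ ⊢ t ≐ numR k ⇒ ψ) → 𝐑 ∣ Γ ⊢ t ≤' numR b → 𝐑 ∣ Γ ⊢ ψ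
≤-elim b {t} h d = ⇒E (oneOf-elim b h) (⇒E (R-bounded b t) d)

R-≤ : ∀ {a b} → a ≤ b → 𝐑 ∣ Γ ⊢ numR a ≤' numR b
R-≤ {Γ = Γ} {a} {b} a≤b = ∨E (R-compare b (numR a)) hyp₀ (≤-elim a each hyp₀)
  where
  each : ∀ k → k ≤ a → 𝐑 ∣ numR b ≤' numR a ∷ Γ ⊢ numR b ≐ numR k ⇒ numR a ≤' numR b
  each k k≤a with b ≟ k
  ... | no b≢k = ⇒I (⊥E (⇒E (R-distinct b≢k) hyp₀))
  ... | yes refl with ≤-antisym a≤b k≤a
  ...   | refl = ⇒I hyp₁

record Family : Set where
  field
    at      : Term LR n → Formula LR n
    natural : (σ : Fin m → Term LR n) (t : Term LR m) → sub σ (at t) ≡ at (subT σ t)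

open Family

replace : (F : Family) {t u : Term LR n} → 𝐑 ∣ Γ ⊢ t ≐ u → 𝐑 ∣ Γ ⊢ at F t → 𝐑 ∣ Γ ⊢ at F u
replace {Γ = Γ} F d e = cast (natural F _ (var zero))
  (≐subst (at F (var zero)) d (cast (sym (natural F _ (var zero))) e))

polyT : (Fin n → Term LR m) → Poly n → Term LR m
polyT σ (varᵖ x) = σ x
polyT σ (conᵖ c) = numR c
polyT σ (p ⊕ᵖ q) = fn ⊕ (polyT σ p ∷ polyT σ q ∷ [])
polyT σ (p ⊗ᵖ q) = fn ⊗ (polyT σ p ∷ polyT σ q ∷ [])

polyT-sub : {σ : Fin k → Term LR m} {θ : Fin m → Term LR n} {σ′ : Fin k → Term LR n} →
            (∀ x → subT θ (σ x) ≡ σ′ x) → ∀ p → subT θ (polyT σ p) ≡ polyT σ′ p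
polyT-sub h (varᵖ x) = h x
polyT-sub h (conᵖ c) = subT-numR _ c
polyT-sub h (p ⊕ᵖ q) = cong₂ (λ t u → fn ⊕ (t ∷ u ∷ [])) (polyT-sub h p) (polyT-sub h q)
polyT-sub h (p ⊗ᵖ q) = cong₂ (λ t u → fn ⊗ (t ∷ u ∷ [])) (polyT-sub h p) (polyT-sub h q)

R-poly : ∀ (ρ : Fin n → ℕ) p → 𝐑 ∣ Γ ⊢ polyT (numR ∘ ρ) p ≐ numR (evalP p ρ)
R-poly ρ (varᵖ x) = ≐refl _
R-poly ρ (conᵖ c) = ≐refl _
R-poly ρ (p ⊕ᵖ q) = ≐trans (≐cong₂ (R-poly ρ p) (R-poly ρ q)) (R-add _ _)
R-poly ρ (p ⊗ᵖ q) = ≐trans (≐cong₂ (R-poly ρ p) (R-poly ρ q)) (R-mul _ _)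

real : BF n → (Fin n → Term LR m) → Term LR m → Formula LR m
real (p ≈ᵇ q) σ w = polyT σ p ≐ polyT σ q
real (a ∧ᵇ b) σ w = real a σ w ∧' real b σ w
real (a ∨ᵇ b) σ w = real a σ w ∨' real b σ w
real (∃ᵇ a)   σ w = ∃' (var zero ≤' renT suc w ∧' real a (lift σ) (renT suc w))
real (∀ᵇ x a) σ w = ∀' (var zero ≤' renT suc (σ x) ⇒ real a (lift σ) (renT suc w))

lift-cong : {σ : Fin k → Term LR m} {θ : Fin m → Term LR n} {σ′ : Fin k → Term LR n} →
            (∀ x → subT θ (σ x) ≡ σ′ x) → ∀ x → subT (lift θ) (lift σ x) ≡ lift σ′ x
lift-cong h zero = refl
lift-cong {σ = σ} {θ} h (suc x) = trans (subT-lift θ (σ x)) (cong (renT suc) (h x))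

real-sub : ∀ (a : BF k) {σ : Fin k → Term LR m} {θ : Fin m → Term LR n} {σ′ : Fin k → Term LR n} {w w′} →
           (∀ x → subT θ (σ x) ≡ σ′ x) → subT θ w ≡ w′ → sub θ (real a σ w) ≡ real a σ′ w′
real-sub (p ≈ᵇ q) h e = cong₂ _≐_ (polyT-sub h p) (polyT-sub h q)
real-sub (a ∧ᵇ b) h e = cong₂ _∧'_ (real-sub a h e) (real-sub b h e)
real-sub (a ∨ᵇ b) h e = cong₂ _∨'_ (real-sub a h e) (real-sub b h e)
real-sub (∃ᵇ a) {θ = θ} {w = w} h e = cong₂ (λ t φ → ∃' (var zero ≤' t ∧' φ)) e′ (real-sub a (lift-cong h) e′)
  where e′ = trans (subT-lift θ w) (cong (renT suc) e)
real-sub (∀ᵇ x a) {σ} {θ = θ} {w = w} h e =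
  cong₂ (λ t φ → ∀' (var zero ≤' t ⇒ φ)) (lift-cong {σ = σ} {θ} h (suc x)) (real-sub a (lift-cong h) (trans (subT-lift θ w) (cong (renT suc) e)))

real-cong : ∀ (a : BF k) {σ σ′ : Fin k → Term LR m} {w w′} → σ ≗ σ′ → w ≡ w′ → real a σ w ≡ real a σ′ w′
real-cong a {σ} {w = w} h e = trans (sym (sub-id (λ _ → refl) (real a σ w)))
  (real-sub a (λ x → trans (subT-id (λ _ → refl) (σ x)) (h x)) (trans (subT-id (λ _ → refl) w) e))

decide : ∀ (a : BF n) w ρ → Dec (⟦ a ⟧ w ρ)
decide (p ≈ᵇ q) w ρ = evalP p ρ ≟ evalP q ρ
decide (a ∧ᵇ b) w ρ = decide a w ρ ×-dec decide b w ρ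
decide (a ∨ᵇ b) w ρ = decide a w ρ ⊎-dec decide b w ρ
decide (∃ᵇ a)   w ρ = map′ (λ { (i , s≤s i≤w , h) → i , i≤w , h }) (λ { (i , i≤w , h) → i , s≤s i≤w , h })
                        (anyUpTo? (λ i → decide a w (i ▸ ρ)) (suc w))
decide (∀ᵇ x a) w ρ = map′ (λ h i i≤ → h (s≤s i≤)) (λ { h {i} (s≤s i≤) → h i i≤ })
                        (allUpTo? (λ i → decide a w (i ▸ ρ)) (suc (ρ x)))

counterexample : ∀ {P : ℕ → Set} → (∀ i → Dec (P i)) → ∀ b → ¬ (∀ i → i ≤ b → P i) → ∃[ i ] i ≤ b × ¬ P i
counterexample P? b ¬all with anyUpTo? (λ i → ¬? (P? i)) (suc b)
... | yes (i , s≤s i≤b , ¬p) = i , i≤b , ¬p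
... | no none = contradiction (λ i i≤b → decidable-stable (P? i) λ ¬p → none (i , s≤s i≤b , ¬p)) ¬all

instance-at : BF (suc n) → ℕ → (Fin n → ℕ) → Family
instance-at a w ρ = record
  { at      = λ t → real a (t ▸ (numR ∘ ρ)) (numR w)
  ; natural = λ σ t → real-sub a (λ { zero → refl ; (suc x) → subT-numR σ (ρ x) }) (subT-numR σ w)
  }

module _ (a : BF (suc n)) (w : ℕ) (ρ : Fin n → ℕ) where

  private F = instance-at a w ρ

  instance-num : ∀ i → at F {m} (numR i) ≡ real a (numR ∘ (i ▸ ρ)) (numR w)
  instance-num i = real-cong a (λ { zero → refl ; (suc x) → refl }) refl

  instance-var : real a (lift (numR {m} ∘ ρ)) (renT suc (numR w)) ≡ at F (var zero)
  instance-var = real-cong a (λ { zero → refl ; (suc x) → renT-numR suc (ρ x) }) (renT-numR suc w)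

  real-∃ : real {m = m} (∃ᵇ a) (numR ∘ ρ) (numR w) ≡ ∃' (var zero ≤' numR w ∧' at F (var zero))
  real-∃ = cong₂ (λ t φ → ∃' (var zero ≤' t ∧' φ)) (renT-numR suc w) instance-var

  real-∀ : ∀ x → real {m = m} (∀ᵇ x a) (numR ∘ ρ) (numR w) ≡ ∀' (var zero ≤' numR (ρ x) ⇒ at F (var zero))
  real-∀ x = cong₂ (λ t φ → ∀' (var zero ≤' t ⇒ φ)) (renT-numR suc (ρ x)) instance-var

  ≤-inst : ∀ b t → inst {n = m} (var zero ≤' numR b) t ≡ t ≤' numR b
  ≤-inst b t = cong (t ≤'_) (subT-numR _ b)

mutual
  prove : ∀ (a : BF n) {w ρ} → ⟦ a ⟧ w ρ → 𝐑 ∣ Γ ⊢ real a (numR ∘ ρ) (numR w)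
  prove {Γ = Γ} (p ≈ᵇ q) {ρ = ρ} h =
    ≐trans (R-poly ρ p) (subst (λ c → 𝐑 ∣ Γ ⊢ numR c ≐ _) (sym h) (≐sym (R-poly ρ q)))
  prove (a ∧ᵇ b) (h , h′) = ∧I (prove a h) (prove b h′)
  prove (a ∨ᵇ b) (inj₁ h) = ∨I₁ (prove a h)
  prove (a ∨ᵇ b) (inj₂ h) = ∨I₂ (prove b h)
  prove {Γ = Γ} (∃ᵇ a) {w} {ρ} (i , i≤w , h) = cast (sym (real-∃ a w ρ)) (∃I _ (numR i)
    (∧I (cast (sym (≤-inst a w ρ w (numR i))) (R-≤ i≤w))
        (cast (sym (trans (natural (instance-at a w ρ) _ (var zero)) (instance-num a w ρ i))) (prove a h))))
  prove {Γ = Γ} (∀ᵇ x a) {w} {ρ} h = cast (sym (real-∀ a w ρ x)) (∀I (⇒I (≤-elim (ρ x) each hyp₀)))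
    where
    each : ∀ k → k ≤ ρ x → 𝐑 ∣ _ ⊢ var zero ≐ numR k ⇒ at (instance-at a w ρ) (var zero)
    each k k≤ = ⇒I (replace (instance-at a w ρ) (≐sym hyp₀) (cast (sym (instance-num a w ρ k)) (prove a (h k k≤))))

  refute : ∀ (a : BF n) {w ρ} → ¬ ⟦ a ⟧ w ρ → 𝐑 ∣ Γ ⊢ ¬' real a (numR ∘ ρ) (numR w)
  refute (p ≈ᵇ q) {ρ = ρ} ¬h = ⇒I (⇒E (R-distinct ¬h) (≐trans (≐sym (R-poly ρ p)) (≐trans hyp₀ (R-poly ρ q))))
  refute (a ∧ᵇ b) {w} {ρ} ¬h with decide a w ρ
  ... | no ¬a = ⇒I (⇒E (refute a ¬a) (∧E₁ hyp₀))
  ... | yes h = ⇒I (⇒E (refute b λ h′ → ¬h (h , h′)) (∧E₂ hyp₀))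
  refute (a ∨ᵇ b) ¬h = ⇒I (∨E hyp₀ (⇒E (refute a (¬h ∘ inj₁)) hyp₀) (⇒E (refute b (¬h ∘ inj₂)) hyp₀))
  refute {Γ = Γ} (∃ᵇ a) {w} {ρ} ¬h = cast (cong ¬'_ (sym (real-∃ a w ρ)))
    (⇒I (∃E hyp₀ (≤-elim w each (∧E₁ hyp₀))))
    where
    F = instance-at a w ρ
    each : ∀ k → k ≤ w → 𝐑 ∣ (var zero ≤' numR w ∧' at F (var zero)) ∷ _ ⊢ var zero ≐ numR k ⇒ ⊥'
    each k k≤ = ⇒I (⇒E (refute a λ h → ¬h (k , k≤ , h))
      (cast (instance-num a w ρ k) (replace F hyp₀ (∧E₂ hyp₁))))
  refute {Γ = Γ} (∀ᵇ x a) {w} {ρ} ¬h with counterexample (λ i → decide a w (i ▸ ρ)) (ρ x) ¬h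
  ... | k , k≤ , ¬a = cast (cong ¬'_ (sym (real-∀ a w ρ x)))
    (⇒I (⇒E (refute a ¬a) (cast (trans (natural (instance-at a w ρ) _ (var zero)) (instance-num a w ρ k))
      (⇒E (∀E (numR k) hyp₀) (cast (sym (≤-inst a w ρ (ρ x) (numR k))) (R-≤ k≤))))))

-- Rosser's formula: the first bound verifying a precedes every bound
-- verifying b.
module Rosser (a b : BF 1) where

  rosser : Term LR m → Formula LR m
  rosser t = ∃' (real a (const (renT suc t)) (var zero)
                 ∧' ∀' (var zero ≤' var (suc zero) ⇒ ¬' real b (const (renT suc (renT suc t))) (var zero)))

  rosser-sub : (σ : Fin m → Term LR n) (t : Term LR m) → sub σ (rosser t) ≡ rosser (subT σ t)
  rosser-sub σ t = cong₂ (λ φ ψ → ∃' (φ ∧' ∀' (var zero ≤' var (suc zero) ⇒ ¬' ψ)))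
    (real-sub a (const (subT-lift σ t)) refl)
    (real-sub b (const (trans (subT-lift (lift σ) (renT suc t)) (cong (renT suc) (subT-lift σ t)))) refl)

  rosserFamily : Family
  rosserFamily = record { at = rosser ; natural = rosser-sub }

  bound-at : BF 1 → ℕ → Family
  bound-at c n = record
    { at      = λ w → real c (const (numR n)) w
    ; natural = λ σ w → real-sub c (const (subT-numR σ n)) refl
    }

  rosser-num : ∀ n → rosser {m} (numR n) ≡
    ∃' (at (bound-at a n) (var zero) ∧' ∀' (var zero ≤' var (suc zero) ⇒ ¬' at (bound-at b n) (var zero)))
  rosser-num n = cong₂ (λ φ ψ → ∃' (φ ∧' ∀' (var zero ≤' var (suc zero) ⇒ ¬' ψ)))
    (real-cong a (const (renT-numR suc n)) refl)
    (real-cong b (const (trans (cong (renT suc) (renT-numR suc n)) (renT-numR suc n))) refl)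

  rosser-positive : ∀ {n} → ∃[ w ] ⟦ a ⟧ w (const n) → (∀ w → ¬ ⟦ b ⟧ w (const n)) → 𝐑 ∣ Γ ⊢ rosser (numR n)
  rosser-positive {Γ = Γ} {n} (w , h) ¬b = cast (sym (rosser-num n)) (∃I _ (numR w) (∧I
    (cast (sym (natural (bound-at a n) _ (var zero))) (prove a h))
    (∀I (⇒I (cast (sym (cong ¬'_ (natural (bound-at b n) _ (var zero))))
      (≤-elim w each (cast (cong (var zero ≤'_) (renT-numR suc w)) hyp₀)))))))
    where
    each : ∀ k → k ≤ w → 𝐑 ∣ _ ⊢ var zero ≐ numR k ⇒ ¬' at (bound-at b n) (var zero)
    each k _ = ⇒I (⇒I (⇒E (refute b (¬b k)) (replace (bound-at b n) hyp₁ hyp₀)))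

  rosser-negative : ∀ {n} → ∃[ v ] ⟦ b ⟧ v (const n) → (∀ w → ¬ ⟦ a ⟧ w (const n)) → 𝐑 ∣ Γ ⊢ ¬' rosser (numR n)
  rosser-negative {Γ = Γ} {n} (v , h) ¬a = cast (cong ¬'_ (sym (rosser-num n)))
    (⇒I (∃E hyp₀ (∨E (R-compare v (var zero)) (≤-elim v each hyp₀)
      (⇒E (cast (cong ¬'_ (natural (bound-at b n) _ (var zero))) (⇒E (∀E (numR v) (∧E₂ hyp₁)) hyp₀)) (prove b h)))))
    where
    each : ∀ k → k ≤ v → 𝐑 ∣ _ ∷ (at (bound-at a n) (var zero) ∧' _) ∷ _ ⊢ var zero ≐ numR k ⇒ ⊥'
    each k _ = ⇒I (⇒E (refute a (¬a k)) (replace (bound-at a n) hyp₀ (∧E₁ (hyp (there (there (here refl)))))))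

-- U is interpretable in R

haltsᵇ : Rec 1 → BF 1
haltsᵇ c = ∃ᵇ (rep c (suc zero ∷ []) zero)

halts-sound : ∀ {c w n} → ⟦ haltsᵇ c ⟧ w (const n) → ∃[ y ] c · (n ∷ []) ⇓ y
halts-sound {c} {w} {n} (y , _ , h) = y , rep-sound c (suc zero ∷ []) zero {w} {y ▸ const n} h

halts-complete : ∀ {c n} → ∃[ y ] c · (n ∷ []) ⇓ y → ∃[ w ] ⟦ haltsᵇ c ⟧ w (const n)
halts-complete (y , d) with sat-∃ y (rep-complete d (suc zero ∷ []) zero {y ▸ const _} refl refl)
... | sat w h = w , h

-- The translation of `t is the numeral n` when t is a variable.
isNum : ℕ → Term LR m → Formula LR m
isNum zero    t = ⊤' ∧' t ≐ fn 𝟎 []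
isNum (suc n) t = ∃' (⊤' ∧' ((isNum n (var zero) ∧' ⊤') ∧' renT suc t ≐ fn 𝐒 (var zero ∷ [])))

isNum-sub : ∀ n (σ : Fin k → Term LR m) t → sub σ (isNum n t) ≡ isNum n (subT σ t)
isNum-sub zero    σ t = refl
isNum-sub (suc n) σ t = cong₂ (λ φ u → ∃' (⊤' ∧' ((φ ∧' ⊤') ∧' u ≐ fn 𝐒 (var zero ∷ []))))
  (isNum-sub n (lift σ) (var zero)) (subT-lift σ t)

isNum-elim : ∀ n {t : Term LR m} → 𝐑 ∣ Γ ⊢ isNum n t → 𝐑 ∣ Γ ⊢ t ≐ numR n
isNum-elim zero    d = ∧E₂ d
isNum-elim (suc n) {t} d = ∃E d (cast (cong₂ _≐_ (renT≡subT suc t) (sym (subT-numR _ (suc n))))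
  (≐trans (∧E₂ (∧E₂ hyp₀)) (≐cong₁ (isNum-elim n (∧E₁ (∧E₁ (∧E₂ hyp₀)))))))

isNum-intro : ∀ n → 𝐑 ∣ Γ ⊢ isNum n (numR {m} n)
isNum-intro zero    = ∧I ⊤I (≐refl _)
isNum-intro (suc n) = ∃I _ (numR n) (∧I ⊤I (∧I
  (∧I (cast (sym (isNum-sub n _ (var zero))) (isNum-intro n)) ⊤I)
  (cast (cong (_≐ fn 𝐒 (numR n ∷ [])) (sym (subT-inst (numR n) (numR (suc n))))) (≐refl _))))

module _ {A B : ℕ → Set} (insep : RecursivelyInseparable A B) where

  open RecursivelyInseparable insep
  open Rosser (haltsᵇ (proj₁ re-A)) (haltsᵇ (proj₁ re-B))

  U→R : Translation LU LR
  U→R = record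
    { dom  = ⊤'
    ; eq   = var zero ≐ var (suc zero)
    ; relᵗ = λ { 𝐏 → rosser (var zero) }
    ; funᵗ = λ { 𝟎 → var zero ≐ fn 𝟎 [] ; 𝐒 → var zero ≐ fn 𝐒 (var (suc zero) ∷ []) }
    }

  open Translation U→R

  value-isNum : ∀ n (ρ : Fin 0 → Fin m) y → value ρ (numU n) y ≡ isNum n (var y)
  value-isNum zero    ρ y = refl
  value-isNum (suc n) ρ y =
    cong (λ φ → ∃' (⊤' ∧' ((φ ∧' ⊤') ∧' var (suc y) ≐ fn 𝐒 (var zero ∷ [])))) (value-isNum n (suc ∘ ρ) zero)

  R-positive : ∀ {n} → A n → 𝐑 ∣ Γ ⊢ rosser (numR n)
  R-positive {n = n} a = rosser-positive (halts-complete (Equivalence.to (proj₂ re-A n) a))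
    λ w h → disjoint n (a , Equivalence.from (proj₂ re-B n) (halts-sound {w = w} h))

  R-negative : ∀ {n} → B n → 𝐑 ∣ Γ ⊢ ¬' rosser (numR n)
  R-negative {n = n} b = rosser-negative (halts-complete (Equivalence.to (proj₂ re-B n) b))
    λ w h → disjoint n (Equivalence.from (proj₂ re-A n) (halts-sound {w = w} h) , b)

  P-positive : ∀ {n} → 𝐑 ⊢ rosser (numR n) → 𝐑 ⊢ (rel 𝐏 (numU n ∷ [])) ᵗ
  P-positive {n} d = ∃I _ (numR n) (∧I ⊤I (∧I
    (∧I (cast (sym (trans (cong (sub _) (value-isNum n _ zero)) (isNum-sub n _ (var zero)))) (isNum-intro n)) ⊤I)
    (cast (sym (trans (cong (sub _) (rosser-sub _ (var zero))) (rosser-sub _ (var zero)))) d)))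

  P-negative : ∀ {n} → (∀ {m} {Γ : List (Formula LR m)} → 𝐑 ∣ Γ ⊢ ¬' rosser (numR n)) → 𝐑 ⊢ (¬' rel 𝐏 (numU n ∷ [])) ᵗ
  P-negative {n} d = ⇒I (∃E hyp₀ (⇒E d (replace rosserFamily
    (isNum-elim n (cast (value-isNum n _ zero) (∧E₁ (∧E₁ (∧E₂ hyp₀)))))
    (cast (rosser-sub _ (var zero)) (∧E₂ (∧E₂ hyp₀))))))

  U-axioms : (φ : Sentence LU) → U A B φ → 𝐑 ⊢ φ ᵗ
  U-axioms _ (distinct {a} {b} a≢b) = ⇒I (∃E hyp₀ (∃E (∧E₂ hyp₀) (⇒E (R-distinct a≢b)
    (≐trans (≐sym (isNum-elim a (cast (value-isNum a _ (suc zero)) (∧E₁ (∧E₂ hyp₀)))))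
      (≐trans (∧E₂ (∧E₂ (∧E₂ hyp₀))) (isNum-elim b (cast (value-isNum b _ zero) (∧E₁ (∧E₂ (∧E₂ hyp₀))))))))))
  U-axioms _ (positive a) = P-positive (R-positive a)
  U-axioms _ (negative b) = P-negative (R-negative b)

  U⊴R : U A B ⊴ 𝐑
  U⊴R = U→R , record
    { domain-nonempty = ∃I _ (numR 0) ⊤I
    ; eq-refl  = ∀I (⇒I (≐refl _))
    ; eq-sym   = ∀I (⇒I (∀I (⇒I (⇒I (≐sym hyp₀)))))
    ; eq-trans = ∀I (⇒I (∀I (⇒I (∀I (⇒I (⇒I (⇒I (≐trans hyp₁ hyp₀))))))))
    ; rel-cong = λ { 𝐏 → ∀I (⇒I (∀I (⇒I (⇒I (⇒I (cast (sym (rosser-sub _ (var zero)))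
        (replace rosserFamily (∧E₁ hyp₁) (cast (rosser-sub _ (var zero)) hyp₀)))))))) }
    ; fun-cong = λ { 𝟎 → ∀I (⇒I (∀I (⇒I (⇒I (⇒I (⇒I (≐trans (≐sym hyp₁) hyp₀)))))))
                   ; 𝐒 → ∀I (⇒I (∀I (⇒I (∀I (⇒I (∀I (⇒I (⇒I (⇒I (⇒I
                       (≐trans (≐sym hyp₁) (≐trans hyp₀ (≐cong₁ (∧E₁ (hyp (there (there (here refl)))))))))))))))))) }
    ; fun-total = λ { 𝟎 → ∃I _ (numR 0) (∧I ⊤I (≐refl _))
                    ; 𝐒 → ∀I (⇒I (∃I _ (fn 𝐒 (var zero ∷ [])) (∧I ⊤I (≐refl _)))) }
    ; fun-functional = λ { 𝟎 → ∀I (⇒I (∀I (⇒I (⇒I (⇒I (≐trans hyp₁ (≐sym hyp₀)))))))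
                         ; 𝐒 → ∀I (⇒I (∀I (⇒I (∀I (⇒I (⇒I (⇒I (≐trans hyp₁ (≐sym hyp₀))))))))) }
    ; axioms = U-axioms
    }

-- Classical models

-- Stability of the atomic facts makes the rule raa sound constructively.
record Model (L : Language) : Set₁ where
  open Language L
  field
    Carrier    : Set
    point      : Carrier
    funᴹ       : Fun k → Vec Carrier k → Carrier
    relᴹ       : Rel k → Vec Carrier k → Set
    ≡-stable   : {x y : Carrier} → ¬ ¬ (x ≡ y) → x ≡ y
    rel-stable : {r : Rel k} {xs : Vec Carrier k} → ¬ ¬ relᴹ r xs → relᴹ r xs

module Semantics {L : Language} (M : Model L) where

  open Model M

  mutual
    evalT : Term L n → (Fin n → Carrier) → Carrier
    evalT (var x)   ρ = ρ x
    evalT (fn f ts) ρ = funᴹ f (evalTs ts ρ)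

    evalTs : Vec (Term L n) k → (Fin n → Carrier) → Vec Carrier k
    evalTs []       ρ = []
    evalTs (t ∷ ts) ρ = evalT t ρ ∷ evalTs ts ρ

  ⊨ : Formula L n → (Fin n → Carrier) → Set
  ⊨ ⊥'         ρ = ⊥
  ⊨ (t ≐ u)    ρ = evalT t ρ ≡ evalT u ρ
  ⊨ (rel r ts) ρ = relᴹ r (evalTs ts ρ)
  ⊨ (φ ⇒ ψ)    ρ = ⊨ φ ρ → ⊨ ψ ρ
  ⊨ (∀' φ)     ρ = ∀ x → ⊨ φ (x ▸ ρ)

  ⊨-stable : ∀ (φ : Formula L n) {ρ} → ¬ ¬ ⊨ φ ρ → ⊨ φ ρ
  ⊨-stable ⊥'         h = h id
  ⊨-stable (t ≐ u)    h = ≡-stable h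
  ⊨-stable (rel r ts) h = rel-stable h
  ⊨-stable (φ ⇒ ψ)    h = λ p → ⊨-stable ψ λ ¬q → h λ f → ¬q (f p)
  ⊨-stable (∀' φ)     h = λ x → ⊨-stable φ λ ¬p → h λ f → ¬p (f x)

  mutual
    evalT-sub : ∀ {σ : Fin m → Term L n} {ρ ρ′} → (∀ x → evalT (σ x) ρ ≡ ρ′ x) → ∀ t → evalT (subT σ t) ρ ≡ evalT t ρ′
    evalT-sub h (var x)   = h x
    evalT-sub h (fn f ts) = cong (funᴹ f) (evalTs-sub h ts)

    evalTs-sub : ∀ {σ : Fin m → Term L n} {ρ ρ′} → (∀ x → evalT (σ x) ρ ≡ ρ′ x) →
                 ∀ (ts : Vec (Term L m) k) → evalTs (subTs σ ts) ρ ≡ evalTs ts ρ′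
    evalTs-sub h []       = refl
    evalTs-sub h (t ∷ ts) = cong₂ _∷_ (evalT-sub h t) (evalTs-sub h ts)

  evalT-lift : ∀ {σ : Fin m → Term L n} {ρ ρ′} {y : Carrier} → (∀ x → evalT (σ x) ρ ≡ ρ′ x) →
               ∀ x → evalT ((var zero ▸ (renT suc ∘ σ)) x) (y ▸ ρ) ≡ (y ▸ ρ′) x
  evalT-lift h zero = refl
  evalT-lift {σ = σ} h (suc x) =
    trans (cong (λ t → evalT t _) (renT≡subT suc (σ x))) (trans (evalT-sub (λ _ → refl) (σ x)) (h x))

  mutual
    ⊨-sub⁻ : ∀ {σ : Fin m → Term L n} {ρ ρ′} → (∀ x → evalT (σ x) ρ ≡ ρ′ x) → ∀ φ → ⊨ (sub σ φ) ρ → ⊨ φ ρ′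
    ⊨-sub⁻ h (t ≐ u)    p = trans (sym (evalT-sub h t)) (trans p (evalT-sub h u))
    ⊨-sub⁻ h (rel r ts) p = subst (relᴹ r) (evalTs-sub h ts) p
    ⊨-sub⁻ h (φ ⇒ ψ)    p = λ q → ⊨-sub⁻ h ψ (p (⊨-sub⁺ h φ q))
    ⊨-sub⁻ {σ = σ} h (∀' φ) p = λ x → ⊨-sub⁻ (evalT-lift {σ = σ} h) φ (p x)

    ⊨-sub⁺ : ∀ {σ : Fin m → Term L n} {ρ ρ′} → (∀ x → evalT (σ x) ρ ≡ ρ′ x) → ∀ φ → ⊨ φ ρ′ → ⊨ (sub σ φ) ρ
    ⊨-sub⁺ h (t ≐ u)    p = trans (evalT-sub h t) (trans p (sym (evalT-sub h u)))
    ⊨-sub⁺ h (rel r ts) p = subst (relᴹ r) (sym (evalTs-sub h ts)) p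
    ⊨-sub⁺ h (φ ⇒ ψ)    p = λ q → ⊨-sub⁺ h ψ (p (⊨-sub⁻ h φ q))
    ⊨-sub⁺ {σ = σ} h (∀' φ) p = λ x → ⊨-sub⁺ (evalT-lift {σ = σ} h) φ (p x)

  ⊨-inst⁻ : ∀ (φ : Formula L (suc n)) t {ρ} → ⊨ (inst φ t) ρ → ⊨ φ (evalT t ρ ▸ ρ)
  ⊨-inst⁻ φ t = ⊨-sub⁻ (λ { zero → refl ; (suc x) → refl }) φ

  ⊨-inst⁺ : ∀ (φ : Formula L (suc n)) t {ρ} → ⊨ φ (evalT t ρ ▸ ρ) → ⊨ (inst φ t) ρ
  ⊨-inst⁺ φ t = ⊨-sub⁺ (λ { zero → refl ; (suc x) → refl }) φ

  module _ {T : Theory L} (model : ∀ φ → T φ → ⊨ φ ε) where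

    soundness : {Γ : List (Formula L n)} {φ : Formula L n} → T ∣ Γ ⊢ φ →
                ∀ {ρ} → (∀ {ψ} → ψ ∈ Γ → ⊨ ψ ρ) → ⊨ φ ρ
    soundness (axiom {φ} a) hs = ⊨-sub⁺ (λ ()) φ (model φ a)
    soundness (hyp φ∈) hs = hs φ∈
    soundness (⇒I d) hs = λ p → soundness d λ { (here refl) → p ; (there ψ∈) → hs ψ∈ }
    soundness (⇒E d e) hs = soundness d hs (soundness e hs)
    soundness {φ = φ} (raa d) hs = ⊨-stable φ λ ¬p → soundness d λ { (here refl) → ¬p ; (there ψ∈) → hs ψ∈ }
    soundness {Γ = Γ} (∀I d) {ρ} hs x = soundness d shifted
      where
      shifted : ∀ {ψ} → ψ ∈ List.map shift Γ → ⊨ ψ (x ▸ ρ)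
      shifted ψ∈ with ∈-map⁻ shift ψ∈
      ... | χ , χ∈ , refl = ⊨-sub⁺ (λ _ → refl) χ (hs χ∈)
    soundness (∀E {φ} t d) hs = ⊨-inst⁺ φ t (soundness d hs _)
    soundness (≐refl t) hs = refl
    soundness (≐subst {t} {u} φ d e) {ρ} hs =
      ⊨-inst⁺ φ u (subst (λ x → ⊨ φ (x ▸ ρ)) (soundness d hs) (⊨-inst⁻ φ t (soundness e hs)))
    soundness nonempty hs = λ h → h point refl

    ⊢⇒⊨ : {φ : Sentence L} → T ⊢ φ → ⊨ φ ε
    ⊢⇒⊨ d = soundness d λ ()

-- The order on interpreted numerals

module InterpretedOrder {L : Language} {T : Theory L} (M : Model L)
                        (model : ∀ φ → T φ → Semantics.⊨ M φ ε)
                        (τ : Translation LR L) (int : IsInterpretation 𝐑 T τ) where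

  open Model M
  open Semantics M
  open Translation τ
  open IsInterpretation int

  ⊢ᴹ : {φ : Sentence L} → T ⊢ φ → ⊨ φ ε
  ⊢ᴹ = ⊢⇒⊨ model

  D Z : Carrier → Set
  D x = ⊨ dom (x ▸ ε)
  Z y = ⊨ (funᵗ 𝟎) (y ▸ ε)

  E S _⊑_ : Carrier → Carrier → Set
  E x y = ⊨ eq (x ▸ y ▸ ε)
  S x y = ⊨ (funᵗ 𝐒) (y ▸ x ▸ ε)
  x ⊑ y = ⊨ (relᵗ leq) (x ▸ y ▸ ε)

  module _ {ρ : Fin m → Carrier} where

    Dom⁺ : ∀ {x} → D (ρ x) → ⊨ (Dom x) ρ
    Dom⁺ = ⊨-sub⁺ (λ { zero → refl }) dom

    Dom⁻ : ∀ {x} → ⊨ (Dom x) ρ → D (ρ x)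
    Dom⁻ = ⊨-sub⁻ (λ { zero → refl }) dom

    Eq⁺ : ∀ {x y} → E (ρ x) (ρ y) → ⊨ (Eq x y) ρ
    Eq⁺ = ⊨-sub⁺ (λ { zero → refl ; (suc zero) → refl }) eq

    Eq⁻ : ∀ {x y} → ⊨ (Eq x y) ρ → E (ρ x) (ρ y)
    Eq⁻ = ⊨-sub⁻ (λ { zero → refl ; (suc zero) → refl }) eq

    Leq⁺ : ∀ {xs : Fin 2 → Fin m} → ρ (xs zero) ⊑ ρ (xs (suc zero)) → ⊨ (Relᵗ leq xs) ρ
    Leq⁺ = ⊨-sub⁺ (λ { zero → refl ; (suc zero) → refl }) (relᵗ leq)

    Leq⁻ : ∀ {xs : Fin 2 → Fin m} → ⊨ (Relᵗ leq xs) ρ → ρ (xs zero) ⊑ ρ (xs (suc zero))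
    Leq⁻ = ⊨-sub⁻ (λ { zero → refl ; (suc zero) → refl }) (relᵗ leq)

    Zero⁺ : ∀ {xs : Fin 0 → Fin m} {y} → Z (ρ y) → ⊨ (Graph 𝟎 xs y) ρ
    Zero⁺ = ⊨-sub⁺ (λ { zero → refl ; (suc ()) }) (funᵗ 𝟎)

    Zero⁻ : ∀ {xs : Fin 0 → Fin m} {y} → ⊨ (Graph 𝟎 xs y) ρ → Z (ρ y)
    Zero⁻ = ⊨-sub⁻ (λ { zero → refl ; (suc ()) }) (funᵗ 𝟎)

    Suc⁺ : ∀ {xs : Fin 1 → Fin m} {y} → S (ρ (xs zero)) (ρ y) → ⊨ (Graph 𝐒 xs y) ρ
    Suc⁺ = ⊨-sub⁺ (λ { zero → refl ; (suc zero) → refl }) (funᵗ 𝐒)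

    Suc⁻ : ∀ {xs : Fin 1 → Fin m} {y} → ⊨ (Graph 𝐒 xs y) ρ → S (ρ (xs zero)) (ρ y)
    Suc⁻ = ⊨-sub⁻ (λ { zero → refl ; (suc zero) → refl }) (funᵗ 𝐒)

  E-refl : ∀ {x} → D x → E x x
  E-refl dx = Eq⁻ (⊢ᴹ eq-refl _ (Dom⁺ dx))

  E-sym : ∀ {x y} → D x → D y → E x y → E y x
  E-sym dx dy e = Eq⁻ (⊢ᴹ eq-sym _ (Dom⁺ dx) _ (Dom⁺ dy) (Eq⁺ e))

  E-trans : ∀ {x y z} → D x → D y → D z → E x y → E y z → E x z
  E-trans dx dy dz e f = Eq⁻ (⊢ᴹ eq-trans _ (Dom⁺ dx) _ (Dom⁺ dy) _ (Dom⁺ dz) (Eq⁺ e) (Eq⁺ f))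

  ⊑-cong : ∀ {x y x′ y′} → D x → D y → D x′ → D y′ → E x x′ → E y y′ → x ⊑ y → x′ ⊑ y′
  ⊑-cong {x} {y} {x′} {y′} dx dy dx′ dy′ e f le = Leq⁻ {ρ = y′▸} {xs = λ i → i ↑ˡ 2}
    (⊢ᴹ (rel-cong leq) _ (Dom⁺ dy) _ (Dom⁺ dx) _ (Dom⁺ dy′) _ (Dom⁺ dx′)
      (λ h → h (Eq⁺ e) (λ h′ → h′ (Eq⁺ f) id)) (Leq⁺ {ρ = y′▸} {xs = λ i → 2 ↑ʳ (i ↑ˡ 0)} le))
    where y′▸ = x′ ▸ y′ ▸ x ▸ y ▸ ε

  S-cong : ∀ {x y x′ y′} → D x → D y → D x′ → D y′ → E x x′ → E y y′ → S x y → S x′ y′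
  S-cong {x} {y} {x′} {y′} dx dy dx′ dy′ e f s = Suc⁻ {ρ = ρ} {xs = λ i → 2 ↑ʳ (i ↑ˡ 1)} {y = zero}
    (⊢ᴹ (fun-cong 𝐒) _ (Dom⁺ dx) _ (Dom⁺ dx′) _ (Dom⁺ dy) _ (Dom⁺ dy′) (λ h → h (Eq⁺ e) id) (Eq⁺ f)
      (Suc⁺ {ρ = ρ} {xs = λ i → 2 ↑ʳ (1 ↑ʳ (i ↑ˡ 0))} {y = suc zero} s))
    where ρ = y′ ▸ y ▸ x′ ▸ x ▸ ε

  Z-unique : ∀ {x y} → D x → D y → Z x → Z y → E x y
  Z-unique dx dy z z′ = Eq⁻ (⊢ᴹ (fun-functional 𝟎) _ (Dom⁺ dx) _ (Dom⁺ dy) (Zero⁺ {y = suc zero} z) (Zero⁺ {y = zero} z′))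

  S-unique : ∀ {x y z} → D x → D y → D z → S x y → S x z → E y z
  S-unique {x} {y} {z} dx dy dz s s′ = Eq⁻ (⊢ᴹ (fun-functional 𝐒) _ (Dom⁺ dx) _ (Dom⁺ dy) _ (Dom⁺ dz)
    (Suc⁺ {ρ = z ▸ y ▸ x ▸ ε} {xs = λ i → 2 ↑ʳ (i ↑ˡ 0)} {y = suc zero} s)
    (Suc⁺ {ρ = z ▸ y ▸ x ▸ ε} {xs = λ i → 2 ↑ʳ (i ↑ˡ 0)} {y = zero} s′))

  Num : ℕ → Carrier → Set
  Num zero    y = Z y
  Num (suc k) y = ¬ ¬ (Σ[ x ∈ Carrier ] D x × Num k x × S x y)

  E-stable : ∀ {x y} → ¬ ¬ E x y → E x y
  E-stable = ⊨-stable eq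

  Num-exists : ∀ k → ¬ ¬ (Σ[ x ∈ Carrier ] D x × Num k x)
  Num-exists zero none = ⊢ᴹ (fun-total 𝟎) λ y h → h λ d z → none (y , Dom⁻ d , Zero⁻ {y = zero} z)
  Num-exists (suc k) none = Num-exists k λ (x , dx , nx) →
    ⊢ᴹ (fun-total 𝐒) x (Dom⁺ dx) λ y h → h λ dy s →
      none (y , Dom⁻ dy , λ ¬s → ¬s (x , dx , nx , Suc⁻ {ρ = y ▸ x ▸ ε} {xs = λ i → 1 ↑ʳ (i ↑ˡ 0)} {y = zero} s))

  Num-unique : ∀ k {x y} → D x → D y → Num k x → Num k y → E x y
  Num-unique zero    dx dy z z′ = Z-unique dx dy z z′
  Num-unique (suc k) dx dy n n′ = E-stable λ ¬e → n λ (u , du , nu , s) → n′ λ (v , dv , nv , s′) →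
    ¬e (S-unique dv dx dy (S-cong du dx dv dx (Num-unique k du dv nu nv) (E-refl dx) s) s′)

  value⁺ : ∀ k {ξ : Fin n → Fin m} {y ρ} → Num k (ρ y) → ⊨ (value ξ (numR k) y) ρ
  value⁺ zero {y = y} z = λ h → h id (Zero⁺ {y = y} z)
  value⁺ (suc k) {y = y} {ρ} n = λ h → n λ (x , dx , nx , s) →
    h x λ h′ → h′ (Dom⁺ dx) λ h″ → h″ (λ h‴ → h‴ (value⁺ k nx) id) (Suc⁺ {ρ = x ▸ ρ} {xs = _↑ˡ _} {y = suc y} s)

  value⁻ : ∀ k {ξ : Fin n → Fin m} {y ρ} → ⊨ (value ξ (numR k) y) ρ → Num k (ρ y)
  value⁻ zero {y = y} h = ⊨-stable (funᵗ 𝟎) λ ¬z → h λ _ z → ¬z (Zero⁻ {y = y} z)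
  value⁻ (suc k) {y = y} {ρ} h = λ ¬n → h λ x h′ → h′ λ dx h″ → h″ λ nx s → nx λ nx′ _ →
    ¬n (x , Dom⁻ dx , value⁻ k nx′ , Suc⁻ {ρ = x ▸ ρ} {xs = _↑ˡ _} {y = suc y} s)

  Num-distinct : ∀ {k l x y} → k ≢ l → D x → D y → Num k x → Num l y → ¬ E x y
  Num-distinct {k} {l} {x} {y} k≢l dx dy nx ny e = ⊢ᴹ (axioms _ (distinct k≢l))
    λ h → h x λ h′ → h′ (Dom⁺ dx) λ g → g y λ g′ → g′ (Dom⁺ dy)
      λ f → f (value⁺ k nx) λ f′ → f′ (value⁺ l ny) (Eq⁺ e)

  oneOf⁻ : ∀ b {l x} → b < l → D x → Num l x → ¬ ⊨ (oneOf b (var zero) ᵗ) (x ▸ ε)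
  oneOf⁻ b {l} {x} b<l dx nx = go b b<l
    where
    isNumeral : ∀ k → k ≢ l → ¬ ⊨ ((var zero ≐ numR k) ᵗ) (x ▸ ε)
    isNumeral k k≢l h = h λ u h′ → h′ λ du g → g λ v g′ → g′ λ dv f → f λ xu f′ → f′ λ vk uv →
      Num-distinct (k≢l ∘ sym) dx (Dom⁻ {x = zero} dv) nx (value⁻ k vk)
        (E-trans dx (Dom⁻ {x = zero} du) (Dom⁻ {x = zero} dv) (Eq⁻ {x = suc (suc zero)} xu) (Eq⁻ uv))
    go : ∀ b → b < l → ¬ ⊨ (oneOf b (var zero) ᵗ) (x ▸ ε)
    go zero    b<l h = isNumeral 0 (<⇒≢ b<l) h
    go (suc b) b<l h = isNumeral (suc b) (<⇒≢ b<l) (h (go b (<⇒≤ b<l)))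

  ⋢ : ∀ {k l x y} → k < l → D x → Num k x → D y → Num l y → ¬ y ⊑ x
  ⋢ {k} {l} {x} {y} k<l dx nx dy ny le = oneOf⁻ k k<l dy ny (⊢ᴹ (axioms _ (bounded k)) y (Dom⁺ dy)
    λ h → h x λ h′ → h′ (Dom⁺ dx) λ g → g y λ g′ → g′ (Dom⁺ dy)
      λ f → f (λ e → e (Eq⁺ (E-refl dy)) λ e′ → e′ (value⁺ k nx) id) (Leq⁺ {ρ = y ▸ x ▸ y ▸ ε} {xs = _↑ˡ 1} le))

  ⊑-numerals : ∀ {k l x y} → k < l → D x → Num k x → D y → Num l y → ¬ ¬ x ⊑ y
  ⊑-numerals {k} {l} {x} {y} k<l dx nx dy ny ¬le =
    ⊢ᴹ (axioms _ (compare l)) x (Dom⁺ dx) first λ v h → h λ dv g → g λ u g′ → g′ λ du f → f λ es le →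
      es λ lu es′ → es′ λ xv _ →
        ⋢ k<l dx nx dy ny (⊑-cong (Dom⁻ {x = zero} du) (Dom⁻ {x = zero} dv) dy dx
          (Num-unique l (Dom⁻ {x = zero} du) dy (value⁻ l lu) ny)
          (E-sym dx (Dom⁻ {x = zero} dv) (Eq⁻ {x = suc (suc zero)} xv))
          (Leq⁻ {ρ = u ▸ v ▸ x ▸ ε} {xs = _↑ˡ 1} le))
    where
    first : ¬ ⊨ ((var zero ≤' numR l) ᵗ) (x ▸ ε)
    first h = h λ v h → h λ dv g → g λ u g′ → g′ λ du f → f λ es le →
      es λ xu es′ → es′ λ lv _ →
        ¬le (⊑-cong (Dom⁻ {x = zero} du) (Dom⁻ {x = zero} dv) dx dy
          (E-sym dx (Dom⁻ {x = zero} du) (Eq⁻ {x = suc (suc zero)} xu))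
          (Num-unique l (Dom⁻ {x = zero} dv) dy (value⁻ l lv) ny)
          (Leq⁻ {ρ = u ▸ v ▸ x ▸ ε} {xs = _↑ˡ 1} le))

-- A stable model of U

open import Data.Integer as ℤ using (ℤ; +_; -[1+_]; ∣_∣; 0ℤ; 1ℤ)
open import Data.Integer.DivMod using (n%ℕd<d; a≡a%ℕn+[a/ℕn]*n)
import Data.Integer.Properties as ℤ
open import Data.Integer.Tactic.RingSolver renaming (solve-∀ to ℤ-solve-∀) using ()

-- Infinitely many copies of the chain ℤ, all coloured alike; the numerals
-- form the right half of the copy with number 0.
Point : Set
Point = ℕ × ℤ

infixl 6 _⊞_

_⊞_ : Point → ℤ → Point
(c , z) ⊞ d = c , z ℤ.+ d

⊞-assoc : ∀ x d e → x ⊞ d ⊞ e ≡ x ⊞ (d ℤ.+ e)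
⊞-assoc (c , z) d e = cong (c ,_) (ℤ.+-assoc z d e)

⊞-0 : ∀ x → x ⊞ 0ℤ ≡ x
⊞-0 (c , z) = cong (c ,_) (ℤ.+-identityʳ z)

⊞-difference : ∀ x y d e → x ⊞ d ≡ y ⊞ e → x ≡ y ⊞ (e ℤ.- d)
⊞-difference (c , z) (c′ , z′) d e eq = cong₂ _,_ (cong proj₁ eq)
  (trans (cancel z d) (trans (cong (ℤ._- d) (cong proj₂ eq)) (ℤ.+-assoc z′ e (ℤ.- d))))
  where
  cancel : ∀ z d → z ≡ z ℤ.+ d ℤ.- d
  cancel = ℤ-solve-∀

⊞-undifference : ∀ x y d e → x ≡ y ⊞ (e ℤ.- d) → x ⊞ d ≡ y ⊞ e
⊞-undifference _ y d e refl = trans (⊞-assoc y (e ℤ.- d) d) (cong (y ⊞_) (cancel e d))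
  where
  cancel : ∀ e d → e ℤ.- d ℤ.+ d ≡ e
  cancel = ℤ-solve-∀

⊞-flip : ∀ {x} y d → x ≡ y ⊞ d → y ≡ x ⊞ (ℤ.- d)
⊞-flip y d refl = sym (trans (⊞-assoc y d (ℤ.- d)) (trans (cong (y ⊞_) (ℤ.+-inverseʳ d)) (⊞-0 y)))

module Chains (Colour : ℤ → Set) (Colour-stable : ∀ {z} → ¬ ¬ Colour z → Colour z) where

  origin : Point
  origin = 0 , 0ℤ

  chains : Model LU
  chains = record
    { Carrier    = Point
    ; point      = origin
    ; funᴹ       = λ { 𝟎 [] → origin ; 𝐒 (x ∷ []) → x ⊞ 1ℤ }
    ; relᴹ       = λ { 𝐏 ((c , z) ∷ []) → Colour z }
    ; ≡-stable   = λ {x} {y} → decidable-stable (≡-dec _≟_ ℤ._≟_ x y)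
    ; rel-stable = λ { {r = 𝐏} {_ ∷ []} → Colour-stable }
    }

  open Semantics chains

  -- Places are the variables and, as nothing, the origin.
  place : (Fin n → Point) → Maybe (Fin n) → Point
  place ρ nothing  = origin
  place ρ (just x) = ρ x

  record Half (r : ℕ) (ρ ρ′ : Fin n → Point) : Set where
    field
      near   : ∀ p q d → ∣ d ∣ ≤ r → place ρ p ≡ place ρ q ⊞ d → place ρ′ p ≡ place ρ′ q ⊞ d
      colour : ∀ p d → ∣ d ∣ ≤ r → Colour (proj₂ (place ρ p ⊞ d)) → Colour (proj₂ (place ρ′ p ⊞ d))

  open Half

  Agree : ℕ → (ρ ρ′ : Fin n → Point) → Set
  Agree r ρ ρ′ = Half r ρ ρ′ × Half r ρ′ ρ

  Half-mono : ∀ {r r′} {ρ ρ′ : Fin n → Point} → r ≤ r′ → Half r′ ρ ρ′ → Half r ρ ρ′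
  Half-mono r≤ h = record { near = λ p q d d≤ → near h p q d (≤-trans d≤ r≤) ; colour = λ p d d≤ → colour h p d (≤-trans d≤ r≤) }

  Agree-mono : ∀ {r r′} {ρ ρ′ : Fin n → Point} → r ≤ r′ → Agree r′ ρ ρ′ → Agree r ρ ρ′
  Agree-mono r≤ (h , h′) = Half-mono r≤ h , Half-mono r≤ h′

  -- A new point close to an old place is described by that place.
  module Near {r : ℕ} (p : Maybe (Fin n)) {d : ℤ} (d≤r : ∣ d ∣ ≤ r) where

    base : Maybe (Fin (suc n)) → Maybe (Fin n)
    base nothing        = nothing
    base (just zero)    = p
    base (just (suc x)) = just x

    offset : Maybe (Fin (suc n)) → ℤ
    offset (just zero) = d
    offset _           = 0ℤ

    offset≤ : ∀ q → ∣ offset q ∣ ≤ r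
    offset≤ nothing        = z≤n
    offset≤ (just zero)    = d≤r
    offset≤ (just (suc x)) = z≤n

    place-base : ∀ {ρ} q → place ((place ρ p ⊞ d) ▸ ρ) q ≡ place ρ (base q) ⊞ offset q
    place-base nothing        = sym (⊞-0 origin)
    place-base (just zero)    = refl
    place-base {ρ} (just (suc x)) = sym (⊞-0 (ρ x))

    near-half : ∀ {ρ ρ′} → Half (r + r + r) ρ ρ′ → Half r ((place ρ p ⊞ d) ▸ ρ) ((place ρ′ p ⊞ d) ▸ ρ′)
    near-half {ρ} {ρ′} h = record
      { near = λ q q′ e e≤r eq →
          trans (place-base q) (trans (⊞-undifference (place ρ′ (base q)) (place ρ′ (base q′)) (offset q) (offset q′ ℤ.+ e) (near h (base q) (base q′) _ (difference≤ q q′ e e≤r)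
            (⊞-difference (place ρ (base q)) (place ρ (base q′)) (offset q) (offset q′ ℤ.+ e)
            (trans (sym (place-base q)) (trans eq (trans (cong (_⊞ e) (place-base q′)) (⊞-assoc (place ρ (base q′)) (offset q′) e)))))))
            (trans (sym (⊞-assoc (place ρ′ (base q′)) (offset q′) e)) (cong (_⊞ e) (sym (place-base q′)))))
      ; colour = λ q e e≤r c → subst (Colour ∘ proj₂) (sym (trans (cong (_⊞ e) (place-base q)) (⊞-assoc (place ρ′ (base q)) (offset q) e)))
          (colour h (base q) (offset q ℤ.+ e) (≤-trans (sum≤ q e e≤r) (m≤m+n (r + r) r))
            (subst (Colour ∘ proj₂) (trans (cong (_⊞ e) (place-base q)) (⊞-assoc (place ρ (base q)) (offset q) e)) c))
      }
      where
      sum≤ : ∀ q e → ∣ e ∣ ≤ r → ∣ offset q ℤ.+ e ∣ ≤ r + r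
      sum≤ q e e≤r = ≤-trans (ℤ.∣i+j∣≤∣i∣+∣j∣ (offset q) e) (+-mono-≤ (offset≤ q) e≤r)
      difference≤ : ∀ q q′ e → ∣ e ∣ ≤ r → ∣ offset q′ ℤ.+ e ℤ.- offset q ∣ ≤ r + r + r
      difference≤ q q′ e e≤r = ≤-trans (ℤ.∣i-j∣≤∣i∣+∣j∣ (offset q′ ℤ.+ e) (offset q)) (+-mono-≤ (sum≤ q′ e e≤r) (offset≤ q))

  Far : ℕ → (Fin n → Point) → Point → Set
  Far r ρ x = ∀ p d → ∣ d ∣ ≤ r → x ≢ place ρ p ⊞ d

  far-half : ∀ {r} {ρ ρ′ : Fin n → Point} {x x′} → proj₂ x ≡ proj₂ x′ → Far r ρ x → Half r ρ ρ′ → Half r (x ▸ ρ) (x′ ▸ ρ′)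
  far-half {r = r} {ρ} {ρ′} {x} {x′} z≡z′ far h = record { near = near′ ; colour = colour′ }
    where
    near′ : ∀ p q d → ∣ d ∣ ≤ r → place (x ▸ ρ) p ≡ place (x ▸ ρ) q ⊞ d → place (x′ ▸ ρ′) p ≡ place (x′ ▸ ρ′) q ⊞ d
    near′ (just zero)    (just zero)    d d≤ eq = cong (proj₁ x′ ,_) (subst (λ z → z ≡ z ℤ.+ d) z≡z′ (cong proj₂ eq))
    near′ (just zero)    nothing        d d≤ eq = contradiction eq (far nothing d d≤)
    near′ (just zero)    (just (suc q)) d d≤ eq = contradiction eq (far (just q) d d≤)
    near′ nothing        (just zero)    d d≤ eq = contradiction (⊞-flip x d eq) (far nothing (ℤ.- d) (subst (_≤ r) (sym (ℤ.∣-i∣≡∣i∣ d)) d≤))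
    near′ (just (suc p)) (just zero)    d d≤ eq = contradiction (⊞-flip x d eq) (far (just p) (ℤ.- d) (subst (_≤ r) (sym (ℤ.∣-i∣≡∣i∣ d)) d≤))
    near′ nothing        nothing        d d≤ eq = eq
    near′ nothing        (just (suc q)) d d≤ eq = near h nothing (just q) d d≤ eq
    near′ (just (suc p)) nothing        d d≤ eq = near h (just p) nothing d d≤ eq
    near′ (just (suc p)) (just (suc q)) d d≤ eq = near h (just p) (just q) d d≤ eq
    colour′ : ∀ p d → ∣ d ∣ ≤ r → Colour (proj₂ (place (x ▸ ρ) p ⊞ d)) → Colour (proj₂ (place (x′ ▸ ρ′) p ⊞ d))
    colour′ (just zero)    d d≤ c = subst (λ z → Colour (z ℤ.+ d)) z≡z′ c
    colour′ nothing        d d≤ c = c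
    colour′ (just (suc p)) d d≤ c = colour h (just p) d d≤ c

  fresh : (Fin n → Point) → ℕ
  fresh {zero}  ρ = 1
  fresh {suc n} ρ = suc (proj₁ (ρ zero)) ⊔ fresh (ρ ∘ suc)

  fresh> : ∀ (ρ : Fin n → Point) p → proj₁ (place ρ p) < fresh ρ
  fresh> {zero}  ρ nothing        = s≤s z≤n
  fresh> {suc n} ρ nothing        = ≤-trans (fresh> (ρ ∘ suc) nothing) (m≤n⊔m (suc (proj₁ (ρ zero))) (fresh (ρ ∘ suc)))
  fresh> {suc n} ρ (just zero)    = m≤m⊔n (suc (proj₁ (ρ zero))) (fresh (ρ ∘ suc))
  fresh> {suc n} ρ (just (suc x)) = ≤-trans (fresh> (ρ ∘ suc) (just x)) (m≤n⊔m (suc (proj₁ (ρ zero))) (fresh (ρ ∘ suc)))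

  fresh-far : ∀ {r} (ρ : Fin n → Point) z → Far r ρ (fresh ρ , z)
  fresh-far ρ z p _ _ eq = <⇒≢ (fresh> ρ p) (sym (cong proj₁ eq))

  close? : ∀ r x y → Dec (Σ[ d ∈ ℤ ] ∣ d ∣ ≤ r × x ≡ y ⊞ d)
  close? r x@(c , z) y@(c′ , z′) = map′
    (λ (d≤ , eq) → z ℤ.- z′ , d≤ , cong₂ _,_ eq (cancel z z′))
    (λ (d , d≤ , eq) → subst (λ e → ∣ e ∣ ≤ r) (sym (trans (cong (ℤ._- z′) (cong proj₂ eq)) (cancel′ z′ d))) d≤ , cong proj₁ eq)
    ((∣ z ℤ.- z′ ∣ ≤? r) ×-dec (c ≟ c′))
    where
    cancel : ∀ z z′ → z ≡ z′ ℤ.+ (z ℤ.- z′)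
    cancel = ℤ-solve-∀
    cancel′ : ∀ z d → z ℤ.+ d ℤ.- z ≡ d
    cancel′ = ℤ-solve-∀

  near-or-far : ∀ r (ρ : Fin n → Point) x → (Σ[ p ∈ Maybe (Fin n) ] Σ[ d ∈ ℤ ] ∣ d ∣ ≤ r × x ≡ place ρ p ⊞ d) ⊎ Far r ρ x
  near-or-far r ρ x with close? r x origin | any? (λ i → close? r x (ρ i))
  ... | yes (d , d≤ , eq) | _ = inj₁ (nothing , d , d≤ , eq)
  ... | no _ | yes (i , d , d≤ , eq) = inj₁ (just i , d , d≤ , eq)
  ... | no ¬o | no ¬i = inj₂ λ { nothing d d≤ eq → ¬o (d , d≤ , eq) ; (just i) d d≤ eq → ¬i (i , d , d≤ , eq) }

  forth : ∀ {r} {ρ ρ′ : Fin n → Point} → Agree (r + r + r) ρ ρ′ → ∀ x → Σ[ x′ ∈ Point ] Agree r (x ▸ ρ) (x′ ▸ ρ′)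
  forth {r = r} {ρ} {ρ′} a@(h , h′) x with near-or-far r ρ x
  ... | inj₁ (p , d , d≤ , refl) = place ρ′ p ⊞ d , near-half h , near-half h′
    where open Near p {d} d≤
  ... | inj₂ far = (fresh ρ′ , proj₂ x) , far-half refl far (Half-mono r≤3r h) ,
                   far-half refl (fresh-far ρ′ (proj₂ x)) (Half-mono r≤3r h′)
    where
    r≤3r : r ≤ r + r + r
    r≤3r = m≤n+m r (r + r)

  baseT : Term LU n → Maybe (Fin n)
  baseT (var x)         = just x
  baseT (fn 𝟎 [])       = nothing
  baseT (fn 𝐒 (t ∷ [])) = baseT t

  depthT : Term LU n → ℕ
  depthT (var x)         = 0
  depthT (fn 𝟎 [])       = 0
  depthT (fn 𝐒 (t ∷ [])) = suc (depthT t)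

  evalT-place : ∀ (t : Term LU n) {ρ} → evalT t ρ ≡ place ρ (baseT t) ⊞ + depthT t
  evalT-place (var x) {ρ}     = sym (⊞-0 (ρ x))
  evalT-place (fn 𝟎 [])       = refl
  evalT-place (fn 𝐒 (t ∷ [])) {ρ} = trans (cong (_⊞ 1ℤ) (evalT-place t)) (trans (⊞-assoc (place ρ (baseT t)) (+ depthT t) 1ℤ)
    (cong (λ k → place ρ (baseT t) ⊞ + k) (+-comm (depthT t) 1)))

  rank : Formula LU n → ℕ
  rank ⊥'               = 0
  rank (t ≐ u)          = depthT u + depthT t
  rank (rel 𝐏 (t ∷ [])) = depthT t
  rank (φ ⇒ ψ)          = rank φ ⊔ rank ψ
  rank (∀' φ)           = rank φ + rank φ + rank φ

  transfer : ∀ (φ : Formula LU n) {ρ ρ′} → Agree (rank φ) ρ ρ′ → ⊨ φ ρ → ⊨ φ ρ′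
  transfer (t ≐ u) {ρ} {ρ′} (h , _) eq = trans (evalT-place t) (trans
    (⊞-undifference (place ρ′ (baseT t)) (place ρ′ (baseT u)) (+ depthT t) (+ depthT u) (near h (baseT t) (baseT u) _ (ℤ.∣i-j∣≤∣i∣+∣j∣ (+ depthT u) (+ depthT t))
      (⊞-difference (place ρ (baseT t)) (place ρ (baseT u)) (+ depthT t) (+ depthT u) (trans (sym (evalT-place t)) (trans eq (evalT-place u))))))
    (sym (evalT-place u)))
  transfer (rel 𝐏 (t ∷ [])) {ρ} {ρ′} (h , _) c = subst (Colour ∘ proj₂) (sym (evalT-place t {ρ′}))
    (colour h (baseT t) (+ depthT t) ≤-refl (subst (Colour ∘ proj₂) (evalT-place t {ρ}) c))
  transfer (φ ⇒ ψ) a f p = transfer ψ (Agree-mono (m≤n⊔m (rank φ) (rank ψ)) a)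
    (f (transfer φ (swap (Agree-mono (m≤m⊔n (rank φ) (rank ψ)) a)) p))
  transfer (∀' φ) a f x′ = let (x , a′) = forth (swap a) x′ in transfer φ (swap a′) (f x)

-- R is not interpretable in U

¬¬-Fin : {P : Fin n → Set} → (∀ i → ¬ ¬ P i) → ¬ ¬ (∀ i → P i)
¬¬-Fin {zero}  h ¬all = ¬all λ ()
¬¬-Fin {suc n} h ¬all = h zero λ p → ¬¬-Fin (h ∘ suc) λ ps → ¬all λ { zero → p ; (suc i) → ps i }

bit : {X : Set} → Dec X → Fin 2
bit (yes _) = zero
bit (no _)  = suc zero

bit-transport : ∀ {X Y : Set} (x : Dec X) (y : Dec Y) → bit x ≡ bit y → X → Y
bit-transport (yes _) (yes q) _  _ = q
bit-transport (no ¬p) _       _  p = contradiction p ¬p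

bit-no : ∀ {X Y : Set} (x : Dec X) (y : Dec Y) → bit x ≡ bit y → ¬ (X × Y) → ¬ X × ¬ Y
bit-no (yes p) (yes q) _  h = contradiction (p , q) h
bit-no (no ¬p) (no ¬q) _  h = ¬p , ¬q

same-residue : ∀ N .{{_ : Data.Nat.NonZero N}} z w → z ℤ.%ℕ N ≡ w ℤ.%ℕ N → ∣ z ℤ.- w ∣ < N → z ≡ w
same-residue N z w eq small = ℤ.i-j≡0⇒i≡j z w (trans difference (cong (ℤ._* + N) (ℤ.∣i∣≡0⇒i≡0 {q} quotient≡0)))
  where
  q = z ℤ./ℕ N ℤ.- w ℤ./ℕ N
  difference : z ℤ.- w ≡ q ℤ.* + N
  difference = begin
    z ℤ.- w                                                                          ≡⟨ cong₂ ℤ._-_ (a≡a%ℕn+[a/ℕn]*n z N) (a≡a%ℕn+[a/ℕn]*n w N) ⟩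
    + (z ℤ.%ℕ N) ℤ.+ z ℤ./ℕ N ℤ.* + N ℤ.- (+ (w ℤ.%ℕ N) ℤ.+ w ℤ./ℕ N ℤ.* + N)        ≡⟨ cong (λ r → + r ℤ.+ z ℤ./ℕ N ℤ.* + N ℤ.- (+ (w ℤ.%ℕ N) ℤ.+ w ℤ./ℕ N ℤ.* + N)) eq ⟩
    + (w ℤ.%ℕ N) ℤ.+ z ℤ./ℕ N ℤ.* + N ℤ.- (+ (w ℤ.%ℕ N) ℤ.+ w ℤ./ℕ N ℤ.* + N)        ≡⟨ collect (+ (w ℤ.%ℕ N)) (z ℤ./ℕ N) (w ℤ./ℕ N) (+ N) ⟩
    q ℤ.* + N                                                                        ∎
    where
    open ≡-Reasoning
    collect : ∀ r a b N → r ℤ.+ a ℤ.* N ℤ.- (r ℤ.+ b ℤ.* N) ≡ (a ℤ.- b) ℤ.* N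
    collect = ℤ-solve-∀
  quotient≡0 : ∣ q ∣ ≡ 0
  quotient≡0 = n<1⇒n≡0 (*-cancelʳ-< N ∣ q ∣ 1 (subst (_< 1 * N) (trans (cong ∣_∣ difference) (ℤ.∣i*j∣≡∣i∣*∣j∣ q (+ N)))
    (subst (∣ z ℤ.- w ∣ <_) (sym (*-identityˡ N)) small)))

module _ {A B : ℕ → Set} (disjoint : ∀ n → ¬ (A n × B n)) where

  Colour : ℤ → Set
  Colour (+ n)    = ¬ ¬ A n
  Colour -[1+ n ] = ⊥

  Colour-stable : ∀ {z} → ¬ ¬ Colour z → Colour z
  Colour-stable {+ n}      h = λ ¬a → h λ a → a ¬a
  Colour-stable { -[1+ n ]} h = h id

  open Chains Colour Colour-stable
  open Semantics chains

  evalT-numU : ∀ k {ρ : Fin n → Point} → evalT (numU k) ρ ≡ (0 , + k)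
  evalT-numU zero    = refl
  evalT-numU (suc k) = trans (cong (_⊞ 1ℤ) (evalT-numU k)) (cong (λ k → 0 , + k) (+-comm k 1))

  chains-model : ∀ φ → U A B φ → ⊨ φ ε
  chains-model _ (distinct {k} {l} k≢l) eq = k≢l (ℤ.+-injective (cong proj₂ (trans (sym (evalT-numU k)) (trans eq (evalT-numU l)))))
  chains-model _ (positive {n} a) = subst (Colour ∘ proj₂) (sym (evalT-numU n {ε})) λ ¬a → ¬a a
  chains-model _ (negative {n} b) p = subst (Colour ∘ proj₂) (evalT-numU n {ε}) p λ a → disjoint n (a , b)

  spread-half : ∀ {r x y} → Far r ε x → Far r ε y → (∀ d → ∣ d ∣ ≤ r → x ≢ y ⊞ d) →
                (∀ d → ∣ d ∣ ≤ r → Colour (proj₂ (x ⊞ d)) → Colour (proj₂ (y ⊞ d))) →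
                (∀ d → ∣ d ∣ ≤ r → Colour (proj₂ (y ⊞ d)) → Colour (proj₂ (x ⊞ d))) →
                Half r (x ▸ y ▸ ε) (y ▸ x ▸ ε)
  spread-half {r} {x} {y} far-x far-y apart x→y y→x = record { near = near ; colour = colour }
    where
    flipped : ∀ {u} v d → ∣ d ∣ ≤ r → u ≡ v ⊞ d → ¬ (∀ d → ∣ d ∣ ≤ r → v ≢ u ⊞ d)
    flipped v d d≤ eq h = h (ℤ.- d) (subst (_≤ r) (sym (ℤ.∣-i∣≡∣i∣ d)) d≤) (⊞-flip v d eq)
    fixed : ∀ u v d → u ≡ u ⊞ d → v ≡ v ⊞ d
    fixed (_ , z) v d eq = sym (trans (cong (v ⊞_) d≡0) (⊞-0 v))
      where
      cancel : ∀ z d → d ≡ z ℤ.+ d ℤ.- z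
      cancel = ℤ-solve-∀
      d≡0 : d ≡ 0ℤ
      d≡0 = trans (cancel z d) (trans (cong (ℤ._- z) (sym (cong proj₂ eq))) (ℤ.+-inverseʳ z))
    near : ∀ p q d → ∣ d ∣ ≤ r → place (x ▸ y ▸ ε) p ≡ place (x ▸ y ▸ ε) q ⊞ d → place (y ▸ x ▸ ε) p ≡ place (y ▸ x ▸ ε) q ⊞ d
    near nothing           nothing           d d≤ eq = eq
    near (just zero)       (just zero)       d d≤ eq = fixed x y d eq
    near (just (suc zero)) (just (suc zero)) d d≤ eq = fixed y x d eq
    near (just zero)       nothing           d d≤ eq = contradiction eq (far-x nothing d d≤)
    near (just (suc zero)) nothing           d d≤ eq = contradiction eq (far-y nothing d d≤)
    near nothing           (just zero)       d d≤ eq = contradiction (far-x nothing) (flipped x d d≤ eq)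
    near nothing           (just (suc zero)) d d≤ eq = contradiction (far-y nothing) (flipped y d d≤ eq)
    near (just zero)       (just (suc zero)) d d≤ eq = contradiction eq (apart d d≤)
    near (just (suc zero)) (just zero)       d d≤ eq = contradiction apart (flipped x d d≤ eq)
    colour : ∀ p d → ∣ d ∣ ≤ r → Colour (proj₂ (place (x ▸ y ▸ ε) p ⊞ d)) → Colour (proj₂ (place (y ▸ x ▸ ε) p ⊞ d))
    colour nothing           d d≤ c = c
    colour (just zero)       d d≤ c = x→y d d≤ c
    colour (just (suc zero)) d d≤ c = y→x d d≤ c

  module _ (r : ℕ) where

    Pattern : Point → Set
    Pattern (_ , z) = (j : Fin (suc r)) → Dec (Colour (z ℤ.+ + toℕ j)) × Dec (Colour (z ℤ.- + toℕ j))

    types : ℕ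
    types = (2 ^ suc r * 2 ^ suc r) * (suc (r + r) * 2)

    typeOf : ∀ x → Pattern x → Fin types
    typeOf x pat = combine
      (combine (funToFin (λ j → bit (proj₁ (pat j)))) (funToFin (λ j → bit (proj₂ (pat j)))))
      (combine (fromℕ< (n%ℕd<d (proj₂ x) (suc (r + r)))) (bit (close? r x origin)))

    -- Distinct points with the same residue modulo 2r + 1 are more than 2r
    -- apart, so of two such points at most one is close to the origin.
    same-type : ∀ x y (px : Pattern x) (py : Pattern y) → x ≢ y → typeOf x px ≡ typeOf y py →
                Agree r (x ▸ y ▸ ε) (y ▸ x ▸ ε)
    same-type x y px py x≢y eq =
      spread-half (far (proj₁ far-both)) (far (proj₂ far-both)) (apart x≢y same-z) x→y y→x ,
      spread-half (far (proj₂ far-both)) (far (proj₁ far-both)) (apart (x≢y ∘ sym) (λ d≤ → sym (same-z (subst (_≤ r + r) (ℤ.∣i-j∣≡∣j-i∣ (proj₂ y) (proj₂ x)) d≤)))) y→x x→y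
      where
      bits₁ = funToFin (λ j → bit (proj₁ (px j)))
      bits₂ = funToFin (λ j → bit (proj₂ (px j)))
      bits₁′ = funToFin (λ j → bit (proj₁ (py j)))
      bits₂′ = funToFin (λ j → bit (proj₂ (py j)))
      residue residue′ : Fin (suc (r + r))
      residue  = fromℕ< (n%ℕd<d (proj₂ x) (suc (r + r)))
      residue′ = fromℕ< (n%ℕd<d (proj₂ y) (suc (r + r)))
      flag flag′ : Fin 2
      flag  = bit (close? r x origin)
      flag′ = bit (close? r y origin)
      split = combine-injective (combine bits₁ bits₂) (combine residue flag) (combine bits₁′ bits₂′) (combine residue′ flag′) eq
      splitˡ = combine-injective bits₁ bits₂ bits₁′ bits₂′ (proj₁ split)
      splitʳ = combine-injective residue flag residue′ flag′ (proj₂ split)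
      bits⁺ : ∀ j → bit (proj₁ (px j)) ≡ bit (proj₁ (py j))
      bits⁺ j = trans (sym (finToFun-funToFin (λ j → bit (proj₁ (px j))) j))
        (trans (cong (λ c → finToFun c j) (proj₁ splitˡ)) (finToFun-funToFin (λ j → bit (proj₁ (py j))) j))
      bits⁻ : ∀ j → bit (proj₂ (px j)) ≡ bit (proj₂ (py j))
      bits⁻ j = trans (sym (finToFun-funToFin (λ j → bit (proj₂ (px j))) j))
        (trans (cong (λ c → finToFun c j) (proj₂ splitˡ)) (finToFun-funToFin (λ j → bit (proj₂ (py j))) j))
      same-z : ∣ proj₂ x ℤ.- proj₂ y ∣ ≤ r + r → proj₂ x ≡ proj₂ y
      same-z d≤ = same-residue (suc (r + r)) (proj₂ x) (proj₂ y) (fromℕ<-injective _ _ _ _ (proj₁ splitʳ)) (s≤s d≤)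
      apart : ∀ {u v} → u ≢ v → (∣ proj₂ u ℤ.- proj₂ v ∣ ≤ r + r → proj₂ u ≡ proj₂ v) →
              ∀ d → ∣ d ∣ ≤ r → u ≢ v ⊞ d
      apart {v = c , z} u≢v same-z d d≤ refl = u≢v (cong (c ,_) (same-z
        (≤-trans (≤-reflexive (cong ∣_∣ (cancel z d))) (≤-trans d≤ (m≤m+n r r)))))
        where
        cancel : ∀ z d → z ℤ.+ d ℤ.- z ≡ d
        cancel = ℤ-solve-∀
      far-both : ¬ (Σ[ d ∈ ℤ ] ∣ d ∣ ≤ r × x ≡ origin ⊞ d) × ¬ (Σ[ d ∈ ℤ ] ∣ d ∣ ≤ r × y ≡ origin ⊞ d)
      far-both = bit-no (close? r x origin) (close? r y origin) (proj₂ splitʳ)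
        λ { ((d , d≤ , refl) , (e , e≤ , refl)) → x≢y (cong (0 ,_) (same-z
          (≤-trans (≤-reflexive (cong₂ (λ d e → ∣ d ℤ.- e ∣) (ℤ.+-identityˡ d) (ℤ.+-identityˡ e)))
            (≤-trans (ℤ.∣i-j∣≤∣i∣+∣j∣ d e) (+-mono-≤ d≤ e≤))))) }
      far : ∀ {u} → ¬ (Σ[ d ∈ ℤ ] ∣ d ∣ ≤ r × u ≡ origin ⊞ d) → Far r ε u
      far ¬close nothing d d≤ eq = ¬close (d , d≤ , eq)
      pattern-transport : ∀ u v (pu : Pattern u) (pv : Pattern v) →
        (∀ j → bit (proj₁ (pu j)) ≡ bit (proj₁ (pv j))) → (∀ j → bit (proj₂ (pu j)) ≡ bit (proj₂ (pv j))) →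
        ∀ d → ∣ d ∣ ≤ r → Colour (proj₂ (u ⊞ d)) → Colour (proj₂ (v ⊞ d))
      pattern-transport (_ , z) (_ , w) pu pv e⁺ e⁻ (+ k) k≤ = subst (λ k → Colour (z ℤ.+ + k) → Colour (w ℤ.+ + k)) (toℕ-fromℕ< (s≤s k≤))
        (bit-transport (proj₁ (pu j)) (proj₁ (pv j)) (e⁺ j))
        where j = fromℕ< (s≤s k≤)
      pattern-transport (_ , z) (_ , w) pu pv e⁺ e⁻ -[1+ k ] k< = subst (λ k → Colour (z ℤ.- + k) → Colour (w ℤ.- + k)) (toℕ-fromℕ< (s≤s k<))
        (bit-transport (proj₂ (pu j)) (proj₂ (pv j)) (e⁻ j))
        where j = fromℕ< (s≤s k<)
      x→y = pattern-transport x y px py bits⁺ bits⁻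
      y→x = pattern-transport y x py px (λ j → sym (bits⁺ j)) (λ j → sym (bits⁻ j))

  R⋬U : ¬ (𝐑 ⊴ U A B)
  R⋬U (τ , int) = ¬¬-Fin {suc (types r)} (λ i → Num-exists (toℕ i)) λ numerals →
    ¬¬-Fin (λ i → pattern-exists (proj₁ (numerals i))) λ patterns →
      let (i , j , i<j , eq) = pigeonhole (n<1+n (types r)) (λ i → typeOf r (proj₁ (numerals i)) (patterns i))
          (x , dx , nx) = numerals i
          (y , dy , ny) = numerals j
          x≢y = λ x≡y → Num-distinct (<⇒≢ i<j) dx dy nx ny (subst (E x) x≡y (E-refl dx))
      in ⊑-numerals i<j dx nx dy ny λ x⊑y →
           ⋢ i<j dx nx dy ny (transfer (Translation.relᵗ τ leq) (same-type r x y (patterns i) (patterns j) x≢y eq) x⊑y)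
    where
    open InterpretedOrder chains chains-model τ int
    r = rank (Translation.relᵗ τ leq)
    pattern-exists : ∀ x → ¬ ¬ Pattern r x
    pattern-exists x = ¬¬-Fin λ j ¬p → ¬¬-excluded-middle λ p → ¬¬-excluded-middle λ q → ¬p (p , q)

mainTheorem6 : (A B : ℕ → Set) → RecursivelyInseparable A B →
    RETheory (U A B) × G1 (U A B) × (U A B ⊲ 𝐑)
mainTheorem6 A B insep =
  (recursive-LU , re-U re-A re-B) , G1-U insep , (U⊴R insep , R⋬U disjoint)
  where open RecursivelyInseparable insep
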